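{- For every $\epsilon>0$ there exist $\delta>0$ and $n_0$ such that for every $n\ge n_0$, every $n$-vertex graph with at most $\delta n^2$ copies of $C_4$ and at most $\delta n^{5/2}$ copies of $C_5$ can be made simultaneously $C_3$-free and $C_5$-free by deleting at most $\epsilon n^{3/2}$ edges.
   Context: $C_k$ denotes the cycle of length $k$; a copy of $C_k$ in a graph is a subgraph isomorphic to $C_k$. (The paper states this as: an $n$-vertex graph with $o(n^2)$ $C_4$'s and $o(n^{5/2})$ $C_5$'s can be made $\{C_3,C_5\}$-free by deleting $o(n^{3/2})$ edges.) -}

module Defs where

open import Data.Nat using (ℕ; zero; suc; _+_; _*_; _∸_; _^_; _/_)
open import Data.Fin using (Fin; zero; suc; _≟_)
open import Data.Bool using (Bool; true; false; _∧_; not)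
open import Data.Product using (Σ; _×_; _,_)
open import Relation.Nullary using (¬_)
open import Relation.Nullary.Decidable using (⌊_⌋)
open import Relation.Binary.PropositionalEquality using (_≡_)
open import Data.Integer using (+_)
import Data.Rational as ℚ

record Graph (n : ℕ) : Set where
  field
    adj    : Fin n → Fin n → Bool
    sym    : ∀ i j → adj i j ≡ adj j i
    irrefl : ∀ i → adj i i ≡ false
open Graph public

Σ[_] : ∀ n → (Fin n → ℕ) → ℕ
Σ[ zero ] f = 0
Σ[ suc n ] f = f zero + Σ[ n ] (λ i → f (suc i))

ind : Bool → ℕ
ind true = 1
ind false = 0

_≠ᵇ_ : ∀ {n} → Fin n → Fin n → Bool
a ≠ᵇ b = not ⌊ a ≟ b ⌋

_<ᵇ_ : ∀ {n} → Fin n → Fin n → Bool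
a <ᵇ b = ⌊ Data.Fin._<?_ a b ⌋

edges : ∀ {n} → Graph n → ℕ
edges {n} G = Σ[ n ] λ i → Σ[ n ] λ j → ind ((i <ᵇ j) ∧ adj G i j)

_⊆ᴳ_ : ∀ {n} → Graph n → Graph n → Set
H ⊆ᴳ G = ∀ i j → adj H i j ≡ true → adj G i j ≡ true

cyc4 : ∀ {n} → Graph n → (a b c d : Fin n) → Bool
cyc4 G a b c d =
  (adj G a b ∧ adj G b c ∧ adj G c d ∧ adj G d a) ∧
  ((a ≠ᵇ b) ∧ (a ≠ᵇ c) ∧ (a ≠ᵇ d) ∧ (b ≠ᵇ c) ∧ (b ≠ᵇ d) ∧ (c ≠ᵇ d))

cyc5 : ∀ {n} → Graph n → (a b c d e : Fin n) → Bool
cyc5 G a b c d e =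
  (adj G a b ∧ adj G b c ∧ adj G c d ∧ adj G d e ∧ adj G e a) ∧
  ((a ≠ᵇ b) ∧ (a ≠ᵇ c) ∧ (a ≠ᵇ d) ∧ (a ≠ᵇ e) ∧ (b ≠ᵇ c) ∧
   (b ≠ᵇ d) ∧ (b ≠ᵇ e) ∧ (c ≠ᵇ d) ∧ (c ≠ᵇ e) ∧ (d ≠ᵇ e))

-- number of copies of C4 (subgraphs isomorphic to C4): each copy corresponds
-- to exactly 8 = |Aut C4| labelled 4-cycles
copiesC4 : ∀ {n} → Graph n → ℕ
copiesC4 {n} G =
  (Σ[ n ] λ a → Σ[ n ] λ b → Σ[ n ] λ c → Σ[ n ] λ d → ind (cyc4 G a b c d)) / 8

-- number of copies of C5: each copy corresponds to 10 = |Aut C5| labelled 5-cycles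
copiesC5 : ∀ {n} → Graph n → ℕ
copiesC5 {n} G =
  (Σ[ n ] λ a → Σ[ n ] λ b → Σ[ n ] λ c → Σ[ n ] λ d → Σ[ n ] λ e →
     ind (cyc5 G a b c d e)) / 10

-- C3-free: no triangle a~b~c~a (vertices are automatically distinct by irreflexivity)
C3-free : ∀ {n} → Graph n → Set
C3-free G = ∀ a b c → ¬ (adj G a b ∧ adj G b c ∧ adj G c a ≡ true)

C5-free : ∀ {n} → Graph n → Set
C5-free G = ∀ a b c d e → ¬ (cyc5 G a b c d e ≡ true)

ℕ→ℚ : ℕ → ℚ.ℚ
ℕ→ℚ k = + k ℚ./ 1

{-# OPTIONS --safe #-}

-- Let s ≈ √n and call a 0/1 matrix R a lower model of the graph if C s e(X,Y) ≥ e_R(X,Y) - n²/E for all vertex sets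
-- X and Y.  Starting from the all-ones matrix, cut violating rectangles out of R.  The edges of the graph lost in
-- this way are paid for by the lost area of R, so few are lost in total, and after at most E cuts R is a lower model
-- that is constant on pairs of cells of a bounded partition.  Repeat with E depending on the number of cells reached
-- so far, until a new model R′ has almost the same area as the old model R.  Keep the edges between large cells of
-- the old partition on which R is 1 and R′ has density at least 9/10; since few C4's force every union of cell pairs
-- of small area to carry few edges, few edges are dropped.
--
-- If the kept edges contained a closed walk of length 5 (hence if they contained a triangle or a C5), the five cells
-- that it visits would carry a positive proportion of all possible closed 5-walks in R′.  Replace the entries of R′
-- in these walks by edges of the graph, one factor at a time.  As there are few C4's, the number of paths of length 2
-- between two vertices is a 0/1 function up to a small error, so the remaining factors are bounded functions to which
-- the lower model property applies.  Hence the graph has many closed 5-walks, nearly all of them genuine C5's.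
module Submission where

open import Defs hiding (sym)
open import Data.Bool using (Bool; true; false; not; _∧_)
open import Data.Bool.Properties using (∧-comm)
open import Data.Empty using (⊥; ⊥-elim)
open import Data.Fin using (Fin; zero; suc)
import Data.Fin as F
open import Data.Fin.Properties using (inject≤-injective; combine-injective)
open import Data.Fin.Subset.Properties using (anySubset?)
open import Data.Integer using (-[1+_]) renaming (+_ to ℤpos)
import Data.Integer as ℤ
import Data.Integer.Properties as ℤ
open import Data.Nat hiding (_<ᵇ_)
open import Data.Nat.DivMod using (m≡m%n+[m/n]*n; m%n<n)
open import Data.Nat.Properties
open import Data.Nat.Tactic.RingSolver using (solve-∀)
open import Data.Product using (Σ-syntax; ∃-syntax; _×_; _,_; proj₁; proj₂)
open import Data.Rational using (ℚ; mkℚ; 0ℚ; toℚᵘ; fromℚᵘ)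
import Data.Rational as ℚ
import Data.Rational.Properties as ℚ
open import Data.Rational.Unnormalised using (mkℚᵘ; *≤*)
import Data.Rational.Unnormalised as ℚᵘ
import Data.Rational.Unnormalised.Properties as ℚᵘ
open import Data.Sum using (_⊎_; inj₁; inj₂)
open import Data.Vec using (lookup; tabulate)
open import Data.Vec.Properties using (lookup∘tabulate)
open import Relation.Binary.PropositionalEquality using (_≡_; refl; sym; trans; cong; cong₂; subst; subst₂; ≢-sym; module ≡-Reasoning)
open import Relation.Nullary using (Dec; ¬_)
open import Relation.Nullary.Decidable using (⌊_⌋; yes; no)

-- Two obstacles shape the argument. If the cells have at least n / L vertices, the precision E has
-- to exceed a multiple of L^5, yet the number of cells is known only once a precision has been
-- fixed. Hence two models: the cells come from the older one, domination from the newer one, whose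
-- E was chosen with these cells in view, and the almost unchanged area makes the two compatible.
-- The second obstacle is that every edge put in place of an entry of the model brings a weight of
-- order √n, so the errors of later replacements count more. After j replacements, the entry bounds
-- of the two remaining sides of the walk may have a product of order at most n^(2 - j/2). Sides
-- containing a single edge meet this thanks to a cap of order √n on the degrees. It is imposed
-- beforehand and costs few edges, as few C4's bound the sum of the squared degrees. Sides
-- containing two edges have to be truncated at 1.

-- Finite sums

Σ-cong : ∀ {n} {f g : Fin n → ℕ} → (∀ i → f i ≡ g i) → Σ[ n ] f ≡ Σ[ n ] g
Σ-cong {zero} h = refl
Σ-cong {suc n} h = cong₂ _+_ (h zero) (Σ-cong (λ i → h (suc i)))

Σ-mono : ∀ {n} {f g : Fin n → ℕ} → (∀ i → f i ≤ g i) → Σ[ n ] f ≤ Σ[ n ] g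
Σ-mono {zero} h = z≤n
Σ-mono {suc n} h = +-mono-≤ (h zero) (Σ-mono (λ i → h (suc i)))

interchange : ∀ a b c d → (a + b) + (c + d) ≡ (a + c) + (b + d)
interchange = solve-∀

Σ-+ : ∀ {n} (f g : Fin n → ℕ) → Σ[ n ] (λ i → f i + g i) ≡ Σ[ n ] f + Σ[ n ] g
Σ-+ {zero} f g = refl
Σ-+ {suc n} f g = trans (cong (f zero + g zero +_) (Σ-+ (λ i → f (suc i)) (λ i → g (suc i))))
  (interchange (f zero) (g zero) _ _)

Σ-*ˡ : ∀ {n} k (f : Fin n → ℕ) → Σ[ n ] (λ i → k * f i) ≡ k * Σ[ n ] f
Σ-*ˡ {zero} k f = sym (*-zeroʳ k)
Σ-*ˡ {suc n} k f = trans (cong (k * f zero +_) (Σ-*ˡ k (λ i → f (suc i)))) (sym (*-distribˡ-+ k (f zero) _))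

Σ-*ʳ : ∀ {n} (f : Fin n → ℕ) k → Σ[ n ] (λ i → f i * k) ≡ Σ[ n ] f * k
Σ-*ʳ f k = trans (Σ-cong (λ i → *-comm (f i) k)) (trans (Σ-*ˡ k f) (*-comm k _))

Σ-const : ∀ n k → Σ[ n ] (λ _ → k) ≡ n * k
Σ-const zero k = refl
Σ-const (suc n) k = cong (k +_) (Σ-const n k)

Σ-≤ : ∀ {n} {f : Fin n → ℕ} {k} → (∀ i → f i ≤ k) → Σ[ n ] f ≤ n * k
Σ-≤ {n} {f} {k} h = subst (Σ[ n ] f ≤_) (Σ-const n k) (Σ-mono h)

Σ-swap : ∀ {n m} (f : Fin n → Fin m → ℕ) →
  Σ[ n ] (λ i → Σ[ m ] (f i)) ≡ Σ[ m ] (λ j → Σ[ n ] (λ i → f i j))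
Σ-swap {zero} {m} f = sym (trans (Σ-const m 0) (*-zeroʳ m))
Σ-swap {suc n} {m} f = trans (cong (Σ[ m ] (f zero) +_) (Σ-swap (λ i → f (suc i))))
  (sym (Σ-+ (f zero) (λ j → Σ[ n ] (λ i → f (suc i) j))))

Σ-term : ∀ {n} (f : Fin n → ℕ) i → f i ≤ Σ[ n ] f
Σ-term f zero = m≤m+n _ _
Σ-term f (suc i) = ≤-trans (Σ-term (λ j → f (suc j)) i) (m≤n+m _ _)

Σ-* : ∀ {n m} (f : Fin n → ℕ) (g : Fin m → ℕ) →
  Σ[ n ] (λ i → Σ[ m ] (λ j → f i * g j)) ≡ Σ[ n ] f * Σ[ m ] g
Σ-* {n} {m} f g = trans (Σ-cong (λ i → Σ-*ˡ (f i) g)) (Σ-*ʳ f (Σ[ m ] g))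

Σ-δ : ∀ {n} (j : Fin n) (f : Fin n → ℕ) → Σ[ n ] (λ i → ind ⌊ j F.≟ i ⌋ * f i) ≡ f j
Σ-δ {suc n} zero f = trans (cong₂ _+_ (*-identityˡ (f zero)) (trans (Σ-const n 0) (*-zeroʳ n))) (+-identityʳ _)
Σ-δ {suc n} (suc j) f = trans (Σ-cong step) (Σ-δ j (λ i → f (suc i)))
  where
  step : ∀ i → ind ⌊ suc j F.≟ suc i ⌋ * f (suc i) ≡ ind ⌊ j F.≟ i ⌋ * f (suc i)
  step i with j F.≟ i
  ... | yes refl = refl
  ... | no _ = refl

-- Matrices

Mat : ℕ → Set
Mat n = Fin n → Fin n → ℕ

infixr 7 _⊙_
_⊙_ : ∀ {n} → Mat n → Mat n → Mat n
_⊙_ {n} P Q x z = Σ[ n ] λ y → P x y * Q y z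

infix 4 _≐_ _≼_ _≼ᶜ_
_≐_ _≼_ : ∀ {n} → Mat n → Mat n → Set
P ≐ Q = ∀ x y → P x y ≡ Q x y
P ≼ Q = ∀ x y → P x y ≤ Q x y

_≼ᶜ_ : ∀ {n} → Mat n → ℕ → Set
P ≼ᶜ k = ∀ x y → P x y ≤ k

infixl 6 _⊕_
_⊕_ : ∀ {n} → Mat n → Mat n → Mat n
(P ⊕ Q) x y = P x y + Q x y

total tr : ∀ {n} → Mat n → ℕ
total {n} P = Σ[ n ] λ x → Σ[ n ] λ y → P x y
tr {n} P = Σ[ n ] λ x → P x x

⊙-assoc : ∀ {n} (P Q S : Mat n) → (P ⊙ Q) ⊙ S ≐ P ⊙ (Q ⊙ S)
⊙-assoc {n} P Q S x z = begin
  Σ[ n ] (λ y → Σ[ n ] (λ w → P x w * Q w y) * S y z)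
    ≡⟨ Σ-cong (λ y → sym (Σ-*ʳ (λ w → P x w * Q w y) (S y z))) ⟩
  Σ[ n ] (λ y → Σ[ n ] (λ w → P x w * Q w y * S y z))
    ≡⟨ Σ-swap (λ y w → P x w * Q w y * S y z) ⟩
  Σ[ n ] (λ w → Σ[ n ] (λ y → P x w * Q w y * S y z))
    ≡⟨ Σ-cong (λ w → trans (Σ-cong (λ y → *-assoc (P x w) (Q w y) (S y z))) (Σ-*ˡ (P x w) (λ y → Q w y * S y z))) ⟩
  Σ[ n ] (λ w → P x w * Σ[ n ] (λ y → Q w y * S y z)) ∎
  where open ≡-Reasoning

⊙-cong : ∀ {n} {P P′ Q Q′ : Mat n} → P ≐ P′ → Q ≐ Q′ → P ⊙ Q ≐ P′ ⊙ Q′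
⊙-cong p q x z = Σ-cong (λ y → cong₂ _*_ (p x y) (q y z))

⊙-mono : ∀ {n} {P P′ Q Q′ : Mat n} → P ≼ P′ → Q ≼ Q′ → P ⊙ Q ≼ P′ ⊙ Q′
⊙-mono p q x z = Σ-mono (λ y → *-mono-≤ (p x y) (q y z))

⊙-distribʳ : ∀ {n} (P Q S : Mat n) → (P ⊕ Q) ⊙ S ≐ (P ⊙ S) ⊕ (Q ⊙ S)
⊙-distribʳ P Q S x z = trans (Σ-cong (λ y → *-distribʳ-+ (S y z) (P x y) (Q x y)))
  (Σ-+ (λ y → P x y * S y z) (λ y → Q x y * S y z))

tr-cong : ∀ {n} {P Q : Mat n} → P ≐ Q → tr P ≡ tr Q
tr-cong h = Σ-cong (λ x → h x x)

tr-mono : ∀ {n} {P Q : Mat n} → P ≼ Q → tr P ≤ tr Q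
tr-mono h = Σ-mono (λ x → h x x)

tr-⊕ : ∀ {n} (P Q : Mat n) → tr (P ⊕ Q) ≡ tr P + tr Q
tr-⊕ P Q = Σ-+ (λ x → P x x) (λ x → Q x x)

tr-comm : ∀ {n} (P Q : Mat n) → tr (P ⊙ Q) ≡ tr (Q ⊙ P)
tr-comm P Q = trans (Σ-swap (λ x y → P x y * Q y x)) (Σ-cong (λ y → Σ-cong (λ x → *-comm (P x y) (Q y x))))

≐-sym : ∀ {n} {P Q : Mat n} → P ≐ Q → Q ≐ P
≐-sym h x y = sym (h x y)

≼-refl : ∀ {n} {P : Mat n} → P ≼ P
≼-refl x y = ≤-refl

⊙-≼ᶜ : ∀ {n} {P Q : Mat n} {j k} → P ≼ᶜ j → Q ≼ᶜ k → P ⊙ Q ≼ᶜ n * (j * k)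
⊙-≼ᶜ p q x z = Σ-≤ (λ y → *-mono-≤ (p x y) (q y z))

⊙-rowBound : ∀ {n} {P Q : Mat n} {m} → (∀ x → Σ[ n ] (P x) ≤ m) → Q ≼ᶜ 1 → P ⊙ Q ≼ᶜ m
⊙-rowBound {P = P} {Q} p q x z = ≤-trans
  (Σ-mono (λ y → ≤-trans (*-monoʳ-≤ (P x y) (q y z)) (≤-reflexive (*-identityʳ _)))) (p x)

⊙-colBound : ∀ {n} {P Q : Mat n} {m} → P ≼ᶜ 1 → (∀ z → Σ[ n ] (λ y → Q y z) ≤ m) → P ⊙ Q ≼ᶜ m
⊙-colBound {P = P} {Q} p q x z = ≤-trans
  (Σ-mono (λ y → ≤-trans (*-monoˡ-≤ (Q y z) (p x y)) (≤-reflexive (*-identityˡ _)))) (q z)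

tr-total : ∀ {n} {P Q : Mat n} {k} → Q ≼ᶜ k → tr (P ⊙ Q) ≤ total P * k
tr-total {n} {P} {Q} {k} q = begin
  Σ[ n ] (λ x → Σ[ n ] (λ y → P x y * Q y x)) ≤⟨ Σ-mono (λ x → Σ-mono (λ y → *-monoʳ-≤ (P x y) (q y x))) ⟩
  Σ[ n ] (λ x → Σ[ n ] (λ y → P x y * k))     ≡⟨ Σ-cong (λ x → Σ-*ʳ (P x) k) ⟩
  Σ[ n ] (λ x → Σ[ n ] (P x) * k)             ≡⟨ Σ-*ʳ (λ x → Σ[ n ] (P x)) k ⟩
  total P * k ∎
  where open ≤-Reasoning

-- The counting lemma

form : ∀ {n} → Mat n → (f g : Fin n → ℕ) → ℕ
form {n} P f g = Σ[ n ] λ x → f x * Σ[ n ] λ y → P x y * g y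

-- One half of a cut-norm approximation, cleared of denominators. The weight `q` will be of order
-- √n, the ratio of n^2 pairs to n^(3/2) edges. Only a lower bound for `a` is imposed, in keeping
-- with the aim of bounding closed walks from below.
record Dominates {n} (E q : ℕ) (a r : Mat n) : Set where
  field
    on-rectangles : ∀ (X Y : Fin n → Bool) →
      E * form r (λ x → ind (X x)) (λ y → ind (Y y))
        ≤ E * (q * form a (λ x → ind (X x)) (λ y → ind (Y y))) + n * n

open Dominates

positive : ℕ → Bool
positive zero = false
positive (suc _) = true

positive+pred : ∀ k → ind (positive k) + pred k ≡ k
positive+pred zero = refl
positive+pred (suc k) = refl

form-transpose : ∀ {n} (P : Mat n) f g → form P f g ≡ form (λ y x → P x y) g f
form-transpose {n} P f g = begin
  Σ[ n ] (λ x → f x * Σ[ n ] (λ y → P x y * g y)) ≡⟨ Σ-cong (λ x → sym (Σ-*ˡ (f x) (λ y → P x y * g y))) ⟩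
  Σ[ n ] (λ x → Σ[ n ] (λ y → f x * (P x y * g y))) ≡⟨ Σ-swap (λ x y → f x * (P x y * g y)) ⟩
  Σ[ n ] (λ y → Σ[ n ] (λ x → f x * (P x y * g y)))
    ≡⟨ Σ-cong (λ y → trans (Σ-cong (λ x → rearrange (f x) (P x y) (g y))) (Σ-*ˡ (g y) (λ x → P x y * f x))) ⟩
  Σ[ n ] (λ y → g y * Σ[ n ] (λ x → P x y * f x)) ∎
  where
  open ≡-Reasoning
  rearrange : ∀ u v w → u * (v * w) ≡ w * (v * u)
  rearrange = solve-∀

-- A function with values in {0,…,φ} is a sum of φ indicator functions.
layers : ∀ {n} (u w : Fin n → ℕ) k →
  (∀ X → Σ[ n ] (λ x → ind (X x) * u x) ≤ Σ[ n ] (λ x → ind (X x) * w x) + k) →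
  ∀ φ f → (∀ x → f x ≤ φ) → Σ[ n ] (λ x → f x * u x) ≤ Σ[ n ] (λ x → f x * w x) + φ * k
layers {n} u w k h zero f b = ≤-trans (≤-trans (Σ-≤ {k = 0} zeroTerm) (≤-reflexive (*-zeroʳ n))) z≤n
  where
  zeroTerm : ∀ x → f x * u x ≤ 0
  zeroTerm x = *-monoˡ-≤ (u x) (b x)
layers {n} u w k h (suc φ) f b = begin
  Σ[ n ] (λ x → f x * u x) ≡⟨ split u ⟩
  Σ[ n ] (λ x → ind (positive (f x)) * u x) + Σ[ n ] (λ x → pred (f x) * u x)
    ≤⟨ +-mono-≤ (h (λ x → positive (f x))) (layers u w k h φ (λ x → pred (f x)) (λ x → pred-mono-≤ (b x))) ⟩
  (Σ[ n ] (λ x → ind (positive (f x)) * w x) + k) + (Σ[ n ] (λ x → pred (f x) * w x) + φ * k)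
    ≡⟨ interchange (Σ[ n ] (λ x → ind (positive (f x)) * w x)) k _ (φ * k) ⟩
  (Σ[ n ] (λ x → ind (positive (f x)) * w x) + Σ[ n ] (λ x → pred (f x) * w x)) + (k + φ * k)
    ≡⟨ cong (_+ (k + φ * k)) (sym (split w)) ⟩
  Σ[ n ] (λ x → f x * w x) + suc φ * k ∎
  where
  open ≤-Reasoning
  split : ∀ v → Σ[ n ] (λ x → f x * v x) ≡ Σ[ n ] (λ x → ind (positive (f x)) * v x) + Σ[ n ] (λ x → pred (f x) * v x)
  split v = trans
    (Σ-cong (λ x → trans (cong (_* v x) (sym (positive+pred (f x)))) (*-distribʳ-+ (v x) (ind (positive (f x))) (pred (f x)))))
    (Σ-+ (λ x → ind (positive (f x)) * v x) (λ x → pred (f x) * v x))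

pull : ∀ {n} c (f u : Fin n → ℕ) → Σ[ n ] (λ x → f x * (c * u x)) ≡ c * Σ[ n ] (λ x → f x * u x)
pull c f u = trans (Σ-cong (λ x → rearrange (f x) c (u x))) (Σ-*ˡ c (λ x → f x * u x))
  where
  rearrange : ∀ u v w → u * (v * w) ≡ v * (u * w)
  rearrange = solve-∀

layers-form : ∀ {n} (E q k : ℕ) (a r : Mat n) g →
  (∀ X → E * form r (λ x → ind (X x)) g ≤ E * (q * form a (λ x → ind (X x)) g) + k) →
  ∀ φ f → (∀ x → f x ≤ φ) → E * form r f g ≤ E * (q * form a f g) + φ * k
layers-form {n} E q k a r g h φ f b =
  subst₂ (λ s t → s ≤ t + φ * k) (pull E f u) (trans (pull E f _) (cong (E *_) (pull q f w)))
    (layers (λ x → E * u x) (λ x → E * (q * w x)) k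
      (λ X → subst₂ (λ s t → s ≤ t + k) (sym (pull E (λ x → ind (X x)) u))
        (sym (trans (pull E (λ x → ind (X x)) _) (cong (E *_) (pull q (λ x → ind (X x)) w)))) (h X)) φ f b)
  where
  u w : Fin n → ℕ
  u x = Σ[ n ] λ y → r x y * g y
  w x = Σ[ n ] λ y → a x y * g y

-- The layers of `g` are treated through the transposed form, then those of `f`; each of the φ * γ
-- pairs of layers pays n * n once.
dominates-form : ∀ {n E q} {a r : Mat n} → Dominates E q a r →
  ∀ {φ γ} f g → (∀ x → f x ≤ φ) → (∀ y → g y ≤ γ) →
  E * form r f g ≤ E * (q * form a f g) + φ * (γ * (n * n))
dominates-form {n} {E} {q} {a} {r} dom {φ} {γ} f g bf bg =
  layers-form E q (γ * (n * n)) a r g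
    (λ X → let 1X = λ x → ind (X x) in subst₂ (λ s t → E * s ≤ E * (q * t) + γ * (n * n))
      (sym (form-transpose r 1X g)) (sym (form-transpose a 1X g))
      (layers-form E q (n * n) (λ y x → a x y) (λ y x → r x y) (λ x → ind (X x))
        (λ Y → subst₂ (λ s t → E * s ≤ E * (q * t) + n * n) (form-transpose r 1X (λ y → ind (Y y))) (form-transpose a 1X (λ y → ind (Y y))) (on-rectangles dom X Y))
        γ g bg))
    φ f bf

-- Each diagonal entry is a bilinear form in a row of `P` and a column of `Q`, so the error of
-- `dominates-form` occurs n times.
dominates-tr : ∀ {n E q} {a r : Mat n} → Dominates E q a r →
  ∀ {φ γ} (P Q : Mat n) → P ≼ᶜ φ → Q ≼ᶜ γ →
  E * tr (P ⊙ (r ⊙ Q)) ≤ E * (q * tr (P ⊙ (a ⊙ Q))) + n * (φ * (γ * (n * n)))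
dominates-tr {n} {E} {q} {a} {r} dom {φ} {γ} P Q bP bQ = begin
  E * Σ[ n ] (λ z → form r (P z) (λ y → Q y z)) ≡⟨ sym (Σ-*ˡ E (λ z → form r (P z) (λ y → Q y z))) ⟩
  Σ[ n ] (λ z → E * form r (P z) (λ y → Q y z))
    ≤⟨ Σ-mono (λ z → dominates-form dom (P z) (λ y → Q y z) (bP z) (λ y → bQ y z)) ⟩
  Σ[ n ] (λ z → E * (q * form a (P z) (λ y → Q y z)) + φ * (γ * (n * n))) 
    ≡⟨ Σ-+ (λ z → E * (q * form a (P z) (λ y → Q y z))) (λ z → φ * (γ * (n * n))) ⟩
  Σ[ n ] (λ z → E * (q * form a (P z) (λ y → Q y z))) + Σ[ n ] (λ z → φ * (γ * (n * n)))
    ≡⟨ cong₂ _+_ (trans (Σ-*ˡ E (λ z → q * form a (P z) (λ y → Q y z))) (cong (E *_) (Σ-*ˡ q (λ z → form a (P z) (λ y → Q y z))))) (Σ-const n _) ⟩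
  E * (q * tr (P ⊙ (a ⊙ Q))) + n * (φ * (γ * (n * n))) ∎
  where open ≤-Reasoning

⊙-congʳ : ∀ {n} (P : Mat n) {Q Q′ : Mat n} → Q ≐ Q′ → P ⊙ Q ≐ P ⊙ Q′
⊙-congʳ P h x z = Σ-cong (λ y → cong (P x y *_) (h y z))

⊙-monoʳ : ∀ {n} (P : Mat n) {Q Q′ : Mat n} → Q ≼ Q′ → P ⊙ Q ≼ P ⊙ Q′
⊙-monoʳ P h x z = Σ-mono (λ y → *-monoʳ-≤ (P x y) (h y z))

⊙-distribˡ : ∀ {n} (P Q S : Mat n) → P ⊙ (Q ⊕ S) ≐ (P ⊙ Q) ⊕ (P ⊙ S)
⊙-distribˡ P Q S x z = trans (Σ-cong (λ y → *-distribˡ-+ (P x y) (Q y z) (S y z)))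
  (Σ-+ (λ y → P x y * Q y z) (λ y → P x y * S y z))

tr-assoc : ∀ {n} (P Q S : Mat n) → tr ((P ⊙ Q) ⊙ S) ≡ tr (P ⊙ (Q ⊙ S))
tr-assoc P Q S = tr-cong (⊙-assoc P Q S)

-- The error `e′` of a later replacement is multiplied by the weight `c` gathered so far. This
-- growth dictates the order of the replacements in `closed5-lower`.
chain-dominate : ∀ E c q e e′ S S₁ S₂ → E * S ≤ E * (c * S₁) + e → E * S₁ ≤ E * (q * S₂) + e′ →
  E * S ≤ E * (c * q * S₂) + (e + c * e′)
chain-dominate E c q e e′ S S₁ S₂ h h′ = begin
  E * S                          ≤⟨ h ⟩
  E * (c * S₁) + e               ≡⟨ cong (_+ e) (eq₁ E c S₁) ⟩
  c * (E * S₁) + e               ≤⟨ +-monoˡ-≤ e (*-monoʳ-≤ c h′) ⟩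
  c * (E * (q * S₂) + e′) + e    ≡⟨ eq₂ E c q S₂ e e′ ⟩
  E * (c * q * S₂) + (e + c * e′) ∎
  where
  open ≤-Reasoning
  eq₁ : ∀ E c S₁ → E * (c * S₁) ≡ c * (E * S₁)
  eq₁ = solve-∀
  eq₂ : ∀ E c q S₂ e e′ → c * (E * (q * S₂) + e′) + e ≡ E * (c * q * S₂) + (e + c * e′)
  eq₂ = solve-∀

chain-split : ∀ E c e x S S₁ S₂ → E * S ≤ E * (c * S₁) + e → S₁ ≤ S₂ + x →
  E * S ≤ E * (c * S₂) + (e + E * (c * x))
chain-split E c e x S S₁ S₂ h h′ = begin
  E * S                             ≤⟨ h ⟩
  E * (c * S₁) + e                  ≤⟨ +-monoˡ-≤ e (*-monoʳ-≤ E (*-monoʳ-≤ c h′)) ⟩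
  E * (c * (S₂ + x)) + e            ≡⟨ eq E c S₂ x e ⟩
  E * (c * S₂) + (e + E * (c * x))  ∎
  where
  open ≤-Reasoning
  eq : ∀ E c S₂ x e → E * (c * (S₂ + x)) + e ≡ E * (c * S₂) + (e + E * (c * x))
  eq = solve-∀

module _ {n : ℕ} (a : Mat n) where

  codeg excess simple : Mat n
  codeg = a ⊙ a
  excess x y = codeg x y ∸ 1
  simple x y = codeg x y ⊓ 1

  closed5 : ℕ
  closed5 = tr (codeg ⊙ (a ⊙ codeg))

  codeg-split : codeg ≼ (simple ⊕ excess)
  codeg-split x y = lem (codeg x y)
    where
    lem : ∀ k → k ≤ k ⊓ 1 + (k ∸ 1)
    lem zero = z≤n
    lem (suc zero) = ≤-refl
    lem (suc (suc k)) = ≤-refl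

  simple≤1 : simple ≼ᶜ 1
  simple≤1 x y = m⊓n≤n (codeg x y) 1

  simple≼codeg : simple ≼ codeg
  simple≼codeg x y = m⊓n≤m (codeg x y) 1

  module _ {E q m : ℕ} (row : ∀ x → Σ[ n ] (a x) ≤ m) (col : ∀ y → Σ[ n ] (λ x → a x y) ≤ m)
           (r₁ r₂ r₃ r₄ r₅ : Mat n)
           (d₁ : Dominates E q a r₁) (d₂ : Dominates E q a r₂) (d₃ : Dominates E q a r₃)
           (d₄ : Dominates E q a r₄) (d₅ : Dominates E q a r₅)
           (b₁ : r₁ ≼ᶜ 1) (b₂ : r₂ ≼ᶜ 1) (b₃ : r₃ ≼ᶜ 1) (b₄ : r₄ ≼ᶜ 1) (b₅ : r₅ ≼ᶜ 1) where

    private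
      X : ℕ
      X = total excess

      -- Rotating the trace isolates `excess` as a single factor, so that its total can be paired
      -- with an entry bound for the rest of the walk.
      split-at : ∀ {k} (P Q : Mat n) → Q ⊙ P ≼ᶜ k →
        tr (P ⊙ (codeg ⊙ Q)) ≤ tr (P ⊙ (simple ⊙ Q)) + X * k
      split-at {k} P Q b = begin
        tr (P ⊙ (codeg ⊙ Q)) ≤⟨ tr-mono (⊙-monoʳ P (⊙-mono codeg-split ≼-refl)) ⟩
        tr (P ⊙ ((simple ⊕ excess) ⊙ Q)) ≡⟨ tr-cong (⊙-congʳ P (⊙-distribʳ simple excess Q)) ⟩
        tr (P ⊙ ((simple ⊙ Q) ⊕ (excess ⊙ Q))) ≡⟨ tr-cong (⊙-distribˡ P (simple ⊙ Q) (excess ⊙ Q)) ⟩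
        tr ((P ⊙ (simple ⊙ Q)) ⊕ (P ⊙ (excess ⊙ Q))) ≡⟨ tr-⊕ (P ⊙ (simple ⊙ Q)) (P ⊙ (excess ⊙ Q)) ⟩
        tr (P ⊙ (simple ⊙ Q)) + tr (P ⊙ (excess ⊙ Q))
          ≡⟨ cong (tr (P ⊙ (simple ⊙ Q)) +_) (trans (tr-comm P (excess ⊙ Q)) (tr-assoc excess Q P)) ⟩
        tr (P ⊙ (simple ⊙ Q)) + tr (excess ⊙ (Q ⊙ P)) ≤⟨ +-monoʳ-≤ _ (tr-total b) ⟩
        tr (P ⊙ (simple ⊙ Q)) + X * k ∎
        where open ≤-Reasoning

    -- The factors are replaced in the order 4, 3, 1, 2, 5. The entry bounds of the two sides are
    -- then n^2 and 1, n and m, 1 and n, m and 1, 1 and 1; for `q` and `m` of order √n this keeps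
    -- every weighted error of order n^5. The two terms with `X` come from truncating codegrees
    -- after the second and the fourth replacement.
    closed5-lower : E * tr (((r₁ ⊙ r₂) ⊙ r₃) ⊙ (r₄ ⊙ r₅)) ≤
      E * (q * q * q * q * q * closed5)
      + (n * n * n * n * n + q * (m * n * n * n * n) + E * (q * q * (X * (n * n)))
         + q * q * (n * n * n * n) + q * q * q * (m * n * n * n)
         + E * (q * q * q * q * (X * n)) + q * q * q * q * (n * n * n))
    closed5-lower = ≤-trans (step₇ (q * q * q * q) (step₆ (q * q * q * q) (step₅ (q * q * q) (step₄ (q * q) (step₃ (q * q) (step₂ q step₁))))))
        (≤-reflexive (cong (E * (q * q * q * q * q * closed5) +_) (errors n E q m X)))
      where
      open ≤-Reasoning
      S = tr (((r₁ ⊙ r₂) ⊙ r₃) ⊙ (r₄ ⊙ r₅))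
      r₁₂ : (r₁ ⊙ r₂) ≼ᶜ n * 1
      r₁₂ = ⊙-≼ᶜ b₁ b₂

      errors : ∀ n E q m X →
        n * (n * (n * 1 * 1) * (1 * (n * n))) + q * (n * (n * 1 * (m * (n * n)))) + E * (q * q * (X * (n * (1 * (n * 1)))))
        + q * q * (n * (1 * (n * (1 * 1) * (n * n)))) + q * q * q * (n * (m * (1 * (n * n))))
        + E * (q * q * q * q * (X * (n * (1 * 1)))) + q * q * q * q * (n * (1 * (1 * (n * n))))
        ≡ n * n * n * n * n + q * (m * n * n * n * n) + E * (q * q * (X * (n * n)))
          + q * q * (n * n * n * n) + q * q * q * (m * n * n * n)
          + E * (q * q * q * q * (X * n)) + q * q * q * q * (n * n * n)
      errors = solve-∀

      step₁ : E * S ≤ E * (q * tr ((r₁ ⊙ r₂) ⊙ (r₃ ⊙ (a ⊙ r₅)))) + n * (n * (n * 1 * 1) * (1 * (n * n)))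
      step₁ = subst (λ t → E * S ≤ E * (q * t) + n * (n * (n * 1 * 1) * (1 * (n * n))))
        (tr-assoc (r₁ ⊙ r₂) r₃ (a ⊙ r₅))
        (dominates-tr d₄ ((r₁ ⊙ r₂) ⊙ r₃) r₅ (⊙-≼ᶜ r₁₂ b₃) b₅)

      step₂ : ∀ c {e} → E * S ≤ E * (c * tr ((r₁ ⊙ r₂) ⊙ (r₃ ⊙ (a ⊙ r₅)))) + e →
        E * S ≤ E * (c * q * tr ((r₁ ⊙ r₂) ⊙ (codeg ⊙ r₅))) + (e + c * (n * (n * 1 * (m * (n * n)))))
      step₂ c {e} h = chain-dominate E c q e _ S _ _ h
        (subst (λ t → E * tr ((r₁ ⊙ r₂) ⊙ (r₃ ⊙ (a ⊙ r₅))) ≤ E * (q * t) + _) (tr-cong (⊙-congʳ (r₁ ⊙ r₂) (≐-sym (⊙-assoc a a r₅))))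
          (dominates-tr d₃ (r₁ ⊙ r₂) (a ⊙ r₅) r₁₂ (⊙-rowBound row b₅)))

      -- Without this truncation the side `simple` in `step₅` would be `codeg`, which for a graph
      -- can have entries as large as `m`. The other side `r₅ ⊙ a` already uses up the bound `m`
      -- allowed there, so the error would be too large by a factor of order √n.
      step₃ : ∀ c {e} → E * S ≤ E * (c * tr ((r₁ ⊙ r₂) ⊙ (codeg ⊙ r₅))) + e →
        E * S ≤ E * (c * tr (r₅ ⊙ (r₁ ⊙ (r₂ ⊙ simple)))) + (e + E * (c * (X * (n * (1 * (n * 1))))))
      step₃ c {e} h = subst (λ t → E * S ≤ E * (c * t) + (e + E * (c * (X * (n * (1 * (n * 1))))))) rotate
        (chain-split E c e _ S _ _ h (split-at (r₁ ⊙ r₂) r₅ (⊙-≼ᶜ b₅ r₁₂)))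
        where
        rotate : tr ((r₁ ⊙ r₂) ⊙ (simple ⊙ r₅)) ≡ tr (r₅ ⊙ (r₁ ⊙ (r₂ ⊙ simple)))
        rotate = trans (sym (tr-assoc (r₁ ⊙ r₂) simple r₅)) (trans (tr-comm ((r₁ ⊙ r₂) ⊙ simple) r₅)
          (tr-cong (⊙-congʳ r₅ (⊙-assoc r₁ r₂ simple))))

      step₄ : ∀ c {e} → E * S ≤ E * (c * tr (r₅ ⊙ (r₁ ⊙ (r₂ ⊙ simple)))) + e →
        E * S ≤ E * (c * q * tr ((r₅ ⊙ a) ⊙ (r₂ ⊙ simple))) + (e + c * (n * (1 * (n * (1 * 1) * (n * n)))))
      step₄ c {e} h = chain-dominate E c q e _ S _ _ h
        (subst (λ t → E * tr (r₅ ⊙ (r₁ ⊙ (r₂ ⊙ simple))) ≤ E * (q * t) + _) (sym (tr-assoc r₅ a (r₂ ⊙ simple)))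
          (dominates-tr d₁ r₅ (r₂ ⊙ simple) b₅ (⊙-≼ᶜ b₂ simple≤1)))

      step₅ : ∀ c {e} → E * S ≤ E * (c * tr ((r₅ ⊙ a) ⊙ (r₂ ⊙ simple))) + e →
        E * S ≤ E * (c * q * tr (r₅ ⊙ (codeg ⊙ simple))) + (e + c * (n * (m * (1 * (n * n)))))
      step₅ c {e} h = chain-dominate E c q e _ S _ _ h
        (subst (λ t → E * tr ((r₅ ⊙ a) ⊙ (r₂ ⊙ simple)) ≤ E * (q * t) + _)
          (trans (tr-assoc r₅ a (a ⊙ simple)) (tr-cong (⊙-congʳ r₅ (≐-sym (⊙-assoc a a simple)))))
          (dominates-tr d₂ (r₅ ⊙ a) simple (⊙-colBound b₅ col) simple≤1))

      step₆ : ∀ c {e} → E * S ≤ E * (c * tr (r₅ ⊙ (codeg ⊙ simple))) + e →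
        E * S ≤ E * (c * tr (simple ⊙ (r₅ ⊙ simple))) + (e + E * (c * (X * (n * (1 * 1)))))
      step₆ c {e} h = subst (λ t → E * S ≤ E * (c * t) + (e + E * (c * (X * (n * (1 * 1)))))) rotate
        (chain-split E c e _ S _ _ h (split-at r₅ simple (⊙-≼ᶜ simple≤1 b₅)))
        where
        rotate : tr (r₅ ⊙ (simple ⊙ simple)) ≡ tr (simple ⊙ (r₅ ⊙ simple))
        rotate = trans (sym (tr-assoc r₅ simple simple)) (tr-comm (r₅ ⊙ simple) simple)

      -- After this replacement `simple` may be enlarged to `codeg`, since the trace is only
      -- compared with `closed5` from below.
      step₇ : ∀ c {e} → E * S ≤ E * (c * tr (simple ⊙ (r₅ ⊙ simple))) + e →
        E * S ≤ E * (c * q * closed5) + (e + c * (n * (1 * (1 * (n * n)))))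
      step₇ c {e} h = chain-dominate E c q e _ S _ _ h
        (≤-trans (dominates-tr d₅ simple simple simple≤1 simple≤1)
          (+-monoˡ-≤ _ (*-monoʳ-≤ E (*-monoʳ-≤ q (tr-mono (⊙-mono simple≼codeg (⊙-monoʳ a simple≼codeg)))))))

-- Closed walks through dense pairs of cells

ind≤1 : ∀ b → ind b ≤ 1
ind≤1 true = ≤-refl
ind≤1 false = z≤n

ind-idem : ∀ b → ind b * ind b ≡ ind b
ind-idem true = refl
ind-idem false = refl

ind+ind-not : ∀ b → ind b + ind (not b) ≡ 1
ind+ind-not true = refl
ind+ind-not false = refl

tr5 : ∀ {n} (A B C D E : Mat n) → ℕ
tr5 A B C D E = tr (A ⊙ (B ⊙ (C ⊙ (D ⊙ E))))

tr5-rotate : ∀ {n} (A B C D E : Mat n) → tr5 A B C D E ≡ tr5 B C D E A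
tr5-rotate A B C D E = trans (tr-comm A (B ⊙ (C ⊙ (D ⊙ E)))) (trans (tr-assoc B (C ⊙ (D ⊙ E)) A)
  (tr-cong (⊙-congʳ B (λ x y → trans (⊙-assoc C (D ⊙ E) A x y) (⊙-congʳ C (⊙-assoc D E A) x y)))))

tr5-split : ∀ {n} (P Q B C D E : Mat n) → tr5 (P ⊕ Q) B C D E ≡ tr5 P B C D E + tr5 Q B C D E
tr5-split P Q B C D E = trans (tr-cong (⊙-distribʳ P Q rest)) (tr-⊕ (P ⊙ rest) (Q ⊙ rest))
  where rest = B ⊙ (C ⊙ (D ⊙ E))

tr5-mono : ∀ {n} {A B C D E A′ B′ C′ D′ E′ : Mat n} →
  A ≼ A′ → B ≼ B′ → C ≼ C′ → D ≼ D′ → E ≼ E′ → tr5 A B C D E ≤ tr5 A′ B′ C′ D′ E′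
tr5-mono a b c d e = tr-mono (⊙-mono a (⊙-mono b (⊙-mono c (⊙-mono d e))))

outer : ∀ {n} → (u v : Fin n → ℕ) → Mat n
outer u v x y = u x * v y

-- Shaped for folding a product of blocks from the right: the scalar collected so far sits in the
-- left vector, and idempotence of the indicator of `V` turns the inner sum into a size.
outer-⊙ : ∀ {n} (u : Fin n → ℕ) (V : Fin n → Bool) c w → let v = λ y → ind (V y) in
  outer u v ⊙ outer (λ y → v y * c) w ≐ outer (λ x → u x * (Σ[ n ] v * c)) w
outer-⊙ {n} u V c w x z = begin
  Σ[ n ] (λ y → u x * ind (V y) * (ind (V y) * c * w z))
    ≡⟨ Σ-cong (λ y → trans (rearrange (u x) (ind (V y)) c (w z)) (cong (u x * c * w z *_) (ind-idem (V y)))) ⟩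
  Σ[ n ] (λ y → u x * c * w z * ind (V y)) ≡⟨ Σ-*ˡ (u x * c * w z) (λ y → ind (V y)) ⟩
  u x * c * w z * Σ[ n ] (λ y → ind (V y)) ≡⟨ rearrange′ (u x) c (w z) (Σ[ n ] (λ y → ind (V y))) ⟩
  u x * (Σ[ n ] (λ y → ind (V y)) * c) * w z ∎
  where
  open ≡-Reasoning
  rearrange : ∀ u i c w → u * i * (i * c * w) ≡ u * c * w * (i * i)
  rearrange = solve-∀
  rearrange′ : ∀ u c w s → u * c * w * s ≡ u * (s * c) * w
  rearrange′ = solve-∀

outer-≼ᶜ : ∀ {n} (U : Fin n → Bool) v {P : Mat n} {k} → P ≼ᶜ k → outer (λ x → ind (U x)) v ⊙ P ≼ᶜ Σ[ n ] v * k
outer-≼ᶜ {n} U v {P} {k} p x z = begin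
  Σ[ n ] (λ y → ind (U x) * v y * P y z)
    ≤⟨ Σ-mono (λ y → *-mono-≤ (≤-trans (*-monoˡ-≤ (v y) (ind≤1 (U x))) (≤-reflexive (*-identityˡ (v y)))) (p y z)) ⟩
  Σ[ n ] (λ y → v y * k) ≡⟨ Σ-*ʳ v k ⟩
  Σ[ n ] v * k ∎
  where open ≤-Reasoning

size : ∀ {n} → (Fin n → Bool) → ℕ
size {n} V = Σ[ n ] λ x → ind (V x)

module _ {n} (R : Fin n → Fin n → Bool) where

  block : (U V : Fin n → Bool) → Mat n
  block U V = outer (λ x → ind (U x)) (λ y → ind (V y))

  inside outside : (U V : Fin n → Bool) → Mat n
  inside U V x y = ind (U x) * ind (R x y) * ind (V y)
  outside U V x y = ind (U x) * ind (not (R x y)) * ind (V y)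

  block-split : ∀ U V → block U V ≐ (inside U V ⊕ outside U V)
  block-split U V x y = sym (trans (rearrange (ind (U x)) (ind (R x y)) (ind (not (R x y))) (ind (V y)))
    (trans (cong (ind (U x) * ind (V y) *_) (ind+ind-not (R x y))) (*-identityʳ _)))
    where
    rearrange : ∀ u r s v → u * r * v + u * s * v ≡ u * v * (r + s)
    rearrange = solve-∀

  inside≼block : ∀ U V → inside U V ≼ block U V
  inside≼block U V x y = ≤-trans (m≤m+n _ _) (≤-reflexive (sym (block-split U V x y)))

  -- A tenth is small enough for five defects, one on each side of the walk, to use up only half of
  -- the volume.
  DenseOn : (U V : Fin n → Bool) → Set
  DenseOn U V = 10 * total (outside U V) ≤ size U * size V

  module _ (V₁ V₂ V₃ V₄ V₅ : Fin n → Bool) where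

    volume : ℕ
    volume = size V₁ * (size V₂ * (size V₃ * (size V₄ * (size V₅ * 1))))

    tr5-blocks : tr5 (block V₁ V₂) (block V₂ V₃) (block V₃ V₄) (block V₄ V₅) (block V₅ V₁) ≡ volume
    tr5-blocks = begin
      tr5 (block V₁ V₂) (block V₂ V₃) (block V₃ V₄) (block V₄ V₅) (block V₅ V₁)
        ≡⟨ tr-cong (λ x y → trans (⊙-congʳ (block V₁ V₂) (λ x y →
             trans (⊙-congʳ (block V₂ V₃) (λ x y →
               trans (⊙-congʳ (block V₃ V₄) (λ x y →
                 trans (⊙-congʳ (block V₄ V₅) (λ x y → cong (_* χ V₁ y) (sym (*-identityʳ (χ V₅ x)))) x y)
                   (outer-⊙ (χ V₄) V₅ 1 (χ V₁) x y)) x y)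
                 (outer-⊙ (χ V₃) V₄ _ (χ V₁) x y)) x y)
               (outer-⊙ (χ V₂) V₃ _ (χ V₁) x y)) x y)
             (outer-⊙ (χ V₁) V₂ _ (χ V₁) x y)) ⟩
      Σ[ n ] (λ x → χ V₁ x * tail * χ V₁ x)
        ≡⟨ Σ-cong (λ x → trans (rearrange (χ V₁ x) tail) (cong (_* tail) (ind-idem (V₁ x)))) ⟩
      Σ[ n ] (λ x → χ V₁ x * tail) ≡⟨ Σ-*ʳ (χ V₁) tail ⟩
      volume ∎
      where
      open ≡-Reasoning
      χ : (Fin n → Bool) → Fin n → ℕ
      χ V x = ind (V x)
      tail = size V₂ * (size V₃ * (size V₄ * (size V₅ * 1)))
      rearrange : ∀ u t → u * t * u ≡ u * u * t
      rearrange = solve-∀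

    tr5-outside : DenseOn V₁ V₂ →
      10 * tr5 (outside V₁ V₂) (block V₂ V₃) (block V₃ V₄) (block V₄ V₅) (block V₅ V₁) ≤ volume
    tr5-outside h = begin
      10 * tr (outside V₁ V₂ ⊙ rest) ≤⟨ *-monoʳ-≤ 10 (tr-total {P = outside V₁ V₂} {Q = rest} bound) ⟩
      10 * (total (outside V₁ V₂) * t) ≡⟨ sym (*-assoc 10 (total (outside V₁ V₂)) t) ⟩
      10 * total (outside V₁ V₂) * t ≤⟨ *-monoˡ-≤ t h ⟩
      size V₁ * size V₂ * t ≡⟨ *-assoc (size V₁) (size V₂) t ⟩
      volume ∎
      where
      open ≤-Reasoning
      rest = block V₂ V₃ ⊙ (block V₃ V₄ ⊙ (block V₄ V₅ ⊙ block V₅ V₁))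
      t = size V₃ * (size V₄ * (size V₅ * 1))
      bound : rest ≼ᶜ t
      bound = outer-≼ᶜ V₂ _ (outer-≼ᶜ V₃ _ (outer-≼ᶜ V₄ _ (λ x y → *-mono-≤ (ind≤1 (V₅ x)) (ind≤1 (V₁ y)))))

  module _ (V₁ V₂ V₃ V₄ V₅ : Fin n → Bool) (d : DenseOn V₁ V₂) {B C D E : Mat n}
           (b : B ≼ block V₂ V₃) (c : C ≼ block V₃ V₄) (e : D ≼ block V₄ V₅) (f : E ≼ block V₅ V₁) where

    -- Exchanging the first factor costs at most a tenth of the volume. The result is rotated by one
    -- place, so that five uses exchange all the factors.
    restrict : 10 * tr5 (block V₁ V₂) B C D E ≤ 10 * tr5 B C D E (inside V₁ V₂) + volume V₁ V₂ V₃ V₄ V₅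
    restrict = begin
      10 * tr5 (block V₁ V₂) B C D E
        ≡⟨ cong (10 *_) (trans (tr-cong (⊙-cong {P = block V₁ V₂} {Q = rest} (block-split V₁ V₂) (λ x y → refl)))
             (tr5-split (inside V₁ V₂) (outside V₁ V₂) B C D E)) ⟩
      10 * (tr5 (inside V₁ V₂) B C D E + tr5 (outside V₁ V₂) B C D E)
        ≡⟨ *-distribˡ-+ 10 (tr5 (inside V₁ V₂) B C D E) _ ⟩
      10 * tr5 (inside V₁ V₂) B C D E + 10 * tr5 (outside V₁ V₂) B C D E
        ≤⟨ +-mono-≤ (≤-reflexive (cong (10 *_) (tr5-rotate (inside V₁ V₂) B C D E)))
             (≤-trans (*-monoʳ-≤ 10 (tr5-mono {A = outside V₁ V₂} {A′ = outside V₁ V₂} ≼-refl b c e f)) (tr5-outside V₁ V₂ V₃ V₄ V₅ d)) ⟩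
      10 * tr5 B C D E (inside V₁ V₂) + volume V₁ V₂ V₃ V₄ V₅ ∎
      where
      open ≤-Reasoning
      rest = B ⊙ (C ⊙ (D ⊙ E))

  -- A union bound: the five exchanges lose at most five tenths of the closed walks through the
  -- blocks.
  volume≤tr5 : ∀ V₁ V₂ V₃ V₄ V₅ → DenseOn V₁ V₂ → DenseOn V₂ V₃ → DenseOn V₃ V₄ → DenseOn V₄ V₅ → DenseOn V₅ V₁ →
    volume V₁ V₂ V₃ V₄ V₅ ≤ 2 * tr5 (inside V₁ V₂) (inside V₂ V₃) (inside V₃ V₄) (inside V₄ V₅) (inside V₅ V₁)
  volume≤tr5 V₁ V₂ V₃ V₄ V₅ d₁ d₂ d₃ d₄ d₅ = *-cancelˡ-≤ 5 (+-cancelʳ-≤ (5 * v) _ _ (begin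
    5 * v + 5 * v ≡⟨ double v ⟩
    10 * v ≡⟨ cong (10 *_) (sym (tr5-blocks V₁ V₂ V₃ V₄ V₅)) ⟩
    10 * tr5 (block V₁ V₂) (block V₂ V₃) (block V₃ V₄) (block V₄ V₅) (block V₅ V₁)
      ≤⟨ restrict V₁ V₂ V₃ V₄ V₅ d₁ ≼-refl ≼-refl ≼-refl ≼-refl ⟩
    10 * tr5 (block V₂ V₃) (block V₃ V₄) (block V₄ V₅) (block V₅ V₁) (inside V₁ V₂) + v
      ≤⟨ +-monoˡ-≤ v (restrict V₂ V₃ V₄ V₅ V₁ d₂ ≼-refl ≼-refl ≼-refl i₁) ⟩
    _ ≤⟨ +-monoˡ-≤ v (+-monoˡ-≤ _ (restrict V₃ V₄ V₅ V₁ V₂ d₃ ≼-refl ≼-refl i₁ i₂)) ⟩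
    _ ≤⟨ +-monoˡ-≤ v (+-monoˡ-≤ _ (+-monoˡ-≤ _ (restrict V₄ V₅ V₁ V₂ V₃ d₄ ≼-refl i₁ i₂ i₃))) ⟩
    _ ≤⟨ +-monoˡ-≤ v (+-monoˡ-≤ _ (+-monoˡ-≤ _ (+-monoˡ-≤ _ (restrict V₅ V₁ V₂ V₃ V₄ d₅ i₁ i₂ i₃ i₄)))) ⟩
    10 * t + volume V₅ V₁ V₂ V₃ V₄ + volume V₄ V₅ V₁ V₂ V₃ + volume V₃ V₄ V₅ V₁ V₂ + volume V₂ V₃ V₄ V₅ V₁ + v
      ≡⟨ collect (size V₁) (size V₂) (size V₃) (size V₄) (size V₅) t ⟩
    5 * (2 * t) + 5 * v ∎))
    where
    open ≤-Reasoning
    v = volume V₁ V₂ V₃ V₄ V₅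
    t = tr5 (inside V₁ V₂) (inside V₂ V₃) (inside V₃ V₄) (inside V₄ V₅) (inside V₅ V₁)
    i₁ = inside≼block V₁ V₂
    i₂ = inside≼block V₂ V₃
    i₃ = inside≼block V₃ V₄
    i₄ = inside≼block V₄ V₅
    double : ∀ v → 5 * v + 5 * v ≡ 10 * v
    double = solve-∀
    collect : ∀ a b c d e t →
      10 * t + e * (a * (b * (c * (d * 1)))) + d * (e * (a * (b * (c * 1)))) + c * (d * (e * (a * (b * 1))))
        + b * (c * (d * (e * (a * 1)))) + a * (b * (c * (d * (e * 1))))
      ≡ 5 * (2 * t) + 5 * (a * (b * (c * (d * (e * 1)))))
    collect = solve-∀

ind-∧ : ∀ b c → ind (b ∧ c) ≡ ind b * ind c
ind-∧ true c = sym (+-identityʳ (ind c))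
ind-∧ false c = refl

form-cong : ∀ {n} (P Q : Mat n) f f′ g g′ → (∀ x y → f x * P x y * g y ≡ f′ x * Q x y * g′ y) → form P f g ≡ form Q f′ g′
form-cong {n} P Q f f′ g g′ h = Σ-cong λ x →
  trans (sym (pushed P f g x)) (trans (Σ-cong (h x)) (pushed Q f′ g′ x))
  where
  pushed : ∀ (P : Mat n) f g x → Σ[ n ] (λ y → f x * P x y * g y) ≡ f x * Σ[ n ] (λ y → P x y * g y)
  pushed P f g x = trans (Σ-cong (λ y → *-assoc (f x) (P x y) (g y))) (Σ-*ˡ (f x) (λ y → P x y * g y))

form-mono : ∀ {n} (P : Mat n) {f f′ g g′} → (∀ x → f x ≤ f′ x) → (∀ y → g y ≤ g′ y) → form P f g ≤ form P f′ g′
form-mono P hf hg = Σ-mono (λ x → *-mono-≤ (hf x) (Σ-mono (λ y → *-monoʳ-≤ (P x y) (hg y))))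

-- A rectangle with sides X and Y meets the restricted region in the rectangle with sides X ∩ U and
-- Y ∩ V, so no error is added.
dominates-inside : ∀ {n E q} {a : Mat n} {R} → Dominates E q a (λ x y → ind (R x y)) →
  ∀ U V → Dominates E q a (inside R U V)
dominates-inside {n} {E} {q} {a} {R} dom U V .Dominates.on-rectangles X Y = begin
  E * form (inside R U V) (λ x → ind (X x)) (λ y → ind (Y y)) ≡⟨ cong (E *_) (form-cong (inside R U V) (λ x y → ind (R x y))
    (λ x → ind (X x)) (λ x → ind (XU x)) (λ y → ind (Y y)) (λ y → ind (YV y)) move) ⟩
  E * form (λ x y → ind (R x y)) (λ x → ind (XU x)) (λ y → ind (YV y)) ≤⟨ Dominates.on-rectangles dom XU YV ⟩
  E * (q * form a (λ x → ind (XU x)) (λ y → ind (YV y))) + n * n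
    ≤⟨ +-monoˡ-≤ (n * n) (*-monoʳ-≤ E (*-monoʳ-≤ q (form-mono a (λ x → weaken (X x) (U x)) (λ y → weaken (Y y) (V y))))) ⟩
  E * (q * form a (λ x → ind (X x)) (λ y → ind (Y y))) + n * n ∎
  where
  open ≤-Reasoning
  XU YV : Fin n → Bool
  XU x = X x ∧ U x
  YV y = Y y ∧ V y
  weaken : ∀ b c → ind (b ∧ c) ≤ ind b
  weaken true c = ind≤1 c
  weaken false c = z≤n
  rearrange : ∀ x u r v y → x * (u * r * v) * y ≡ x * u * r * (y * v)
  rearrange = solve-∀
  move : ∀ x y → ind (X x) * inside R U V x y * ind (Y y) ≡ ind (XU x) * ind (R x y) * ind (YV y)
  move x y = trans (rearrange (ind (X x)) (ind (U x)) (ind (R x y)) (ind (V y)) (ind (Y y)))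
    (sym (cong₂ (λ s t → s * ind (R x y) * t) (ind-∧ (X x) (U x)) (ind-∧ (Y y) (V y))))

factor-positive : ∀ j {k} → 1 ≤ j * k → 1 ≤ j
factor-positive (suc j) h = s≤s z≤n

-- With these parameters, the main term of closed5-lower exceeds the error terms when all cells have at least n / L
-- vertices.
module Parameters (C M L : ℕ) where
  -- `c₁` collects the coefficients of the errors free of `X` and `W`, to be beaten by the
  -- precision; `c₂` those of the errors containing `X` or `W`, to be beaten by the sparsity. In 4 *
  -- ℓ, one factor 2 comes from `volume≤tr5`, and the other makes the first kind use up only half of
  -- the main term. The successor makes the final comparison strict.
  ℓ c₁ c₂ regularity sparsity : ℕ
  ℓ = L * L * L * L * L
  c₁ = C * C * C * C + C * C * C * M + C * C + C * M + 1
  c₂ = C * C * C * C * C + C * C * C * C + C * C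
  regularity = 4 * ℓ * c₁
  sparsity = suc (4 * ℓ * c₂)

  module _ (n s X W S P : ℕ) (s²≤n : s * s ≤ n)
           (hX : sparsity * X ≤ n * n) (hW : sparsity * W ≤ n * n * s) where
    private
      D E q m : ℕ
      D = sparsity
      E = regularity
      q = C * s
      m = M * s
      N = n * n * n * n * n

    -- `D` is multiplied in so that `hX` and `hW` can absorb it wherever `X` or `W` occurs. The
    -- remaining powers of `s` are even and turn into powers of n.
    errors-small :
      D * (E * (q * q * q * q * q * W)
        + (n * n * n * n * n + q * (m * n * n * n * n) + E * (q * q * (X * (n * n)))
           + q * q * (n * n * n * n) + q * q * q * (m * n * n * n)
           + E * (q * q * q * q * (X * n)) + q * q * q * q * (n * n * n)))
      ≤ (E * c₂ + D * c₁) * N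
    errors-small = begin
      _ ≡⟨ distribute D (E * (q * q * q * q * q * W)) N (q * (m * n * n * n * n)) (E * (q * q * (X * (n * n))))
             (q * q * (n * n * n * n)) (q * q * q * (m * n * n * n)) (E * (q * q * q * q * (X * n))) (q * q * q * q * (n * n * n)) ⟩
      D * (E * (q * q * q * q * q * W)) + D * N + D * (q * (m * n * n * n * n)) + D * (E * (q * q * (X * (n * n))))
        + D * (q * q * (n * n * n * n)) + D * (q * q * q * (m * n * n * n)) + D * (E * (q * q * q * q * (X * n)))
        + D * (q * q * q * q * (n * n * n))
        ≤⟨ t₀ ⊹ ≤-refl ⊹ t₂ ⊹ t₃ ⊹ t₄ ⊹ t₅ ⊹ t₆ ⊹ t₇ ⟩
      E * (C * C * C * C * C) * N + D * N + D * (C * M) * N + E * (C * C) * N + D * (C * C) * N + D * (C * C * C * M) * N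
        + E * (C * C * C * C) * N + D * (C * C * C * C) * N ≡⟨ collect D E C M N ⟩
      (E * c₂ + D * c₁) * N ∎
      where
      open ≤-Reasoning
      infixl 6 _⊹_
      _⊹_ : ∀ {a b c d} → a ≤ b → c ≤ d → a + c ≤ b + d
      _⊹_ = +-mono-≤
      distribute : ∀ D a b c d e f g h → D * (a + (b + c + d + e + f + g + h)) ≡
        D * a + D * b + D * c + D * d + D * e + D * f + D * g + D * h
      distribute = solve-∀
      collect : ∀ D E C M N →
        E * (C * C * C * C * C) * N + D * N + D * (C * M) * N + E * (C * C) * N + D * (C * C) * N + D * (C * C * C * M) * N
          + E * (C * C * C * C) * N + D * (C * C * C * C) * N
        ≡ (E * (C * C * C * C * C + C * C * C * C + C * C) + D * (C * C * C * C + C * C * C * M + C * C + C * M + 1)) * N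
      collect = solve-∀

      s⁴ : s * s * (s * s) ≤ n * n
      s⁴ = *-mono-≤ s²≤n s²≤n
      s⁶ : s * s * (s * s) * (s * s) ≤ n * n * n
      s⁶ = *-mono-≤ s⁴ s²≤n

      t₀ : D * (E * (q * q * q * q * q * W)) ≤ E * (C * C * C * C * C) * N
      t₀ = begin
        D * (E * (q * q * q * q * q * W)) ≡⟨ e₁ D E C s W ⟩
        E * (C * C * C * C * C) * (s * s * s * s * s * (D * W)) ≤⟨ *-monoʳ-≤ (E * (C * C * C * C * C)) (*-monoʳ-≤ (s * s * s * s * s) hW) ⟩
        E * (C * C * C * C * C) * (s * s * s * s * s * (n * n * s)) ≡⟨ e₂ (E * (C * C * C * C * C)) s n ⟩
        E * (C * C * C * C * C) * (s * s * (s * s) * (s * s) * (n * n)) ≤⟨ *-monoʳ-≤ (E * (C * C * C * C * C)) (*-monoˡ-≤ (n * n) s⁶) ⟩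
        E * (C * C * C * C * C) * (n * n * n * (n * n)) ≡⟨ e₃ (E * (C * C * C * C * C)) n ⟩
        E * (C * C * C * C * C) * N ∎
        where
        e₁ : ∀ D E C s W → D * (E * (C * s * (C * s) * (C * s) * (C * s) * (C * s) * W)) ≡ E * (C * C * C * C * C) * (s * s * s * s * s * (D * W))
        e₁ = solve-∀
        e₂ : ∀ k s n → k * (s * s * s * s * s * (n * n * s)) ≡ k * (s * s * (s * s) * (s * s) * (n * n))
        e₂ = solve-∀
        e₃ : ∀ k n → k * (n * n * n * (n * n)) ≡ k * (n * n * n * n * n)
        e₃ = solve-∀

      t₂ : D * (q * (m * n * n * n * n)) ≤ D * (C * M) * N
      t₂ = begin
        D * (q * (m * n * n * n * n)) ≡⟨ e₁ D C M s n ⟩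
        D * (C * M) * (s * s * (n * n * n * n)) ≤⟨ *-monoʳ-≤ (D * (C * M)) (*-monoˡ-≤ (n * n * n * n) s²≤n) ⟩
        D * (C * M) * (n * (n * n * n * n)) ≡⟨ e₂ (D * (C * M)) n ⟩
        D * (C * M) * N ∎
        where
        e₁ : ∀ D C M s n → D * (C * s * (M * s * n * n * n * n)) ≡ D * (C * M) * (s * s * (n * n * n * n))
        e₁ = solve-∀
        e₂ : ∀ k n → k * (n * (n * n * n * n)) ≡ k * (n * n * n * n * n)
        e₂ = solve-∀

      t₃ : D * (E * (q * q * (X * (n * n)))) ≤ E * (C * C) * N
      t₃ = begin
        D * (E * (q * q * (X * (n * n)))) ≡⟨ e₁ D E C s X n ⟩
        E * (C * C) * (s * s * (D * X) * (n * n)) ≤⟨ *-monoʳ-≤ (E * (C * C)) (*-monoˡ-≤ (n * n) (*-mono-≤ s²≤n hX)) ⟩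
        E * (C * C) * (n * (n * n) * (n * n)) ≡⟨ e₂ (E * (C * C)) n ⟩
        E * (C * C) * N ∎
        where
        e₁ : ∀ D E C s X n → D * (E * (C * s * (C * s) * (X * (n * n)))) ≡ E * (C * C) * (s * s * (D * X) * (n * n))
        e₁ = solve-∀
        e₂ : ∀ k n → k * (n * (n * n) * (n * n)) ≡ k * (n * n * n * n * n)
        e₂ = solve-∀

      t₄ : D * (q * q * (n * n * n * n)) ≤ D * (C * C) * N
      t₄ = begin
        D * (q * q * (n * n * n * n)) ≡⟨ e₁ D C s n ⟩
        D * (C * C) * (s * s * (n * n * n * n)) ≤⟨ *-monoʳ-≤ (D * (C * C)) (*-monoˡ-≤ (n * n * n * n) s²≤n) ⟩
        D * (C * C) * (n * (n * n * n * n)) ≡⟨ e₂ (D * (C * C)) n ⟩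
        D * (C * C) * N ∎
        where
        e₁ : ∀ D C s n → D * (C * s * (C * s) * (n * n * n * n)) ≡ D * (C * C) * (s * s * (n * n * n * n))
        e₁ = solve-∀
        e₂ : ∀ k n → k * (n * (n * n * n * n)) ≡ k * (n * n * n * n * n)
        e₂ = solve-∀

      t₅ : D * (q * q * q * (m * n * n * n)) ≤ D * (C * C * C * M) * N
      t₅ = begin
        D * (q * q * q * (m * n * n * n)) ≡⟨ e₁ D C M s n ⟩
        D * (C * C * C * M) * (s * s * (s * s) * (n * n * n)) ≤⟨ *-monoʳ-≤ (D * (C * C * C * M)) (*-monoˡ-≤ (n * n * n) s⁴) ⟩
        D * (C * C * C * M) * (n * n * (n * n * n)) ≡⟨ e₂ (D * (C * C * C * M)) n ⟩
        D * (C * C * C * M) * N ∎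
        where
        e₁ : ∀ D C M s n → D * (C * s * (C * s) * (C * s) * (M * s * n * n * n)) ≡ D * (C * C * C * M) * (s * s * (s * s) * (n * n * n))
        e₁ = solve-∀
        e₂ : ∀ k n → k * (n * n * (n * n * n)) ≡ k * (n * n * n * n * n)
        e₂ = solve-∀

      t₆ : D * (E * (q * q * q * q * (X * n))) ≤ E * (C * C * C * C) * N
      t₆ = begin
        D * (E * (q * q * q * q * (X * n))) ≡⟨ e₁ D E C s X n ⟩
        E * (C * C * C * C) * (s * s * (s * s) * (D * X) * n) ≤⟨ *-monoʳ-≤ (E * (C * C * C * C)) (*-monoˡ-≤ n (*-mono-≤ s⁴ hX)) ⟩
        E * (C * C * C * C) * (n * n * (n * n) * n) ≡⟨ e₂ (E * (C * C * C * C)) n ⟩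
        E * (C * C * C * C) * N ∎
        where
        e₁ : ∀ D E C s X n → D * (E * (C * s * (C * s) * (C * s) * (C * s) * (X * n))) ≡ E * (C * C * C * C) * (s * s * (s * s) * (D * X) * n)
        e₁ = solve-∀
        e₂ : ∀ k n → k * (n * n * (n * n) * n) ≡ k * (n * n * n * n * n)
        e₂ = solve-∀

      t₇ : D * (q * q * q * q * (n * n * n)) ≤ D * (C * C * C * C) * N
      t₇ = begin
        D * (q * q * q * q * (n * n * n)) ≡⟨ e₁ D C s n ⟩
        D * (C * C * C * C) * (s * s * (s * s) * (n * n * n)) ≤⟨ *-monoʳ-≤ (D * (C * C * C * C)) (*-monoˡ-≤ (n * n * n) s⁴) ⟩
        D * (C * C * C * C) * (n * n * (n * n * n)) ≡⟨ e₂ (D * (C * C * C * C)) n ⟩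
        D * (C * C * C * C) * N ∎
        where
        e₁ : ∀ D C s n → D * (C * s * (C * s) * (C * s) * (C * s) * (n * n * n)) ≡ D * (C * C * C * C) * (s * s * (s * s) * (n * n * n))
        e₁ = solve-∀
        e₂ : ∀ k n → k * (n * n * (n * n * n)) ≡ k * (n * n * n * n * n)
        e₂ = solve-∀

    -- Of two copies of D * E * N, the errors counted by `c₁` use up exactly one, while those
    -- counted by `c₂` fall short of the other by E * N.
    too-many : 0 < E * N → N ≤ ℓ * P → P ≤ 2 * S →
      E * S ≤ E * (q * q * q * q * q * W)
        + (n * n * n * n * n + q * (m * n * n * n * n) + E * (q * q * (X * (n * n)))
           + q * q * (n * n * n * n) + q * q * q * (m * n * n * n)
           + E * (q * q * q * q * (X * n)) + q * q * q * q * (n * n * n)) → ⊥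
    too-many pos hP hS h = <⇒≱ bound (≤-reflexive refl)
      where
      open ≤-Reasoning
      chain : 2 * (D * E * N) ≤ 4 * ℓ * c₂ * (E * N) + D * E * N
      chain = begin
        2 * (D * E * N) ≤⟨ *-monoʳ-≤ 2 (*-monoʳ-≤ (D * E) (≤-trans hP (*-monoʳ-≤ ℓ hS))) ⟩
        2 * (D * E * (ℓ * (2 * S))) ≡⟨ e₁ D E ℓ S ⟩
        4 * ℓ * (D * (E * S)) ≤⟨ *-monoʳ-≤ (4 * ℓ) (*-monoʳ-≤ D h) ⟩
        _ ≤⟨ *-monoʳ-≤ (4 * ℓ) errors-small ⟩
        4 * ℓ * ((E * c₂ + D * c₁) * N) ≡⟨ e₂ ℓ E c₂ D c₁ N ⟩
        4 * ℓ * c₂ * (E * N) + D * (4 * ℓ * c₁) * N ∎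
        where
        e₁ : ∀ D E ℓ S → 2 * (D * E * (ℓ * (2 * S))) ≡ 4 * ℓ * (D * (E * S))
        e₁ = solve-∀
        e₂ : ∀ ℓ E c₂ D c₁ N → 4 * ℓ * ((E * c₂ + D * c₁) * N) ≡ 4 * ℓ * c₂ * (E * N) + D * (4 * ℓ * c₁) * N
        e₂ = solve-∀
      bound : D * E * N < D * E * N
      bound = begin-strict
        D * E * N ≤⟨ +-cancelʳ-≤ (D * E * N) _ _ (≤-trans (≤-reflexive (e₁ (D * E * N))) chain) ⟩
        4 * ℓ * c₂ * (E * N) <⟨ m<n+m _ pos ⟩
        E * N + 4 * ℓ * c₂ * (E * N) ≡⟨ e₂ (4 * ℓ * c₂) E N ⟩
        D * E * N ∎
        where
        e₁ : ∀ k → k + k ≡ 2 * k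
        e₁ = solve-∀
        e₂ : ∀ k E N → E * N + k * (E * N) ≡ suc k * E * N
        e₂ = solve-∀

  no-closed-walk : ∀ {n} s (a : Mat n) R → 0 < n → s * s ≤ n →
    (∀ x → Σ[ n ] (a x) ≤ M * s) → (∀ y → Σ[ n ] (λ x → a x y) ≤ M * s) →
    sparsity * total (excess a) ≤ n * n → sparsity * closed5 a ≤ n * n * s →
    Dominates regularity (C * s) a (λ x y → ind (R x y)) →
    ∀ V₁ V₂ V₃ V₄ V₅ →
    n ≤ L * size V₁ → n ≤ L * size V₂ → n ≤ L * size V₃ → n ≤ L * size V₄ → n ≤ L * size V₅ →
    DenseOn R V₁ V₂ → DenseOn R V₂ V₃ → DenseOn R V₃ V₄ → DenseOn R V₄ V₅ → DenseOn R V₅ V₁ → ⊥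
  no-closed-walk {n} s a R pos s²≤n row col hX hW dom V₁ V₂ V₃ V₄ V₅ n₁ n₂ n₃ n₄ n₅ d₁ d₂ d₃ d₄ d₅ =
    too-many n s (total (excess a)) (closed5 a) S (volume R V₁ V₂ V₃ V₄ V₅) s²≤n hX hW
      (*-mono-≤ (*-mono-≤ (*-mono-≤ {1} {4} (s≤s z≤n) (pos⁵ 1≤L)) (m≤n+m 1 (C * C * C * C + C * C * C * M + C * C + C * M))) (pos⁵ pos))
      (≤-trans (*-mono-≤ (*-mono-≤ (*-mono-≤ (*-mono-≤ n₁ n₂) n₃) n₄) n₅)
        (≤-reflexive (rearrange L (size V₁) (size V₂) (size V₃) (size V₄) (size V₅))))
      (≤-trans (volume≤tr5 R V₁ V₂ V₃ V₄ V₅ d₁ d₂ d₃ d₄ d₅) (≤-reflexive (cong (2 *_) (sym reassociate))))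
      (closed5-lower a row col r₁ r₂ r₃ r₄ r₅
        (dominates-inside dom V₁ V₂) (dominates-inside dom V₂ V₃) (dominates-inside dom V₃ V₄)
        (dominates-inside dom V₄ V₅) (dominates-inside dom V₅ V₁)
        (inside≤1 V₁ V₂) (inside≤1 V₂ V₃) (inside≤1 V₃ V₄) (inside≤1 V₄ V₅) (inside≤1 V₅ V₁))
    where
    r₁ = inside R V₁ V₂
    r₂ = inside R V₂ V₃
    r₃ = inside R V₃ V₄
    r₄ = inside R V₄ V₅
    r₅ = inside R V₅ V₁
    S = tr (((r₁ ⊙ r₂) ⊙ r₃) ⊙ (r₄ ⊙ r₅))
    reassociate : S ≡ tr5 r₁ r₂ r₃ r₄ r₅
    reassociate = trans (tr-assoc (r₁ ⊙ r₂) r₃ (r₄ ⊙ r₅)) (tr-assoc r₁ r₂ (r₃ ⊙ (r₄ ⊙ r₅)))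
    inside≤1 : ∀ U V → inside R U V ≼ᶜ 1
    inside≤1 U V x y = *-mono-≤ (*-mono-≤ (ind≤1 (U x)) (ind≤1 (R x y))) (ind≤1 (V y))
    1≤L : 1 ≤ L
    1≤L = factor-positive L (≤-trans pos n₁)
    pos⁵ : ∀ {k} → 1 ≤ k → 1 ≤ k * k * k * k * k
    pos⁵ h = *-mono-≤ (*-mono-≤ (*-mono-≤ (*-mono-≤ h h) h) h) h
    rearrange : ∀ L a b c d e → L * a * (L * b) * (L * c) * (L * d) * (L * e) ≡ L * L * L * L * L * (a * (b * (c * (d * (e * 1)))))
    rearrange = solve-∀

-- The weak regularity step

form-total : ∀ {n} (P : Mat n) f g → form P f g ≡ total (λ x y → f x * P x y * g y)
form-total P f g = Σ-cong λ x →
  sym (trans (Σ-cong (λ y → *-assoc (f x) (P x y) (g y))) (Σ-*ˡ (f x) (λ y → P x y * g y)))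

total-mono : ∀ {n} {P Q : Mat n} → P ≼ Q → total P ≤ total Q
total-mono h = Σ-mono (λ x → Σ-mono (h x))

total-cong : ∀ {n} {P Q : Mat n} → P ≐ Q → total P ≡ total Q
total-cong h = Σ-cong (λ x → Σ-cong (h x))

total-⊕ : ∀ {n} (P Q : Mat n) → total (P ⊕ Q) ≡ total P + total Q
total-⊕ {n} P Q = trans (Σ-cong (λ x → Σ-+ (P x) (Q x))) (Σ-+ (λ x → Σ[ n ] (P x)) (λ x → Σ[ n ] (Q x)))

Region : ℕ → Set
Region n = Fin n → Fin n → Bool

⟦_⟧ : ∀ {n} → Region n → Mat n
⟦ R ⟧ x y = ind (R x y)

area : ∀ {n} → Region n → ℕ
area R = total ⟦ R ⟧

missed : ∀ {n} → Mat n → Region n → ℕ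
missed a R = total (λ x y → a x y * ind (not (R x y)))

_⊑_ : ∀ {n} → Region n → Region n → Set
R ⊑ R′ = ∀ x y → ind (R x y) ≤ ind (R′ x y)

IsBlock : ∀ {n K} → (Fin n → Fin K) → Region n → Set
IsBlock c R = ∀ {x x′ y y′} → c x ≡ c x′ → c y ≡ c y′ → R x y ≡ R x′ y′

cut : ∀ {n} → Region n → (X Y : Fin n → Bool) → Region n
cut R X Y x y = R x y ∧ not (X x ∧ Y y)

area-cut : ∀ {n} (R : Region n) X Y →
  area R ≡ area (cut R X Y) + form ⟦ R ⟧ (λ x → ind (X x)) (λ y → ind (Y y))
area-cut R X Y = trans (trans (total-cong (λ x y → pointwise (R x y) (X x) (Y y))) (total-⊕ ⟦ cut R X Y ⟧ _))
  (cong (area (cut R X Y) +_) (sym (form-total ⟦ R ⟧ (λ x → ind (X x)) (λ y → ind (Y y)))))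
  where
  pointwise : ∀ r x y → ind r ≡ ind (r ∧ not (x ∧ y)) + ind x * ind r * ind y
  pointwise false false y = refl
  pointwise false true y = refl
  pointwise true false y = refl
  pointwise true true false = refl
  pointwise true true true = refl

missed-cut : ∀ {n} (a : Mat n) (R : Region n) X Y →
  missed a (cut R X Y) ≤ missed a R + form a (λ x → ind (X x)) (λ y → ind (Y y))
missed-cut a R X Y = ≤-trans (total-mono (λ x y → pointwise (a x y) (R x y) (X x) (Y y)))
  (≤-reflexive (trans (total-⊕ (λ x y → a x y * ind (not (R x y))) _) (cong (missed a R +_) (sym (form-total a (λ x → ind (X x)) (λ y → ind (Y y)))))))
  where
  pointwise : ∀ k r x y → k * ind (not (r ∧ not (x ∧ y))) ≤ k * ind (not r) + ind x * k * ind y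
  pointwise k false x y = m≤m+n _ _
  pointwise k true false y = ≤-trans (≤-reflexive (*-zeroʳ k)) z≤n
  pointwise k true true false = ≤-trans (≤-reflexive (*-zeroʳ k)) z≤n
  pointwise k true true true = ≤-trans (≤-reflexive (e k)) (m≤n+m _ (k * 0))
    where
    e : ∀ k → k * 1 ≡ (k + 0) * 1
    e = solve-∀

cut-⊑ : ∀ {n} (R : Region n) X Y → cut R X Y ⊑ R
cut-⊑ R X Y x y = pointwise (R x y) _
  where
  pointwise : ∀ r z → ind (r ∧ z) ≤ ind r
  pointwise false z = z≤n
  pointwise true z = ind≤1 z

bit : Bool → Fin 2
bit false = zero
bit true = suc zero

bit-injective : ∀ {b b′} → bit b ≡ bit b′ → b ≡ b′
bit-injective {false} {false} _ = refl
bit-injective {true} {true} _ = refl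

refine : ∀ {n K} → (Fin n → Fin K) → (X Y : Fin n → Bool) → Fin n → Fin (K * 2 * 2)
refine c X Y x = F.combine (F.combine (c x) (bit (X x))) (bit (Y x))

refine-cut : ∀ {n K} (c : Fin n → Fin K) R X Y → IsBlock c R → IsBlock (refine c X Y) (cut R X Y)
refine-cut c R X Y blk {x} {x′} {y} {y′} p q =
  cong₂ (λ r z → r ∧ not z) (blk (proj₁ cx) (proj₁ cy)) (cong₂ _∧_ (bit-injective (proj₂ cx)) (bit-injective (proj₂ qy)))
  where
  px = combine-injective (F.combine (c x) (bit (X x))) (bit (Y x)) (F.combine (c x′) (bit (X x′))) (bit (Y x′)) p
  cx = combine-injective (c x) (bit (X x)) (c x′) (bit (X x′)) (proj₁ px)
  qy = combine-injective (F.combine (c y) (bit (X y))) (bit (Y y)) (F.combine (c y′) (bit (X y′))) (bit (Y y′)) q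
  cy = combine-injective (c y) (bit (X y)) (c y′) (bit (X y′)) (proj₁ qy)

-- Finitely many pairs of sets can be searched, which gives the case distinction constructively.
-- Sets are enumerated as vectors, hence the passage through `tabulate` and `lookup`.
dominates-or-violated : ∀ {n} E q (a r : Mat n) → Dominates E q a r ⊎
  (Σ[ X ∈ (Fin n → Bool) ] Σ[ Y ∈ (Fin n → Bool) ]
    E * (q * form a (λ x → ind (X x)) (λ y → ind (Y y))) + n * n < E * form r (λ x → ind (X x)) (λ y → ind (Y y)))
dominates-or-violated {n} E q a r with anySubset? (λ X → anySubset? (λ Y →
    E * (q * form a (λ x → ind (lookup X x)) (λ y → ind (lookup Y y))) + n * n
      <? E * form r (λ x → ind (lookup X x)) (λ y → ind (lookup Y y))))
... | yes (X , Y , h) = inj₂ (lookup X , lookup Y , h)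
... | no ¬h = inj₁ record { on-rectangles = λ X Y → subst₂ (λ s t → E * s ≤ E * (q * t) + n * n) (same r X Y) (same a X Y)
        (≮⇒≥ (λ h → ¬h (tabulate X , tabulate Y , h))) }
  where
  same : ∀ (P : Mat n) X Y → form P (λ x → ind (lookup (tabulate X) x)) (λ y → ind (lookup (tabulate Y) y))
    ≡ form P (λ x → ind (X x)) (λ y → ind (Y y))
  same P X Y = form-cong P P (λ x → ind (lookup (tabulate X) x)) (λ x → ind (X x))
    (λ y → ind (lookup (tabulate Y) y)) (λ y → ind (Y y)) (λ x y → cong₂ (λ s t → ind s * P x y * ind t) (lookup∘tabulate X x) (lookup∘tabulate Y y))

-- Each cut splits a cell into at most four, by membership in the two sides of the rectangle.
labels : ℕ → ℕ → ℕ
labels zero K = K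
labels (suc k) K = labels k (K * 2 * 2)

K≤labels : ∀ k K → K ≤ labels k K
K≤labels zero K = ≤-refl
K≤labels (suc k) K = ≤-trans (≤-trans (m≤m*n K 2) (m≤m*n (K * 2) 2)) (K≤labels k (K * 2 * 2))

record Shrunk {n} (E q : ℕ) (a : Mat n) (R : Region n) (K′ : ℕ) : Set where
  field
    region    : Region n
    label     : Fin n → Fin K′
    isBlock   : IsBlock label region
    shrinks   : region ⊑ R
    charged   : q * missed a region + area region ≤ n * n
    dominated : Dominates E q a ⟦ region ⟧

-- Cutting off a rectangle on which domination fails is paid for by the area lost.
shrink : ∀ {n K} E q (a : Mat n) k (c : Fin n → Fin K) R → IsBlock c R →
  q * missed a R + area R ≤ n * n → E * area R ≤ k * (n * n) → Shrunk E q a R (labels k K)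
shrink {n} {K} E q a k c R blk paid fuel with dominates-or-violated E q a ⟦ R ⟧
... | inj₁ dom = record
  { region = R
  -- Unspent cuts are made up for by enlarging the label set: the number of labels has to depend
  -- only on `k` and `K`, not on the graph.
  ; label = λ x → F.inject≤ (c x) (K≤labels k K)
  ; isBlock = λ p q → blk (inject≤-injective (K≤labels k K) (K≤labels k K) _ _ p) (inject≤-injective (K≤labels k K) (K≤labels k K) _ _ q)
  ; shrinks = λ x y → ≤-refl
  ; charged = paid
  ; dominated = dom
  }
shrink {n} {K} E q a zero c R blk paid fuel | inj₂ (X , Y , h) = ⊥-elim (<⇒≱ h (begin
  E * form ⟦ R ⟧ (λ x → ind (X x)) (λ y → ind (Y y)) ≤⟨ *-monoʳ-≤ E (≤-trans (m≤n+m _ (area (cut R X Y))) (≤-reflexive (sym (area-cut R X Y)))) ⟩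
  E * area R ≤⟨ fuel ⟩
  0 ≤⟨ z≤n ⟩
  E * (q * form a (λ x → ind (X x)) (λ y → ind (Y y))) + n * n ∎))
  where open ≤-Reasoning
shrink {n} {K} E q a (suc k) c R blk paid fuel | inj₂ (X , Y , h) = record
  { region = S.region
  ; label = S.label
  ; isBlock = S.isBlock
  ; shrinks = λ x y → ≤-trans (S.shrinks x y) (cut-⊑ R X Y x y)
  ; charged = S.charged
  ; dominated = S.dominated
  }
  where
  open ≤-Reasoning
  fa = form a (λ x → ind (X x)) (λ y → ind (Y y))
  fr = form ⟦ R ⟧ (λ x → ind (X x)) (λ y → ind (Y y))
  -- The violation `h` is used twice. Without its n * n it makes the area lost pay for the edges
  -- lost; without its edge term it makes the cut consume one unit of fuel in `fuel′`.
  qfa≤fr : q * fa ≤ fr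
  qfa≤fr = <⇒≤ (*-cancelˡ-< E (q * fa) fr (≤-<-trans (m≤m+n _ (n * n)) h))
  paid′ : q * missed a (cut R X Y) + area (cut R X Y) ≤ n * n
  paid′ = begin
    q * missed a (cut R X Y) + area (cut R X Y) ≤⟨ +-monoˡ-≤ _ (*-monoʳ-≤ q (missed-cut a R X Y)) ⟩
    q * (missed a R + fa) + area (cut R X Y) ≡⟨ e q (missed a R) fa (area (cut R X Y)) ⟩
    q * missed a R + (area (cut R X Y) + q * fa) ≤⟨ +-monoʳ-≤ (q * missed a R) (+-monoʳ-≤ (area (cut R X Y)) qfa≤fr) ⟩
    q * missed a R + (area (cut R X Y) + fr) ≡⟨ cong (q * missed a R +_) (sym (area-cut R X Y)) ⟩
    q * missed a R + area R ≤⟨ paid ⟩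
    n * n ∎
    where
    e : ∀ q m f r → q * (m + f) + r ≡ q * m + (r + q * f)
    e = solve-∀
  fuel′ : E * area (cut R X Y) ≤ k * (n * n)
  fuel′ = +-cancelˡ-≤ (n * n) _ _ (begin
    n * n + E * area (cut R X Y) ≤⟨ +-monoˡ-≤ _ (≤-trans (m≤n+m (n * n) (E * (q * fa))) (<⇒≤ h)) ⟩
    E * fr + E * area (cut R X Y) ≡⟨ trans (sym (*-distribˡ-+ E fr _)) (cong (E *_) (trans (+-comm fr _) (sym (area-cut R X Y)))) ⟩
    E * area R ≤⟨ fuel ⟩
    n * n + k * (n * n) ∎)
  module S = Shrunk (shrink E q a k (refine c X Y) (cut R X Y) (refine-cut c R X Y blk) paid′ fuel′)

-- Cells of a partition

cell : ∀ {n K} → (Fin n → Fin K) → Fin K → Fin n → Bool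
cell c i x = ⌊ c x F.≟ i ⌋

Σ-cells : ∀ {n K} (c : Fin n → Fin K) (f : Fin n → ℕ) →
  Σ[ n ] f ≡ Σ[ K ] (λ i → Σ[ n ] (λ x → ind (cell c i x) * f x))
Σ-cells {n} {K} c f = trans (Σ-cong (λ x → sym (Σ-δ (c x) (λ _ → f x)))) (Σ-swap (λ x i → ind (cell c i x) * f x))

Σ-size : ∀ {n K} (c : Fin n → Fin K) → Σ[ K ] (λ i → size (cell c i)) ≡ n
Σ-size {n} c = trans (Σ-cong (λ i → Σ-cong (λ x → sym (*-identityʳ (ind (cell c i x))))))
  (trans (sym (Σ-cells c (λ _ → 1))) (trans (Σ-const n 1) (*-identityʳ n)))

cell-mono : ∀ {n K} (c : Fin n → Fin K) i x {u v} → (c x ≡ i → u ≤ v) →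
  ind (cell c i x) * u ≤ ind (cell c i x) * v
cell-mono c i x h with c x F.≟ i
... | yes e = *-monoʳ-≤ 1 (h e)
... | no _ = z≤n

-- Edges in a set of pairs of small area

amgm : ∀ x y → x * y ≤ x * x + y * y
amgm x y with ≤-total x y
... | inj₁ h = ≤-trans (*-monoˡ-≤ y h) (m≤n+m (y * y) (x * x))
... | inj₂ h = ≤-trans (*-monoʳ-≤ x h) (m≤m+n (x * x) (y * y))

module _ {n K} (c : Fin n → Fin K) (a : Mat n) (a-sym : ∀ x y → a x y ≡ a y x) where

  V : Fin K → Fin n → Bool
  V = cell c

  ∣_∣ᶜ : Fin K → ℕ
  ∣ i ∣ᶜ = size (V i)

  degreeInto : Fin K → Fin n → ℕ
  degreeInto i y = Σ[ n ] λ x → ind (V i x) * a x y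

  -- Summed squared degrees into a cell count pairs of vertices of the cell with a common neighbour.
  degreeInto-squares : ∀ i → Σ[ n ] (λ y → degreeInto i y * degreeInto i y) ≤ ∣ i ∣ᶜ * ∣ i ∣ᶜ + total (excess a)
  degreeInto-squares i = begin
    Σ[ n ] (λ y → degreeInto i y * degreeInto i y)
      ≡⟨ Σ-cong (λ y → sym (Σ-* (λ x → ind (V i x) * a x y) (λ z → ind (V i z) * a z y))) ⟩
    Σ[ n ] (λ y → Σ[ n ] (λ x → Σ[ n ] (λ z → ind (V i x) * a x y * (ind (V i z) * a z y))))
      ≡⟨ Σ-swap (λ y x → Σ[ n ] (λ z → ind (V i x) * a x y * (ind (V i z) * a z y))) ⟩
    Σ[ n ] (λ x → Σ[ n ] (λ y → Σ[ n ] (λ z → ind (V i x) * a x y * (ind (V i z) * a z y))))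
      ≡⟨ Σ-cong (λ x → Σ-swap (λ y z → ind (V i x) * a x y * (ind (V i z) * a z y))) ⟩
    Σ[ n ] (λ x → Σ[ n ] (λ z → Σ[ n ] (λ y → ind (V i x) * a x y * (ind (V i z) * a z y))))
      ≡⟨ Σ-cong (λ x → Σ-cong (λ z → trans
           (Σ-cong (λ y → trans (cong (λ t → ind (V i x) * a x y * (ind (V i z) * t)) (a-sym z y))
             (rearrange (ind (V i x)) (a x y) (ind (V i z)) (a y z))))
           (Σ-*ˡ (ind (V i x) * ind (V i z)) (λ y → a x y * a y z)))) ⟩
    Σ[ n ] (λ x → Σ[ n ] (λ z → ind (V i x) * ind (V i z) * codeg a x z))
      ≤⟨ total-mono (λ x z → pointwise (V i x) (V i z) (codeg a x z)) ⟩
    total (λ x z → ind (V i x) * ind (V i z) + excess a x z)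
      ≡⟨ total-⊕ (outer (λ x → ind (V i x)) (λ z → ind (V i z))) (excess a) ⟩
    total (outer (λ x → ind (V i x)) (λ z → ind (V i z))) + total (excess a)
      ≡⟨ cong (_+ total (excess a)) (Σ-* (λ x → ind (V i x)) (λ z → ind (V i z))) ⟩
    ∣ i ∣ᶜ * ∣ i ∣ᶜ + total (excess a) ∎
    where
    open ≤-Reasoning
    rearrange : ∀ u a v b → u * a * (v * b) ≡ u * v * (a * b)
    rearrange = solve-∀
    pointwise : ∀ b d k → ind b * ind d * k ≤ ind b * ind d + (k ∸ 1)
    pointwise false d k = z≤n
    pointwise true false k = z≤n
    pointwise true true zero = z≤n
    pointwise true true (suc k) = ≤-reflexive (cong suc (+-identityʳ k))

  module _ (Bad : Region n) (fibred : ∀ {x x′} y → c x ≡ c x′ → Bad x y ≡ Bad x′ y)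
           (L : ℕ) (large : ∀ x y → Bad x y ≡ true → n ≤ L * ∣ c x ∣ᶜ)
           (hX : K * L * total (excess a) ≤ n * n) .{{_ : NonZero K}} .{{_ : NonZero L}} where

    private
      w z : Fin K → Fin n → ℕ
      w i y = Σ[ n ] λ x → ind (V i x) * (a x y * ind (Bad x y))
      z i y = Σ[ n ] λ x → ind (V i x) * ind (Bad x y)

      Z W : Fin K → ℕ
      Z i = Σ[ n ] (z i)
      W i = Σ[ n ] (w i)

      z≤ : ∀ i y → z i y ≤ ∣ i ∣ᶜ
      z≤ i y = Σ-mono (λ x → ≤-trans (*-monoʳ-≤ (ind (V i x)) (ind≤1 (Bad x y))) (≤-reflexive (*-identityʳ _)))

      w≤ : ∀ i y → w i y ≤ degreeInto i y
      w≤ i y = Σ-mono (λ x → *-monoʳ-≤ (ind (V i x))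
        (≤-trans (*-monoʳ-≤ (a x y) (ind≤1 (Bad x y))) (≤-reflexive (*-identityʳ _))))

      -- Bad is constant on the fibres of c, so the factor z i y is either 0, and then so is w i y, or ∣ i ∣ᶜ.
      size*w : ∀ i y → ∣ i ∣ᶜ * w i y ≤ z i y * w i y
      size*w i y = begin
        ∣ i ∣ᶜ * w i y ≡⟨ sym (Σ-* (λ x → ind (V i x)) (λ x′ → ind (V i x′) * (a x′ y * ind (Bad x′ y)))) ⟩
        Σ[ n ] (λ x → Σ[ n ] (λ x′ → ind (V i x) * (ind (V i x′) * (a x′ y * ind (Bad x′ y)))))
          ≤⟨ Σ-mono (λ x → Σ-mono (λ x′ → cell-mono c i x (λ e → cell-mono c i x′ (λ e′ → *-monoʳ-≤ (a x′ y)
               (≤-reflexive (trans (sym (ind-idem (Bad x′ y))) (cong (λ b → ind b * ind (Bad x′ y)) (fibred y (trans e′ (sym e)))))))))) ⟩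
        Σ[ n ] (λ x → Σ[ n ] (λ x′ → ind (V i x) * (ind (V i x′) * (a x′ y * (ind (Bad x y) * ind (Bad x′ y))))))
          ≡⟨ Σ-cong (λ x → Σ-cong (λ x′ → rearrange (ind (V i x)) (ind (V i x′)) (a x′ y) (ind (Bad x y)) (ind (Bad x′ y)))) ⟩
        Σ[ n ] (λ x → Σ[ n ] (λ x′ → ind (V i x) * ind (Bad x y) * (ind (V i x′) * (a x′ y * ind (Bad x′ y)))))
          ≡⟨ Σ-* (λ x → ind (V i x) * ind (Bad x y)) (λ x′ → ind (V i x′) * (a x′ y * ind (Bad x′ y))) ⟩
        z i y * w i y ∎
        where
        open ≤-Reasoning
        rearrange : ∀ u v a b d → u * (v * (a * (b * d))) ≡ u * b * (v * (a * d))
        rearrange = solve-∀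

      -- Cauchy-Schwarz in the form of `amgm`, with `θ` left free to balance the two terms. Only one
      -- factor `z i y` is bounded by the cell size, so the first term stays linear in the area.
      row-bound : ∀ θ s i y → θ * s * (∣ i ∣ᶜ * w i y) ≤ θ * θ * (∣ i ∣ᶜ * z i y) + s * s * (degreeInto i y * degreeInto i y)
      row-bound θ s i y = begin
        θ * s * (∣ i ∣ᶜ * w i y) ≤⟨ *-monoʳ-≤ (θ * s) (size*w i y) ⟩
        θ * s * (z i y * w i y) ≡⟨ e₁ θ s (z i y) (w i y) ⟩
        θ * z i y * (s * w i y) ≤⟨ amgm (θ * z i y) (s * w i y) ⟩
        θ * z i y * (θ * z i y) + s * w i y * (s * w i y) ≡⟨ e₂ θ s (z i y) (w i y) ⟩
        θ * θ * (z i y * z i y) + s * s * (w i y * w i y)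
          ≤⟨ +-mono-≤ (*-monoʳ-≤ (θ * θ) (*-monoˡ-≤ (z i y) (z≤ i y))) (*-monoʳ-≤ (s * s) (*-mono-≤ (w≤ i y) (w≤ i y))) ⟩
        θ * θ * (∣ i ∣ᶜ * z i y) + s * s * (degreeInto i y * degreeInto i y) ∎
        where
        open ≤-Reasoning
        e₁ : ∀ θ s z w → θ * s * (z * w) ≡ θ * z * (s * w)
        e₁ = solve-∀
        e₂ : ∀ θ s z w → θ * z * (θ * z) + s * w * (s * w) ≡ θ * θ * (z * z) + s * s * (w * w)
        e₂ = solve-∀

      cell-bound : ∀ θ s i → θ * s * (∣ i ∣ᶜ * W i) ≤ θ * θ * (∣ i ∣ᶜ * Z i) + s * s * (∣ i ∣ᶜ * ∣ i ∣ᶜ + total (excess a))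
      cell-bound θ s i = begin
        θ * s * (∣ i ∣ᶜ * W i) ≡⟨ sym (factor (θ * s) ∣ i ∣ᶜ (w i)) ⟩
        Σ[ n ] (λ y → θ * s * (∣ i ∣ᶜ * w i y)) ≤⟨ Σ-mono (row-bound θ s i) ⟩
        Σ[ n ] (λ y → θ * θ * (∣ i ∣ᶜ * z i y) + s * s * (degreeInto i y * degreeInto i y))
          ≡⟨ Σ-+ (λ y → θ * θ * (∣ i ∣ᶜ * z i y)) (λ y → s * s * (degreeInto i y * degreeInto i y)) ⟩
        Σ[ n ] (λ y → θ * θ * (∣ i ∣ᶜ * z i y)) + Σ[ n ] (λ y → s * s * (degreeInto i y * degreeInto i y))
          ≡⟨ cong₂ _+_ (factor (θ * θ) ∣ i ∣ᶜ (z i)) (Σ-*ˡ (s * s) (λ y → degreeInto i y * degreeInto i y)) ⟩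
        θ * θ * (∣ i ∣ᶜ * Z i) + s * s * Σ[ n ] (λ y → degreeInto i y * degreeInto i y)
          ≤⟨ +-monoʳ-≤ (θ * θ * (∣ i ∣ᶜ * Z i)) (*-monoʳ-≤ (s * s) (degreeInto-squares i)) ⟩
        θ * θ * (∣ i ∣ᶜ * Z i) + s * s * (∣ i ∣ᶜ * ∣ i ∣ᶜ + total (excess a)) ∎
        where
        open ≤-Reasoning
        factor : ∀ j k (f : Fin n → ℕ) → Σ[ n ] (λ y → j * (k * f y)) ≡ j * (k * Σ[ n ] f)
        factor j k f = trans (Σ-*ˡ j (λ y → k * f y)) (cong (j *_) (Σ-*ˡ k f))

      W-large : ∀ i → 1 ≤ W i → n ≤ L * ∣ i ∣ᶜ
      W-large i h with n ≤? L * ∣ i ∣ᶜ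
      ... | yes p = p
      ... | no ¬p = ⊥-elim (<⇒≱ h (≤-trans (Σ-≤ {k = 0} (λ y → ≤-trans (Σ-≤ {k = 0} (zeroTerm y)) (≤-reflexive (*-zeroʳ n)))) (≤-reflexive (*-zeroʳ n))))
        where
        zeroTerm : ∀ y x → ind (V i x) * (a x y * ind (Bad x y)) ≤ 0
        zeroTerm y x = ≤-trans (cell-mono c i x {v = 0} inner) (≤-reflexive (*-zeroʳ (ind (V i x))))
          where
          inner : c x ≡ i → a x y * ind (Bad x y) ≤ 0
          inner e with Bad x y in eq
          ... | true = ⊥-elim (¬p (subst (λ j → n ≤ L * ∣ j ∣ᶜ) e (large x y eq)))
          ... | false = ≤-reflexive (*-zeroʳ (a x y))

      -- Dividing `cell-bound` by the cell size needs a large cell, which is guaranteed once `W i`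
      -- is nonzero. Then `hX` turns the excess divided by the cell size into at most n / K, one
      -- share for each cell.
      cell-bound′ : ∀ θ s i → K * (θ * s * W i) ≤ K * (θ * θ * Z i) + s * s * (K * ∣ i ∣ᶜ + n)
      cell-bound′ θ s i with W i in eq
      ... | zero = ≤-trans (≤-reflexive (e K θ s)) z≤n
        where
        e : ∀ K θ s → K * (θ * s * 0) ≡ 0
        e = solve-∀
      ... | suc w₀ = *-cancelˡ-≤ (L * ∣ i ∣ᶜ) {{>-nonZero (≤-trans n>0 n≤)}} (begin
        L * v * (K * (θ * s * suc w₀)) ≡⟨ e₁ L v K θ s (suc w₀) ⟩
        K * L * (θ * s * (v * suc w₀)) ≤⟨ *-monoʳ-≤ (K * L) (subst (λ t → θ * s * (v * t) ≤ θ * θ * (v * Z i) + s * s * (v * v + X)) eq (cell-bound θ s i)) ⟩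
        K * L * (θ * θ * (v * Z i) + s * s * (v * v + X)) ≡⟨ e₂ L v K θ s (Z i) X ⟩
        L * v * (K * (θ * θ * Z i)) + s * s * (K * L * v * v + K * L * X)
          ≤⟨ +-monoʳ-≤ (L * v * (K * (θ * θ * Z i))) (*-monoʳ-≤ (s * s) (+-monoʳ-≤ (K * L * v * v) (≤-trans hX (*-monoˡ-≤ n n≤)))) ⟩
        L * v * (K * (θ * θ * Z i)) + s * s * (K * L * v * v + L * v * n) ≡⟨ e₃ L v K θ s (Z i) n ⟩
        L * v * (K * (θ * θ * Z i) + s * s * (K * v + n)) ∎)
        where
        open ≤-Reasoning
        v = ∣ i ∣ᶜ
        X = total (excess a)
        n≤ : n ≤ L * ∣ i ∣ᶜ
        n≤ = W-large i (subst (1 ≤_) (sym eq) (s≤s z≤n))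
        n>0 : 1 ≤ n
        n>0 = nonempty (subst (1 ≤_) (sym eq) (s≤s z≤n))
          where
          nonempty : 1 ≤ W i → 1 ≤ n
          nonempty h with n ≟ 0
          ... | yes p = ⊥-elim (<⇒≱ h (≤-trans (Σ-≤ {k = W i} (λ y → Σ-term (w i) y)) (≤-reflexive (cong (_* W i) p))))
          ... | no ¬p = n≢0⇒n>0 ¬p
        e₁ : ∀ L v K θ s w → L * v * (K * (θ * s * w)) ≡ K * L * (θ * s * (v * w))
        e₁ = solve-∀
        e₂ : ∀ L v K θ s z X → K * L * (θ * θ * (v * z) + s * s * (v * v + X)) ≡ L * v * (K * (θ * θ * z)) + s * s * (K * L * v * v + K * L * X)
        e₂ = solve-∀
        e₃ : ∀ L v K θ s z n → L * v * (K * (θ * θ * z)) + s * s * (K * L * v * v + L * v * n) ≡ L * v * (K * (θ * θ * z) + s * s * (K * v + n))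
        e₃ = solve-∀

    -- In other words, there are at most θ * area / s + 2 * s * n / θ edges in `Bad`. The 2 joins
    -- the squared cell sizes and the excess: each contributes n after division by the cell sizes
    -- and summation over the cells.
    edges-in-small-area : ∀ θ s → θ * s * total (λ x y → a x y * ind (Bad x y)) ≤ θ * θ * area Bad + 2 * (s * s * n)
    edges-in-small-area θ s = *-cancelˡ-≤ K (begin
      K * (θ * s * total (λ x y → a x y * ind (Bad x y))) ≡⟨ cong (λ t → K * (θ * s * t)) (by-cells (λ x y → a x y * ind (Bad x y))) ⟩
      K * (θ * s * Σ[ K ] W) ≡⟨ sym (factor K (θ * s) W) ⟩
      Σ[ K ] (λ i → K * (θ * s * W i)) ≤⟨ Σ-mono (cell-bound′ θ s) ⟩
      Σ[ K ] (λ i → K * (θ * θ * Z i) + s * s * (K * ∣ i ∣ᶜ + n)) ≡⟨ Σ-+ (λ i → K * (θ * θ * Z i)) (λ i → s * s * (K * ∣ i ∣ᶜ + n)) ⟩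
      Σ[ K ] (λ i → K * (θ * θ * Z i)) + Σ[ K ] (λ i → s * s * (K * ∣ i ∣ᶜ + n))
        ≡⟨ cong₂ _+_ (factor K (θ * θ) Z) (trans (Σ-*ˡ (s * s) (λ i → K * ∣ i ∣ᶜ + n)) (cong (s * s *_) sizes)) ⟩
      K * (θ * θ * Σ[ K ] Z) + s * s * (K * n + K * n) ≡⟨ cong (λ t → K * (θ * θ * t) + s * s * (K * n + K * n)) (sym (by-cells ⟦ Bad ⟧)) ⟩
      K * (θ * θ * area Bad) + s * s * (K * n + K * n) ≡⟨ e K (θ * θ) s n (area Bad) ⟩
      K * (θ * θ * area Bad + 2 * (s * s * n)) ∎)
      where
      open ≤-Reasoning
      factor : ∀ j k (f : Fin K → ℕ) → Σ[ K ] (λ y → j * (k * f y)) ≡ j * (k * Σ[ K ] f)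
      factor j k f = trans (Σ-*ˡ j (λ y → k * f y)) (cong (j *_) (Σ-*ˡ k f))
      by-cells : ∀ (P : Mat n) → total P ≡ Σ[ K ] (λ i → Σ[ n ] (λ y → Σ[ n ] (λ x → ind (V i x) * P x y)))
      by-cells P = trans (Σ-swap P) (trans (Σ-cong (λ y → Σ-cells c (λ x → P x y))) (Σ-swap (λ y i → Σ[ n ] (λ x → ind (V i x) * P x y))))
      sizes : Σ[ K ] (λ i → K * ∣ i ∣ᶜ + n) ≡ K * n + K * n
      sizes = trans (Σ-+ (λ i → K * ∣ i ∣ᶜ) (λ _ → n)) (cong₂ _+_ (trans (Σ-*ˡ K ∣_∣ᶜ) (cong (K *_) (Σ-size c))) (Σ-const K n))
      e : ∀ K k s n z → K * (k * z) + s * s * (K * n + K * n) ≡ K * (k * z + 2 * (s * s * n))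
      e = solve-∀

-- Cleaning the graph along two models

⌊⌋-true : ∀ {P : Set} (P? : Dec P) → ⌊ P? ⌋ ≡ true → P
⌊⌋-true (yes p) _ = p

⌊⌋-false : ∀ {P : Set} (P? : Dec P) → ⌊ P? ⌋ ≡ false → P → ⊥
⌊⌋-false (no ¬p) _ p = ¬p p

∧-trueˡ : ∀ {b c} → b ∧ c ≡ true → b ≡ true
∧-trueˡ {true} _ = refl

∧-trueʳ : ∀ {b c} → b ∧ c ≡ true → c ≡ true
∧-trueʳ {true} h = h

cell-self : ∀ {n K} (c : Fin n → Fin K) x → cell c (c x) x ≡ true
cell-self c x with c x F.≟ c x
... | yes _ = refl
... | no ¬p = ⊥-elim (¬p refl)

module Cleaning {n K : ℕ} (c : Fin n → Fin K) (R R′ : Region n) (blk : IsBlock c R) (L : ℕ) where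

  large : Fin K → Bool
  large i = ⌊ n ≤? L * size (cell c i) ⌋

  dense? : ∀ i j → Dec (DenseOn R′ (cell c i) (cell c j))
  dense? i j = _ ≤? _

  -- `R` and the cells belong to the old model, while density is measured in the new one. In `bad`
  -- the cell of `x` is large because the bound on the edges there divides by its size.
  keep bad : Region n
  keep x y = large (c x) ∧ large (c y) ∧ R x y ∧ ⌊ dense? (c x) (c y) ⌋
  bad x y = large (c x) ∧ R x y ∧ not ⌊ dense? (c x) (c y) ⌋

  keep-large : ∀ {x y} → keep x y ≡ true → n ≤ L * size (cell c (c x))
  keep-large h = ⌊⌋-true (n ≤? _) (∧-trueˡ h)

  keep-dense : ∀ {x y} → keep x y ≡ true → DenseOn R′ (cell c (c x)) (cell c (c y))
  keep-dense {x} {y} h = ⌊⌋-true (dense? (c x) (c y)) (∧-trueʳ {R x y} (∧-trueʳ {large (c y)} (∧-trueʳ {large (c x)} h)))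

  bad-large : ∀ x y → bad x y ≡ true → n ≤ L * size (cell c (c x))
  bad-large x y h = ⌊⌋-true (n ≤? _) (∧-trueˡ h)

  bad-fibred : ∀ {x x′} y → c x ≡ c x′ → bad x y ≡ bad x′ y
  bad-fibred y e = cong₂ _∧_ (cong large e) (cong₂ _∧_ (blk e refl) (cong (λ i → not ⌊ dense? i (c y) ⌋) e))

  lost : Mat n → ℕ
  lost a = missed a keep

  lost-split : ∀ (a : Mat n) → lost a ≤
    total (λ x y → a x y * ind (not (large (c x)))) + total (λ x y → a x y * ind (not (large (c y))))
      + missed a R + total (λ x y → a x y * ind (bad x y))
  lost-split a = ≤-trans
    (total-mono (λ x y → ≤-trans (*-monoʳ-≤ (a x y) (pointwise (large (c x)) (large (c y)) (R x y) ⌊ dense? (c x) (c y) ⌋))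
      (≤-reflexive (distribute (a x y) (ind (not (large (c x)))) (ind (not (large (c y)))) (ind (not (R x y))) (ind (bad x y))))))
    (≤-reflexive (trans (total-⊕ (A₁ ⊕ A₂ ⊕ A₃) A₄) (cong (_+ total A₄)
      (trans (total-⊕ (A₁ ⊕ A₂) A₃) (cong (_+ total A₃) (total-⊕ A₁ A₂))))))
    where
    A₁ A₂ A₃ A₄ : Mat n
    A₁ x y = a x y * ind (not (large (c x)))
    A₂ x y = a x y * ind (not (large (c y)))
    A₃ x y = a x y * ind (not (R x y))
    A₄ x y = a x y * ind (bad x y)
    distribute : ∀ k b d e f → k * (b + d + e + f) ≡ k * b + k * d + k * e + k * f
    distribute = solve-∀
    pointwise : ∀ l l′ r d → ind (not (l ∧ l′ ∧ r ∧ d)) ≤ ind (not l) + ind (not l′) + ind (not r) + ind (l ∧ r ∧ not d)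
    pointwise false l′ r d = m≤m+n 1 _
    pointwise true false r d = m≤m+n 1 _
    pointwise true true false d = m≤m+n 1 _
    pointwise true true true false = ≤-refl
    pointwise true true true true = z≤n

  small-total : L * Σ[ n ] (λ x → ind (not (large (c x)))) ≤ K * n
  small-total = begin
    L * Σ[ n ] (λ x → ind (not (large (c x)))) ≡⟨ cong (L *_) (Σ-cells c (λ x → ind (not (large (c x))))) ⟩
    L * Σ[ K ] (λ i → Σ[ n ] (λ x → ind (cell c i x) * ind (not (large (c x))))) ≡⟨ sym (Σ-*ˡ L (λ i → Σ[ n ] (λ x → ind (cell c i x) * ind (not (large (c x)))))) ⟩
    Σ[ K ] (λ i → L * Σ[ n ] (λ x → ind (cell c i x) * ind (not (large (c x)))))
      ≤⟨ Σ-≤ {k = n} (λ i → ≤-trans (*-monoʳ-≤ L (Σ-mono (λ x → cell-mono c i x (λ e → ≤-reflexive (cong (λ j → ind (not (large j))) e)))))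
           (≤-trans (≤-reflexive (cong (L *_) (Σ-*ʳ (λ x → ind (cell c i x)) (ind (not (large i)))))) (small i))) ⟩
    K * n ∎
    where
    open ≤-Reasoning
    small : ∀ i → L * (size (cell c i) * ind (not (large i))) ≤ n
    small i with n ≤? L * size (cell c i)
    ... | yes _ = ≤-trans (≤-reflexive (trans (cong (L *_) (*-zeroʳ (size (cell c i)))) (*-zeroʳ L))) z≤n
    ... | no h = ≤-trans (≤-reflexive (cong (L *_) (*-identityʳ (size (cell c i))))) (<⇒≤ (≰⇒> h))

  module _ (a : Mat n) {m} (row : ∀ x → Σ[ n ] (a x) ≤ m) (col : ∀ y → Σ[ n ] (λ x → a x y) ≤ m) where

    lost-smallˡ : L * total (λ x y → a x y * ind (not (large (c x)))) ≤ m * (K * n)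
    lost-smallˡ = begin
      L * total (λ x y → a x y * ind (not (large (c x)))) ≡⟨ cong (L *_) (Σ-cong (λ x → Σ-*ʳ (a x) (ind (not (large (c x)))))) ⟩
      L * Σ[ n ] (λ x → Σ[ n ] (a x) * ind (not (large (c x)))) ≤⟨ *-monoʳ-≤ L (Σ-mono (λ x → *-monoˡ-≤ (ind (not (large (c x)))) (row x))) ⟩
      L * Σ[ n ] (λ x → m * ind (not (large (c x)))) ≡⟨ cong (L *_) (Σ-*ˡ m (λ x → ind (not (large (c x))))) ⟩
      L * (m * Σ[ n ] (λ x → ind (not (large (c x))))) ≡⟨ e L m _ ⟩
      m * (L * Σ[ n ] (λ x → ind (not (large (c x))))) ≤⟨ *-monoʳ-≤ m small-total ⟩
      m * (K * n) ∎
      where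
      open ≤-Reasoning
      e : ∀ L m t → L * (m * t) ≡ m * (L * t)
      e = solve-∀

    lost-smallʳ : L * total (λ x y → a x y * ind (not (large (c y)))) ≤ m * (K * n)
    lost-smallʳ = begin
      L * total (λ x y → a x y * ind (not (large (c y)))) ≡⟨ cong (L *_) (Σ-swap (λ x y → a x y * ind (not (large (c y))))) ⟩
      L * Σ[ n ] (λ y → Σ[ n ] (λ x → a x y * ind (not (large (c y))))) ≡⟨ cong (L *_) (Σ-cong (λ y → Σ-*ʳ (λ x → a x y) (ind (not (large (c y)))))) ⟩
      L * Σ[ n ] (λ y → Σ[ n ] (λ x → a x y) * ind (not (large (c y)))) ≤⟨ *-monoʳ-≤ L (Σ-mono (λ x → *-monoˡ-≤ (ind (not (large (c x)))) (col x))) ⟩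
      L * Σ[ n ] (λ x → m * ind (not (large (c x)))) ≡⟨ cong (L *_) (Σ-*ˡ m (λ x → ind (not (large (c x))))) ⟩
      L * (m * Σ[ n ] (λ x → ind (not (large (c x))))) ≡⟨ e L m _ ⟩
      m * (L * Σ[ n ] (λ x → ind (not (large (c x))))) ≤⟨ *-monoʳ-≤ m small-total ⟩
      m * (K * n) ∎
      where
      open ≤-Reasoning
      e : ∀ L m t → L * (m * t) ≡ m * (L * t)
      e = solve-∀

  removed : Mat n
  removed x y = ind (R x y) * ind (not (R′ x y))

  private
    restricted : Mat n → Fin K → Fin K → ℕ
    restricted P i j = total (λ x y → ind (cell c i x) * (ind (cell c j y) * P x y))

    by-cells : ∀ (P : Mat n) → total P ≡ Σ[ K ] (λ i → Σ[ K ] (restricted P i))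
    by-cells P = trans (Σ-cells c (λ x → Σ[ n ] (P x))) (Σ-cong (λ i → trans
      (Σ-cong (λ x → trans (cong (ind (cell c i x) *_) (Σ-cells c (P x))) (trans (sym (Σ-*ˡ (ind (cell c i x)) (λ j → Σ[ n ] (λ y → ind (cell c j y) * P x y))))
        (Σ-cong (λ j → sym (Σ-*ˡ (ind (cell c i x)) (λ y → ind (cell c j y) * P x y)))))))
      (Σ-swap (λ x j → Σ[ n ] (λ y → ind (cell c i x) * (ind (cell c j y) * P x y))))))

    -- `R` is full on the pair of cells of a bad pair, so whatever `R′` lacks there has been removed
    -- from `R`. Failure of density makes this more than a tenth of the pair of cells.
    bad-at : ∀ x y → ind (bad x y) * (size (cell c (c x)) * size (cell c (c y))) ≤ 10 * restricted removed (c x) (c y)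
    bad-at x y with bad x y in eq
    ... | false = z≤n
    ... | true = begin
        1 * (size (cell c (c x)) * size (cell c (c y))) ≡⟨ *-identityˡ _ ⟩
        size (cell c (c x)) * size (cell c (c y))
          ≤⟨ <⇒≤ (≰⇒> (⌊⌋-false (dense? (c x) (c y)) (not-true (∧-trueʳ {R x y} (∧-trueʳ {large (c x)} eq))))) ⟩
        10 * total (outside R′ (cell c (c x)) (cell c (c y)))
          ≤⟨ *-monoʳ-≤ 10 (total-mono (λ x′ y′ → ≤-trans (≤-reflexive (rearrange (ind (cell c (c x) x′)) (ind (not (R′ x′ y′))) (ind (cell c (c y) y′))))
               (cell-mono c (c x) x′ (λ e → cell-mono c (c y) y′ (λ e′ →
                 *-monoˡ-≤ (ind (not (R′ x′ y′))) (≤-reflexive (sym (cong ind (trans (blk e e′) (∧-trueˡ (∧-trueʳ {large (c x)} eq))))))))))) ⟩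
        10 * restricted removed (c x) (c y) ∎
      where
      open ≤-Reasoning
      not-true : ∀ {b} → not b ≡ true → b ≡ false
      not-true {false} _ = refl
      rearrange : ∀ u r v → u * r * v ≡ u * (v * (1 * r))
      rearrange = solve-∀

    -- Averaging over all pairs in the two cells avoids picking a bad one: multiplied by the number
    -- of pairs, every bad pair contributes that number, which `bad-at` bounds.
    cell-area : ∀ i j → restricted ⟦ bad ⟧ i j ≤ 10 * restricted removed i j
    cell-area i j with size (cell c i) * size (cell c j) in eq
    ... | zero = ≤-trans (subst (restricted ⟦ bad ⟧ i j ≤_) eq bound) z≤n
      where
      bound : restricted ⟦ bad ⟧ i j ≤ size (cell c i) * size (cell c j)
      bound = ≤-trans (total-mono (λ x y → *-monoʳ-≤ (ind (cell c i x)) (≤-trans (*-monoʳ-≤ (ind (cell c j y)) (ind≤1 (bad x y))) (≤-reflexive (*-identityʳ _)))))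
        (≤-reflexive (Σ-* (λ x → ind (cell c i x)) (λ y → ind (cell c j y))))
    ... | suc v₀ = *-cancelʳ-≤ _ _ (suc v₀) (subst (λ v → restricted ⟦ bad ⟧ i j * v ≤ 10 * restricted removed i j * v) eq (begin
        restricted ⟦ bad ⟧ i j * v ≡⟨ sym (total-*ʳ (λ x y → ind (cell c i x) * (ind (cell c j y) * ind (bad x y))) v) ⟩
        total (λ x y → ind (cell c i x) * (ind (cell c j y) * ind (bad x y)) * v)
          ≤⟨ total-mono (λ x y → ≤-trans (≤-reflexive (rearrange (ind (cell c i x)) (ind (cell c j y)) (ind (bad x y)) v))
               (≤-trans (cell-mono c i x (λ e → cell-mono c j y (λ e′ → subst₂ (λ i j → ind (bad x y) * (size (cell c i) * size (cell c j)) ≤ 10 * restricted removed i j) e e′ (bad-at x y))))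
                 (≤-reflexive (sym (*-assoc (ind (cell c i x)) (ind (cell c j y)) (10 * restricted removed i j)))))) ⟩
        total (λ x y → ind (cell c i x) * ind (cell c j y) * (10 * restricted removed i j))
          ≡⟨ total-*ʳ (outer (λ x → ind (cell c i x)) (λ y → ind (cell c j y))) (10 * restricted removed i j) ⟩
        total (outer (λ x → ind (cell c i x)) (λ y → ind (cell c j y))) * (10 * restricted removed i j)
          ≡⟨ trans (cong (_* (10 * restricted removed i j)) (Σ-* (λ x → ind (cell c i x)) (λ y → ind (cell c j y)))) (*-comm v _) ⟩
        10 * restricted removed i j * v ∎))
      where
      open ≤-Reasoning
      v = size (cell c i) * size (cell c j)
      total-*ʳ : ∀ (P : Mat n) k → total (λ x y → P x y * k) ≡ total P * k
      total-*ʳ P k = trans (Σ-cong (λ x → Σ-*ʳ (P x) k)) (Σ-*ʳ (λ x → Σ[ n ] (P x)) k)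
      rearrange : ∀ u w b v → u * (w * b) * v ≡ u * (w * (b * v))
      rearrange = solve-∀

  bad-area : area bad ≤ 10 * total removed
  bad-area = begin
    area bad ≡⟨ by-cells ⟦ bad ⟧ ⟩
    Σ[ K ] (λ i → Σ[ K ] (restricted ⟦ bad ⟧ i)) ≤⟨ Σ-mono (λ i → Σ-mono (cell-area i)) ⟩
    Σ[ K ] (λ i → Σ[ K ] (λ j → 10 * restricted removed i j))
      ≡⟨ trans (Σ-cong (λ i → Σ-*ˡ 10 (restricted removed i))) (Σ-*ˡ 10 (λ i → Σ[ K ] (restricted removed i))) ⟩
    10 * Σ[ K ] (λ i → Σ[ K ] (restricted removed i)) ≡⟨ cong (10 *_) (sym (by-cells removed)) ⟩
    10 * total removed ∎
    where open ≤-Reasoning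

  removed-area : R′ ⊑ R → total removed + area R′ ≡ area R
  removed-area sub = trans (sym (total-⊕ removed ⟦ R′ ⟧)) (total-cong (λ x y → pointwise (R x y) (R′ x y) (sub x y)))
    where
    pointwise : ∀ r r′ → ind r′ ≤ ind r → ind r * ind (not r′) + ind r′ ≡ ind r
    pointwise false false _ = refl
    pointwise true false _ = refl
    pointwise true true _ = refl

  -- The sizes concern cells of the old model, whereas density and domination concern `R′`. So the
  -- precision demanded of `R′` may depend on `L`, and thereby on the number of old cells.
  keep-no-closed-walk : ∀ C M s (a : Mat n) → 0 < n → s * s ≤ n →
    (∀ x → Σ[ n ] (a x) ≤ M * s) → (∀ y → Σ[ n ] (λ x → a x y) ≤ M * s) →
    Parameters.sparsity C M L * total (excess a) ≤ n * n → Parameters.sparsity C M L * closed5 a ≤ n * n * s →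
    Dominates (Parameters.regularity C M L) (C * s) a ⟦ R′ ⟧ →
    ∀ {x₁ x₂ x₃ x₄ x₅} → keep x₁ x₂ ≡ true → keep x₂ x₃ ≡ true → keep x₃ x₄ ≡ true → keep x₄ x₅ ≡ true → keep x₅ x₁ ≡ true → ⊥
  keep-no-closed-walk C M s a pos s²≤n row col hX hW dom {x₁} {x₂} {x₃} {x₄} {x₅} k₁ k₂ k₃ k₄ k₅ =
    Parameters.no-closed-walk C M L s a R′ pos s²≤n row col hX hW dom
      (cell c (c x₁)) (cell c (c x₂)) (cell c (c x₃)) (cell c (c x₄)) (cell c (c x₅))
      (keep-large k₁) (keep-large k₂) (keep-large k₃) (keep-large k₄) (keep-large k₅)
      (keep-dense k₁) (keep-dense k₂) (keep-dense k₃) (keep-dense k₄) (keep-dense k₅)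

-- Iterating the weak regularity step

NoClosedWalk : ∀ {n} → Region n → Set
NoClosedWalk keep = ∀ {x₁ x₂ x₃ x₄ x₅} →
  keep x₁ x₂ ≡ true → keep x₂ x₃ ≡ true → keep x₃ x₄ ≡ true → keep x₄ x₅ ≡ true → keep x₅ x₁ ≡ true → ⊥

-- s replaces √n, up to a factor of 2, so that all exponents are integral.
record SparseMatrix (m D n s : ℕ) : Set where
  field
    matrix      : Mat n
    symmetric   : ∀ x y → matrix x y ≡ matrix y x
    nonempty    : 0 < n
    s²≤n        : s * s ≤ n
    n≤4s²       : n ≤ 4 * (s * s)
    row-sum     : ∀ x → Σ[ n ] (matrix x) ≤ m
    few-C4      : D * total (excess matrix) ≤ n * n
    few-walks   : D * closed5 matrix ≤ n * n * s

  column-sum : ∀ y → Σ[ n ] (λ x → matrix x y) ≤ m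
  column-sum y = subst (_≤ m) (Σ-cong (symmetric y)) (row-sum y)

  s-positive : 0 < s
  s-positive = positive-root s n≤4s²
    where
    positive-root : ∀ s → n ≤ 4 * (s * s) → 0 < s
    positive-root zero h = ⊥-elim (<⇒≱ nonempty h)
    positive-root (suc _) _ = s≤s z≤n

relax : ∀ {m D D′ n s} → D′ ≤ D → SparseMatrix m D n s → SparseMatrix m D′ n s
relax le G = record
  { matrix = matrix ; symmetric = symmetric ; nonempty = nonempty ; s²≤n = s²≤n ; n≤4s² = n≤4s² ; row-sum = row-sum
  ; few-C4 = ≤-trans (*-monoˡ-≤ _ le) few-C4
  ; few-walks = ≤-trans (*-monoˡ-≤ _ le) few-walks }
  where open SparseMatrix G

module Iteration (N : ℕ) .{{_ : NonZero N}} where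
  -- Each constant brings one kind of loss down to n * s / N, by n ≤ 4 * (s * s). Vertices of degree
  -- above M * s carry at most 3 * n * n / (M * s) edges. At most n * n / (C * s) lie outside `R`.
  -- `θ` answers the three terms n * s * s that `edges-in-small-area` leaves, and the 40 in `T` is
  -- 10 from `bad-area` times 4.
  M C θ T : ℕ
  M = 12 * N
  C = 4 * N
  θ = 3 * N
  T = 40 * (θ * θ)

  -- At most K cells have fewer than n / cellBound K vertices; with degrees at most M * s their
  -- vertices carry at most n * s / N edges. The second summand of `density` supplies the bound on
  -- `excess` for `edges-in-small-area`.
  cellBound reg density : ℕ → ℕ
  cellBound K = N * M * K
  reg K = Parameters.regularity C M (cellBound K)
  density K = Parameters.sparsity C M (cellBound K) + K * cellBound K

  -- All rounds use the same graph, so its sparsity has to serve every round that may occur. The sum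
  -- over the rounds bounds each of the demands.
  threshold : ℕ → ℕ → ℕ
  threshold zero K = density K
  threshold (suc f) K = density K + threshold f (labels (reg K) K)

  density≤threshold : ∀ f K → density K ≤ threshold f K
  density≤threshold zero K = ≤-refl
  density≤threshold (suc f) K = m≤m+n _ _

  instance
    M-nonZero : NonZero M
    M-nonZero = m*n≢0 12 N

  module _ {n s K : ℕ} .{{_ : NonZero K}} (G : SparseMatrix (M * s) (density K) n s)
           (c : Fin n → Fin K) (R : Region n) (blk : IsBlock c R)
           (paid : C * s * missed (SparseMatrix.matrix G) R + area R ≤ n * n)
           (S : Shrunk (reg K) (C * s) (SparseMatrix.matrix G) R (labels (reg K) K))
           (stalled : T * area R ≤ T * area (Shrunk.region S) + n * n) where
    open SparseMatrix G
    private
      module S = Shrunk S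
      L = cellBound K
    open Cleaning c R S.region blk L

    private
      instance
        s-nonZero : NonZero s
        s-nonZero = >-nonZero s-positive
        MK-nonZero : NonZero (M * K)
        MK-nonZero = m*n≢0 M K
        L-nonZero : NonZero L
        L-nonZero = m*n≢0 (N * M) K {{m*n≢0 N M}}

      small : ∀ t → L * t ≤ M * s * (K * n) → N * t ≤ n * s
      small t h = *-cancelˡ-≤ (M * K) (≤-trans (≤-reflexive (e₁ N M K t)) (≤-trans h (≤-reflexive (e₂ M s K n))))
        where
        e₁ : ∀ N M K t → M * K * (N * t) ≡ N * M * K * t
        e₁ = solve-∀
        e₂ : ∀ M s K n → M * s * (K * n) ≡ M * K * (n * s)
        e₂ = solve-∀

      n²≤ : n * n ≤ n * (4 * (s * s))
      n²≤ = *-monoʳ-≤ n n≤4s²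

      outside-region : N * missed matrix R ≤ n * s
      outside-region = *-cancelˡ-≤ (4 * s) {{m*n≢0 4 s}} (begin
        4 * s * (N * missed matrix R) ≡⟨ e₁ N s (missed matrix R) ⟩
        C * s * missed matrix R ≤⟨ ≤-trans (m≤m+n _ (area R)) (≤-trans paid n²≤) ⟩
        n * (4 * (s * s)) ≡⟨ e₂ n s ⟩
        4 * s * (n * s) ∎)
        where
        open ≤-Reasoning
        e₁ : ∀ N s t → 4 * s * (N * t) ≡ 4 * N * s * t
        e₁ = solve-∀
        e₂ : ∀ n s → n * (4 * (s * s)) ≡ 4 * s * (n * s)
        e₂ = solve-∀

      removed-small : T * total removed ≤ n * n
      removed-small = +-cancelʳ-≤ (T * area S.region) _ _ (begin
        T * total removed + T * area S.region ≡⟨ sym (*-distribˡ-+ T (total removed) (area S.region)) ⟩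
        T * (total removed + area S.region) ≡⟨ cong (T *_) (removed-area S.shrinks) ⟩
        T * area R ≤⟨ stalled ⟩
        T * area S.region + n * n ≡⟨ +-comm (T * area S.region) (n * n) ⟩
        n * n + T * area S.region ∎)
        where open ≤-Reasoning

      θ²area : θ * θ * area bad ≤ n * (s * s)
      θ²area = *-cancelˡ-≤ 40 (begin
        40 * (θ * θ * area bad) ≡⟨ sym (*-assoc 40 (θ * θ) (area bad)) ⟩
        T * area bad ≤⟨ *-monoʳ-≤ T bad-area ⟩
        T * (10 * total removed) ≡⟨ e₁ T (total removed) ⟩
        10 * (T * total removed) ≤⟨ *-monoʳ-≤ 10 (≤-trans removed-small n²≤) ⟩
        10 * (n * (4 * (s * s))) ≡⟨ e₂ n s ⟩
        40 * (n * (s * s)) ∎)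
        where
        open ≤-Reasoning
        e₁ : ∀ T r → T * (10 * r) ≡ 10 * (T * r)
        e₁ = solve-∀
        e₂ : ∀ n s → 10 * (n * (4 * (s * s))) ≡ 40 * (n * (s * s))
        e₂ = solve-∀

      in-bad-cells : N * total (λ x y → matrix x y * ind (bad x y)) ≤ n * s
      in-bad-cells = *-cancelˡ-≤ (3 * s) {{m*n≢0 3 s}} (begin
        3 * s * (N * t) ≡⟨ e₁ N s t ⟩
        θ * s * t ≤⟨ edges-in-small-area c matrix symmetric bad bad-fibred L bad-large
                       (≤-trans (*-monoˡ-≤ (total (excess matrix)) (m≤n+m (K * L) (Parameters.sparsity C M L))) few-C4) θ s ⟩
        θ * θ * area bad + 2 * (s * s * n) ≤⟨ +-monoˡ-≤ (2 * (s * s * n)) θ²area ⟩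
        n * (s * s) + 2 * (s * s * n) ≡⟨ e₂ n s ⟩
        3 * s * (n * s) ∎)
        where
        open ≤-Reasoning
        t = total (λ x y → matrix x y * ind (bad x y))
        e₁ : ∀ N s t → 3 * s * (N * t) ≡ 3 * N * s * t
        e₁ = solve-∀
        e₂ : ∀ n s → n * (s * s) + 2 * (s * s * n) ≡ 3 * s * (n * s)
        e₂ = solve-∀

    lost-few : N * missed matrix keep ≤ 4 * (n * s)
    lost-few = begin
      N * missed matrix keep ≤⟨ *-monoʳ-≤ N (lost-split matrix) ⟩
      N * (t₁ + t₂ + t₃ + t₄) ≡⟨ e₁ N t₁ t₂ t₃ t₄ ⟩
      N * t₁ + N * t₂ + N * t₃ + N * t₄
        ≤⟨ +-mono-≤ (+-mono-≤ (+-mono-≤ (small t₁ (lost-smallˡ matrix row-sum column-sum)) (small t₂ (lost-smallʳ matrix row-sum column-sum)))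
             outside-region) in-bad-cells ⟩
      n * s + n * s + n * s + n * s ≡⟨ e₂ (n * s) ⟩
      4 * (n * s) ∎
      where
      open ≤-Reasoning
      t₁ = total (λ x y → matrix x y * ind (not (large (c x))))
      t₂ = total (λ x y → matrix x y * ind (not (large (c y))))
      t₃ = missed matrix R
      t₄ = total (λ x y → matrix x y * ind (bad x y))
      e₁ : ∀ N a b c d → N * (a + b + c + d) ≡ N * a + N * b + N * c + N * d
      e₁ = solve-∀
      e₂ : ∀ k → k + k + k + k ≡ 4 * k
      e₂ = solve-∀

    cleaned : Σ[ keep ∈ Region n ] (N * missed matrix keep ≤ 4 * (n * s) × NoClosedWalk keep)
    cleaned = keep , lost-few ,
      keep-no-closed-walk C M s matrix nonempty s²≤n row-sum column-sum
        (≤-trans (*-monoˡ-≤ (total (excess matrix)) sparsity≤) few-C4)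
        (≤-trans (*-monoˡ-≤ (closed5 matrix) sparsity≤) few-walks) S.dominated
      where
      sparsity≤ : Parameters.sparsity C M L ≤ density K
      sparsity≤ = m≤m+n (Parameters.sparsity C M L) (K * L)

  -- `f` bounds the number of rounds to come: a round that does not stall takes more than n * n / T
  -- from the area.
  clean : ∀ f K .{{_ : NonZero K}} {n s} (G : SparseMatrix (M * s) (threshold f K) n s) →
    let open SparseMatrix G in
    (c : Fin n → Fin K) (R : Region n) → IsBlock c R →
    C * s * missed matrix R + area R ≤ n * n → T * area R ≤ f * (n * n) →
    Σ[ keep ∈ Region n ] (N * missed matrix keep ≤ 4 * (n * s) × NoClosedWalk keep)
  clean f K {n} {s} G c R blk paid fuel = continue (T * area R ≤? T * area S.region + n * n) f refl
    where
    open SparseMatrix G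
    S : Shrunk (reg K) (C * s) matrix R (labels (reg K) K)
    -- The region has area at most n * n and every cut takes n * n / reg K, so reg K cuts are
    -- enough.
    S = shrink (reg K) (C * s) matrix (reg K) c R blk paid (*-monoʳ-≤ (reg K) (≤-trans (m≤n+m (area R) _) paid))
    module S = Shrunk S
    continue : Dec (T * area R ≤ T * area S.region + n * n) → ∀ f′ → f′ ≡ f →
      Σ[ keep ∈ Region n ] (N * missed matrix keep ≤ 4 * (n * s) × NoClosedWalk keep)
    continue (yes stalled) _ _ = cleaned (relax (density≤threshold f K) G) c R blk paid S stalled
    continue (no progress) zero refl = ⊥-elim (progress (≤-trans fuel z≤n))
    continue (no progress) (suc f′) refl =
      clean f′ (labels (reg K) K) {{>-nonZero (≤-trans (>-nonZero⁻¹ K) (K≤labels (reg K) K))}}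
        (relax (m≤n+m (threshold f′ (labels (reg K) K)) (density K)) G) S.label S.region S.isBlock S.charged
        (+-cancelˡ-≤ (n * n) _ _ (≤-trans (≤-reflexive (+-comm (n * n) _)) (≤-trans (<⇒≤ (≰⇒> progress)) fuel)))

-- Counting labelled cycles

⟪_⟫ : ∀ {n} → Graph n → Mat n
⟪ G ⟫ x y = ind (adj G x y)

⟪⟫-sym : ∀ {n} (G : Graph n) x y → ⟪ G ⟫ x y ≡ ⟪ G ⟫ y x
⟪⟫-sym G x y = cong ind (Graph.sym G x y)

labelledC4 labelledC5 : ∀ {n} → Graph n → ℕ
labelledC4 {n} G = Σ[ n ] λ a → Σ[ n ] λ b → Σ[ n ] λ c → Σ[ n ] λ d → ind (cyc4 G a b c d)
labelledC5 {n} G = Σ[ n ] λ a → Σ[ n ] λ b → Σ[ n ] λ c → Σ[ n ] λ d → Σ[ n ] λ e → ind (cyc5 G a b c d e)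

infixr 5 _∧ᵗ_
_∧ᵗ_ : ∀ {b c} → b ≡ true → c ≡ true → b ∧ c ≡ true
refl ∧ᵗ h = h

≢⇒≠ᵇ : ∀ {n} {a b : Fin n} → ¬ a ≡ b → (a ≠ᵇ b) ≡ true
≢⇒≠ᵇ {a = a} {b} h with a F.≟ b
... | yes e = ⊥-elim (h e)
... | no _ = refl

≠ᵇ⇒≢ : ∀ {n} {a b : Fin n} → (a ≠ᵇ b) ≡ true → ¬ a ≡ b
≠ᵇ⇒≢ {a = a} {b} h with a F.≟ b
≠ᵇ⇒≢ () | yes _
... | no a≢b = a≢b

adjacent⇒≢ : ∀ {n} (G : Graph n) {a b} → adj G a b ≡ true → ¬ a ≡ b
adjacent⇒≢ G {a} h refl with trans (sym h) (Graph.irrefl G a)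
... | ()

ind-mono : ∀ {u v} → (u ≡ true → v ≡ true) → ind u ≤ ind v
ind-mono {true} {v} h = ≤-reflexive (sym (cong ind (h refl)))
ind-mono {false} h = z≤n

product≤ind : ∀ u v {b} → (u ≡ true → v ≡ true → b ≡ true) → ind u * ind v ≤ ind b
product≤ind u v h = ≤-trans (≤-reflexive (sym (ind-∧ u v))) (ind-mono (λ uv → h (∧-trueˡ uv) (∧-trueʳ {u} uv)))

cyc4-intro : ∀ {n} (G : Graph n) {a b c d} → ¬ a ≡ c → ¬ b ≡ d →
  adj G a b ≡ true → adj G b c ≡ true → adj G c d ≡ true → adj G d a ≡ true → cyc4 G a b c d ≡ true
cyc4-intro G ac bd ab bc cd da =
  (ab ∧ᵗ bc ∧ᵗ cd ∧ᵗ da) ∧ᵗ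
  (≢⇒≠ᵇ (adjacent⇒≢ G ab) ∧ᵗ ≢⇒≠ᵇ ac ∧ᵗ ≢⇒≠ᵇ (≢-sym (adjacent⇒≢ G da)) ∧ᵗ ≢⇒≠ᵇ (adjacent⇒≢ G bc) ∧ᵗ ≢⇒≠ᵇ bd ∧ᵗ ≢⇒≠ᵇ (adjacent⇒≢ G cd))

cyc5-intro : ∀ {n} (G : Graph n) {a b c d e} → ¬ a ≡ c → ¬ b ≡ d → ¬ c ≡ e → ¬ d ≡ a → ¬ e ≡ b →
  adj G a b ≡ true → adj G b c ≡ true → adj G c d ≡ true → adj G d e ≡ true → adj G e a ≡ true → cyc5 G a b c d e ≡ true
cyc5-intro G ac bd ce da eb ab bc cd de ea =
  (ab ∧ᵗ bc ∧ᵗ cd ∧ᵗ de ∧ᵗ ea) ∧ᵗ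
  (≢⇒≠ᵇ (adjacent⇒≢ G ab) ∧ᵗ ≢⇒≠ᵇ ac ∧ᵗ ≢⇒≠ᵇ (≢-sym da) ∧ᵗ ≢⇒≠ᵇ (≢-sym (adjacent⇒≢ G ea)) ∧ᵗ ≢⇒≠ᵇ (adjacent⇒≢ G bc) ∧ᵗ
   ≢⇒≠ᵇ bd ∧ᵗ ≢⇒≠ᵇ (≢-sym eb) ∧ᵗ ≢⇒≠ᵇ (adjacent⇒≢ G cd) ∧ᵗ ≢⇒≠ᵇ ce ∧ᵗ ≢⇒≠ᵇ (adjacent⇒≢ G de))

distinct-pairs : ∀ {n} (h : Fin n → Bool) →
  let k = Σ[ n ] (λ b → ind (h b)) in
  k * k ≡ Σ[ n ] (λ b → Σ[ n ] (λ d → ind (h b) * ind (h d) * ind (b ≠ᵇ d))) + k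
distinct-pairs {n} h = begin
  Σ[ n ] (λ b → ind (h b)) * Σ[ n ] (λ b → ind (h b)) ≡⟨ sym (Σ-* (λ b → ind (h b)) (λ b → ind (h b))) ⟩
  total (λ b d → ind (h b) * ind (h d))
    ≡⟨ total-cong (λ b d → trans (trans (sym (*-identityʳ _)) (cong (ind (h b) * ind (h d) *_) (sym (trans (+-comm _ (ind ⌊ b F.≟ d ⌋)) (ind+ind-not ⌊ b F.≟ d ⌋)))))
         (split (ind (h b)) (ind (h d)) (ind (b ≠ᵇ d)) (ind ⌊ b F.≟ d ⌋))) ⟩
  total (λ b d → ind (h b) * ind (h d) * ind (b ≠ᵇ d) + ind ⌊ b F.≟ d ⌋ * (ind (h b) * ind (h d)))
    ≡⟨ total-⊕ (λ b d → ind (h b) * ind (h d) * ind (b ≠ᵇ d)) (λ b d → ind ⌊ b F.≟ d ⌋ * (ind (h b) * ind (h d))) ⟩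
  total (λ b d → ind (h b) * ind (h d) * ind (b ≠ᵇ d)) + total (λ b d → ind ⌊ b F.≟ d ⌋ * (ind (h b) * ind (h d)))
    ≡⟨ cong (total (λ b d → ind (h b) * ind (h d) * ind (b ≠ᵇ d)) +_)
         (Σ-cong (λ b → trans (Σ-δ b (λ d → ind (h b) * ind (h d))) (ind-idem (h b)))) ⟩
  total (λ b d → ind (h b) * ind (h d) * ind (b ≠ᵇ d)) + Σ[ n ] (λ b → ind (h b)) ∎
  where
  open ≡-Reasoning
  split : ∀ u v p q → u * v * (p + q) ≡ u * v * p + q * (u * v)
  split = solve-∀

pred≤pairs : ∀ k p → k * k ≡ p + k → k ∸ 1 ≤ p
pred≤pairs zero p _ = z≤n
pred≤pairs (suc j) p h = ≤-trans (m≤m*n j (suc j)) (≤-reflexive (+-cancelʳ-≡ (suc j) _ _ (trans (+-comm (j * suc j) (suc j)) h)))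

module _ {n} (G : Graph n) (A : Graph n) (A⊆G : A ⊆ᴳ G) where
  private
    a : Mat n
    a = ⟪ A ⟫

  -- k common neighbours of `x` and `z` form k * (k - 1) ordered pairs of distinct vertices, each
  -- giving a labelled C4 in which `x` and `z` are opposite; and k * (k - 1) ≥ k - 1.
  excess-off-diagonal : ∀ {x z} → ¬ x ≡ z → excess a x z ≤ Σ[ n ] (λ b → Σ[ n ] (λ d → ind (cyc4 G x b z d)))
  excess-off-diagonal {x} {z} x≢z = begin
    codeg a x z ∸ 1 ≡⟨ cong (_∸ 1) (Σ-cong (λ b → sym (ind-∧ (adj A x b) (adj A b z)))) ⟩
    Σ[ n ] (λ b → ind (h b)) ∸ 1 ≤⟨ pred≤pairs _ _ (distinct-pairs h) ⟩
    total (λ b d → ind (h b) * ind (h d) * ind (b ≠ᵇ d)) ≤⟨ total-mono entry ⟩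
    total (λ b d → ind (cyc4 G x b z d)) ∎
    where
    open ≤-Reasoning
    h : Fin n → Bool
    h b = adj A x b ∧ adj A b z
    entry : ∀ b d → ind (h b) * ind (h d) * ind (b ≠ᵇ d) ≤ ind (cyc4 G x b z d)
    entry b d = ≤-trans (≤-reflexive (cong (_* ind (b ≠ᵇ d)) (sym (ind-∧ (h b) (h d))))) (product≤ind (h b ∧ h d) (b ≠ᵇ d) (λ hbd b≠d →
      let hb = ∧-trueˡ hbd ; hd = ∧-trueʳ {h b} hbd in
      cyc4-intro G x≢z (≠ᵇ⇒≢ b≠d) (A⊆G x b (∧-trueˡ hb)) (A⊆G b z (∧-trueʳ {adj A x b} hb))
        (A⊆G z d (trans (Graph.sym A z d) (∧-trueʳ {adj A x d} hd))) (A⊆G d x (trans (Graph.sym A d x) (∧-trueˡ hd)))))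

  excess-entry : ∀ x z → excess a x z ≤
    Σ[ n ] (λ b → Σ[ n ] (λ d → ind (cyc4 G x b z d))) + ind ⌊ x F.≟ z ⌋ * Σ[ n ] (a x)
  excess-entry x z = cases (x F.≟ z)
    where
    open ≤-Reasoning
    cases : Dec (x ≡ z) → excess a x z ≤
      Σ[ n ] (λ b → Σ[ n ] (λ d → ind (cyc4 G x b z d))) + ind ⌊ x F.≟ z ⌋ * Σ[ n ] (a x)
    cases (no x≢z) = ≤-trans (excess-off-diagonal x≢z) (m≤m+n _ _)
    cases (yes refl) = begin
      codeg a x x ∸ 1 ≤⟨ m∸n≤m (codeg a x x) 1 ⟩
      codeg a x x ≤⟨ Σ-mono (λ y → ≤-trans (*-monoʳ-≤ (a x y) (ind≤1 (adj A y x))) (≤-reflexive (*-identityʳ (a x y)))) ⟩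
      Σ[ n ] (a x) ≡⟨ sym (trans (cong (λ b → ind b * Σ[ n ] (a x)) (cell-self (λ y → y) x)) (*-identityˡ _)) ⟩
      ind ⌊ x F.≟ x ⌋ * Σ[ n ] (a x) ≤⟨ m≤n+m _ _ ⟩
      Σ[ n ] (λ b → Σ[ n ] (λ d → ind (cyc4 G x b x d))) + ind ⌊ x F.≟ x ⌋ * Σ[ n ] (a x) ∎

  -- The term `total a` comes from the diagonal, where codegrees are degrees. Under a degree cap of
  -- order √n it is of order n^(3/2), negligible against n^2.
  total-excess : total (excess a) ≤ labelledC4 G + total a
  total-excess = begin
    total (excess a) ≤⟨ total-mono excess-entry ⟩
    total (λ x z → Σ[ n ] (λ b → Σ[ n ] (λ d → ind (cyc4 G x b z d))) + ind ⌊ x F.≟ z ⌋ * Σ[ n ] (a x))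
      ≡⟨ total-⊕ (λ x z → Σ[ n ] (λ b → Σ[ n ] (λ d → ind (cyc4 G x b z d)))) (λ x z → ind ⌊ x F.≟ z ⌋ * Σ[ n ] (a x)) ⟩
    _ ≡⟨ cong₂ _+_ (Σ-cong (λ x → Σ-swap (λ z b → Σ[ n ] (λ d → ind (cyc4 G x b z d))))) (Σ-cong (λ x → Σ-δ x (λ _ → Σ[ n ] (a x)))) ⟩
    labelledC4 G + total a ∎
    where open ≤-Reasoning

total-≤n² : ∀ {n} (P : Mat n) → P ≼ᶜ 1 → total P ≤ n * n
total-≤n² {n} P h = Σ-≤ (λ x → ≤-trans (Σ-≤ (h x)) (≤-reflexive (*-identityʳ n)))

-- The left side counts paths of length two by their middle vertex. Counted by their ends, all but
-- one path for each pair of ends belong to `excess`.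
squared-degrees : ∀ {n} (G : Graph n) →
  Σ[ n ] (λ x → Σ[ n ] (⟪ G ⟫ x) * Σ[ n ] (⟪ G ⟫ x)) ≤ n * n + total (excess ⟪ G ⟫)
squared-degrees {n} G = begin
  Σ[ n ] (λ x → Σ[ n ] (g x) * Σ[ n ] (g x)) ≡⟨ Σ-cong (λ x → sym (Σ-* (g x) (g x))) ⟩
  Σ[ n ] (λ x → Σ[ n ] (λ y → Σ[ n ] (λ z → g x y * g x z))) ≡⟨ Σ-swap (λ x y → Σ[ n ] (λ z → g x y * g x z)) ⟩
  Σ[ n ] (λ y → Σ[ n ] (λ x → Σ[ n ] (λ z → g x y * g x z)))
    ≡⟨ Σ-cong (λ y → trans (Σ-swap (λ x z → g x y * g x z)) (Σ-cong (λ z → Σ-cong (λ x → cong (_* g x z) (⟪⟫-sym G x y))))) ⟩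
  total (codeg g) ≤⟨ total-mono (λ x y → m≤n+m∸n (codeg g x y) 1) ⟩
  total (λ x y → 1 + excess g x y) ≡⟨ total-⊕ (λ _ _ → 1) (excess g) ⟩
  total {n} (λ _ _ → 1) + total (excess g) ≤⟨ +-monoˡ-≤ (total (excess g)) (total-≤n² {n} (λ _ _ → 1) (λ _ _ → ≤-refl)) ⟩
  n * n + total (excess g) ∎
  where
  open ≤-Reasoning
  g = ⟪ G ⟫

-- Closed walks of length five

Σ5 : ∀ {n} → (Fin n → Fin n → Fin n → Fin n → Fin n → ℕ) → ℕ
Σ5 {n} f = Σ[ n ] λ a → Σ[ n ] λ b → Σ[ n ] λ c → Σ[ n ] λ d → Σ[ n ] λ e → f a b c d e

Σ5-rotate : ∀ {n} (f : Fin n → Fin n → Fin n → Fin n → Fin n → ℕ) → Σ5 f ≡ Σ5 (λ a b c d e → f b c d e a)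
Σ5-rotate {n} f = sym (trans (Σ-swap (λ a b → Σ[ n ] λ c → Σ[ n ] λ d → Σ[ n ] λ e → f b c d e a))
  (Σ-cong λ b → trans (Σ-swap (λ a c → Σ[ n ] λ d → Σ[ n ] λ e → f b c d e a))
  (Σ-cong λ c → trans (Σ-swap (λ a d → Σ[ n ] λ e → f b c d e a))
  (Σ-cong λ d → Σ-swap (λ a e → f b c d e a)))))

Σ5-mono : ∀ {n} {f g : Fin n → Fin n → Fin n → Fin n → Fin n → ℕ} → (∀ a b c d e → f a b c d e ≤ g a b c d e) → Σ5 f ≤ Σ5 g
Σ5-mono h = Σ-mono λ a → Σ-mono λ b → Σ-mono λ c → Σ-mono λ d → Σ-mono λ e → h a b c d e

Σ5-+ : ∀ {n} (f g : Fin n → Fin n → Fin n → Fin n → Fin n → ℕ) → Σ5 (λ a b c d e → f a b c d e + g a b c d e) ≡ Σ5 f + Σ5 g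
Σ5-+ {n} f g = trans
  (Σ-cong λ a → trans (Σ-cong λ b → Σ-cong λ c → total-⊕ (f a b c) (g a b c)) (total-⊕ (λ b c → total (f a b c)) (λ b c → total (g a b c))))
  (Σ-+ (λ a → total (λ b c → total (f a b c))) (λ a → total (λ b c → total (g a b c))))

module _ {n} (G : Graph n) (A : Graph n) (A⊆G : A ⊆ᴳ G) where
  private
    a : Mat n
    a = ⟪ A ⟫

    walk pinched : Fin n → Fin n → Fin n → Fin n → Fin n → ℕ
    walk x₁ x₂ x₃ x₄ x₅ = a x₁ x₂ * (a x₂ x₃ * (a x₃ x₄ * (a x₄ x₅ * a x₅ x₁)))
    pinched x₁ x₂ x₃ x₄ x₅ = ind ⌊ x₁ F.≟ x₃ ⌋ * walk x₁ x₂ x₃ x₄ x₅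

    walk-rotate : ∀ x₁ x₂ x₃ x₄ x₅ → walk x₂ x₃ x₄ x₅ x₁ ≡ walk x₁ x₂ x₃ x₄ x₅
    walk-rotate x₁ x₂ x₃ x₄ x₅ = rearrange (a x₁ x₂) (a x₂ x₃) (a x₃ x₄) (a x₄ x₅) (a x₅ x₁)
      where
      rearrange : ∀ p q r s t → q * (r * (s * (t * p))) ≡ p * (q * (r * (s * t)))
      rearrange = solve-∀

    closed5-walks : closed5 a ≡ Σ5 walk
    closed5-walks = begin
      tr (codeg a ⊙ (a ⊙ codeg a)) ≡⟨ tr-assoc a a (a ⊙ (a ⊙ a)) ⟩
      Σ[ n ] (λ x₁ → Σ[ n ] (λ x₂ → a x₁ x₂ * Σ[ n ] (λ x₃ → a x₂ x₃ * Σ[ n ] (λ x₄ → a x₃ x₄ * Σ[ n ] (λ x₅ → a x₄ x₅ * a x₅ x₁)))))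
        ≡⟨ (Σ-cong λ x₁ → Σ-cong λ x₂ → trans (cong (a x₁ x₂ *_) (Σ-cong λ x₃ → trans (cong (a x₂ x₃ *_) (Σ-cong λ x₄ →
             push₁ (a x₃ x₄) (λ x₅ → a x₄ x₅ * a x₅ x₁))) (push₂ (a x₂ x₃) (λ x₄ x₅ → a x₃ x₄ * (a x₄ x₅ * a x₅ x₁)))))
             (push₃ (a x₁ x₂) (λ x₃ x₄ x₅ → a x₂ x₃ * (a x₃ x₄ * (a x₄ x₅ * a x₅ x₁))))) ⟩
      Σ5 walk ∎
      where
      open ≡-Reasoning
      push₁ : ∀ k (f : Fin n → ℕ) → k * Σ[ n ] f ≡ Σ[ n ] (λ x → k * f x)
      push₁ k f = sym (Σ-*ˡ k f)
      push₂ : ∀ k (f : Fin n → Fin n → ℕ) → k * Σ[ n ] (λ x → Σ[ n ] (f x)) ≡ Σ[ n ] (λ x → Σ[ n ] (λ y → k * f x y))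
      push₂ k f = trans (push₁ k _) (Σ-cong (λ x → push₁ k (f x)))
      push₃ : ∀ k (f : Fin n → Fin n → Fin n → ℕ) →
        k * Σ[ n ] (λ x → Σ[ n ] (λ y → Σ[ n ] (f x y))) ≡ Σ[ n ] (λ x → Σ[ n ] (λ y → Σ[ n ] (λ z → k * f x y z)))
      push₃ k f = trans (push₁ k _) (Σ-cong (λ x → push₂ k (f x)))

    walk-ind : ∀ x₁ x₂ x₃ x₄ x₅ → walk x₁ x₂ x₃ x₄ x₅ ≡
      ind (adj A x₁ x₂ ∧ adj A x₂ x₃ ∧ adj A x₃ x₄ ∧ adj A x₄ x₅ ∧ adj A x₅ x₁)
    walk-ind x₁ x₂ x₃ x₄ x₅ = sym (trans (ind-∧ (adj A x₁ x₂) _) (cong (a x₁ x₂ *_) (trans (ind-∧ (adj A x₂ x₃) _)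
      (cong (a x₂ x₃ *_) (trans (ind-∧ (adj A x₃ x₄) _) (cong (a x₃ x₄ *_) (ind-∧ (adj A x₄ x₅) (adj A x₅ x₁))))))))

    pinch : ∀ x₁ x₂ x₃ x₄ x₅ → x₁ ≡ x₃ → walk x₁ x₂ x₃ x₄ x₅ ≤ pinched x₁ x₂ x₃ x₄ x₅
    pinch x₁ x₂ x₃ x₄ x₅ e with x₁ F.≟ x₃
    ... | yes _ = ≤-reflexive (sym (+-identityʳ _))
    ... | no ne = ⊥-elim (ne e)

    -- Neighbours are distinct, so a closed 5-walk that is not a C5 repeats a vertex two steps
    -- apart. The five ways to do so are rotations of `pinched`.
    walk-bound : ∀ x₁ x₂ x₃ x₄ x₅ → walk x₁ x₂ x₃ x₄ x₅ ≤
      ind (cyc5 G x₁ x₂ x₃ x₄ x₅) + pinched x₁ x₂ x₃ x₄ x₅ + pinched x₂ x₃ x₄ x₅ x₁ + pinched x₃ x₄ x₅ x₁ x₂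
        + pinched x₄ x₅ x₁ x₂ x₃ + pinched x₅ x₁ x₂ x₃ x₄
    walk-bound x₁ x₂ x₃ x₄ x₅ = cases (x₁ F.≟ x₃) (x₂ F.≟ x₄) (x₃ F.≟ x₅) (x₄ F.≟ x₁) (x₅ F.≟ x₂)
      where
      open ≤-Reasoning
      r₁ = sym (walk-rotate x₁ x₂ x₃ x₄ x₅)
      r₂ = trans r₁ (sym (walk-rotate x₂ x₃ x₄ x₅ x₁))
      r₃ = trans r₂ (sym (walk-rotate x₃ x₄ x₅ x₁ x₂))
      r₄ = trans r₃ (sym (walk-rotate x₄ x₅ x₁ x₂ x₃))
      p₀ = ind (cyc5 G x₁ x₂ x₃ x₄ x₅)
      p₁ = pinched x₁ x₂ x₃ x₄ x₅
      p₂ = pinched x₂ x₃ x₄ x₅ x₁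
      p₃ = pinched x₃ x₄ x₅ x₁ x₂
      p₄ = pinched x₄ x₅ x₁ x₂ x₃
      p₅ = pinched x₅ x₁ x₂ x₃ x₄
      cases : Dec (x₁ ≡ x₃) → Dec (x₂ ≡ x₄) → Dec (x₃ ≡ x₅) → Dec (x₄ ≡ x₁) → Dec (x₅ ≡ x₂) →
        walk x₁ x₂ x₃ x₄ x₅ ≤ p₀ + p₁ + p₂ + p₃ + p₄ + p₅
      cases (yes e) _ _ _ _ = begin
        _ ≤⟨ pinch x₁ x₂ x₃ x₄ x₅ e ⟩ p₁ ≤⟨ m≤n+m p₁ p₀ ⟩ p₀ + p₁ ≤⟨ m≤m+n _ p₂ ⟩ _ ≤⟨ m≤m+n _ p₃ ⟩ _ ≤⟨ m≤m+n _ p₄ ⟩ _ ≤⟨ m≤m+n _ p₅ ⟩ _ ∎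
      cases _ (yes e) _ _ _ = begin
        _ ≡⟨ r₁ ⟩ _ ≤⟨ pinch x₂ x₃ x₄ x₅ x₁ e ⟩ p₂ ≤⟨ m≤n+m p₂ (p₀ + p₁) ⟩ p₀ + p₁ + p₂ ≤⟨ m≤m+n _ p₃ ⟩ _ ≤⟨ m≤m+n _ p₄ ⟩ _ ≤⟨ m≤m+n _ p₅ ⟩ _ ∎
      cases _ _ (yes e) _ _ = begin
        _ ≡⟨ r₂ ⟩ _ ≤⟨ pinch x₃ x₄ x₅ x₁ x₂ e ⟩ p₃ ≤⟨ m≤n+m p₃ (p₀ + p₁ + p₂) ⟩ p₀ + p₁ + p₂ + p₃ ≤⟨ m≤m+n _ p₄ ⟩ _ ≤⟨ m≤m+n _ p₅ ⟩ _ ∎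
      cases _ _ _ (yes e) _ = begin
        _ ≡⟨ r₃ ⟩ _ ≤⟨ pinch x₄ x₅ x₁ x₂ x₃ e ⟩ p₄ ≤⟨ m≤n+m p₄ (p₀ + p₁ + p₂ + p₃) ⟩ p₀ + p₁ + p₂ + p₃ + p₄ ≤⟨ m≤m+n _ p₅ ⟩ _ ∎
      cases _ _ _ _ (yes e) = begin
        _ ≡⟨ r₄ ⟩ _ ≤⟨ pinch x₅ x₁ x₂ x₃ x₄ e ⟩ p₅ ≤⟨ m≤n+m p₅ (p₀ + p₁ + p₂ + p₃ + p₄) ⟩ _ ∎
      cases (no ac) (no bd) (no ce) (no da) (no eb) = begin
        _ ≡⟨ walk-ind x₁ x₂ x₃ x₄ x₅ ⟩
        _ ≤⟨ ind-mono (λ h →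
               let h₂ = ∧-trueʳ {adj A x₁ x₂} h ; h₃ = ∧-trueʳ {adj A x₂ x₃} h₂ ; h₄ = ∧-trueʳ {adj A x₃ x₄} h₃ in
               cyc5-intro G ac bd ce da eb (A⊆G _ _ (∧-trueˡ h)) (A⊆G _ _ (∧-trueˡ h₂)) (A⊆G _ _ (∧-trueˡ h₃))
                 (A⊆G _ _ (∧-trueˡ h₄)) (A⊆G _ _ (∧-trueʳ {adj A x₄ x₅} h₄))) ⟩
        p₀ ≤⟨ m≤m+n _ p₁ ⟩ p₀ + p₁ ≤⟨ m≤m+n _ p₂ ⟩ _ ≤⟨ m≤m+n _ p₃ ⟩ _ ≤⟨ m≤m+n _ p₄ ⟩ _ ≤⟨ m≤m+n _ p₅ ⟩ _ ∎

    -- A pinched walk runs along an edge at x₁ and back, then around a triangle through x₁.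
    pinched-trace : Σ5 pinched ≡ Σ[ n ] (λ x → codeg a x x * (a ⊙ codeg a) x x)
    pinched-trace = Σ-cong λ x₁ → begin
      Σ[ n ] (λ x₂ → Σ[ n ] λ x₃ → Σ[ n ] λ x₄ → Σ[ n ] λ x₅ → pinched x₁ x₂ x₃ x₄ x₅)
        ≡⟨ (Σ-cong λ x₂ → trans (Σ-cong λ x₃ → inner x₁ x₂ x₃) (Σ-δ x₁ (λ x₃ → a x₁ x₂ * a x₂ x₃ * (a ⊙ codeg a) x₃ x₁))) ⟩
      Σ[ n ] (λ x₂ → a x₁ x₂ * a x₂ x₁ * (a ⊙ codeg a) x₁ x₁) ≡⟨ Σ-*ʳ (λ x₂ → a x₁ x₂ * a x₂ x₁) ((a ⊙ codeg a) x₁ x₁) ⟩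
      codeg a x₁ x₁ * (a ⊙ codeg a) x₁ x₁ ∎
      where
      open ≡-Reasoning
      rearrange : ∀ i p q r s → i * (p * (q * (r * s))) ≡ i * (p * q) * r * s
      rearrange = solve-∀
      rearrange′ : ∀ i p r t → i * p * r * t ≡ i * p * (r * t)
      rearrange′ = solve-∀
      inner : ∀ x₁ x₂ x₃ → Σ[ n ] (λ x₄ → Σ[ n ] λ x₅ → pinched x₁ x₂ x₃ x₄ x₅) ≡
        ind ⌊ x₁ F.≟ x₃ ⌋ * (a x₁ x₂ * a x₂ x₃ * (a ⊙ codeg a) x₃ x₁)
      inner x₁ x₂ x₃ = begin
        Σ[ n ] (λ x₄ → Σ[ n ] λ x₅ → i * walk x₁ x₂ x₃ x₄ x₅)
          ≡⟨ (Σ-cong λ x₄ → trans (Σ-cong λ x₅ → rearrange i (a x₁ x₂) (a x₂ x₃) (a x₃ x₄) (a x₄ x₅ * a x₅ x₁)) (Σ-*ˡ (i * p * a x₃ x₄) (λ x₅ → a x₄ x₅ * a x₅ x₁))) ⟩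
        Σ[ n ] (λ x₄ → i * p * a x₃ x₄ * codeg a x₄ x₁)
          ≡⟨ trans (Σ-cong (λ x₄ → rearrange′ i p (a x₃ x₄) (codeg a x₄ x₁))) (Σ-*ˡ (i * p) (λ x₄ → a x₃ x₄ * codeg a x₄ x₁)) ⟩
        i * p * (a ⊙ codeg a) x₃ x₁ ≡⟨ *-assoc i p _ ⟩
        i * (p * (a ⊙ codeg a) x₃ x₁) ∎
        where
        i = ind ⌊ x₁ F.≟ x₃ ⌋
        p = a x₁ x₂ * a x₂ x₃

  module _ {m : ℕ} (row : ∀ x → Σ[ n ] (a x) ≤ m) where

    total-≤nm : total a ≤ n * m
    total-≤nm = Σ-≤ row

    private
      -- Triangles are counted edge by edge: up to `excess`, an edge lies in at most one.
      triangles : tr (a ⊙ codeg a) ≤ n * m + total (excess a)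
      triangles = begin
        total (λ x y → a x y * codeg a y x) ≤⟨ total-mono (λ x y → pointwise (adj A x y) (codeg a y x)) ⟩
        total (λ x y → a x y + excess a y x) ≡⟨ total-⊕ a (λ x y → excess a y x) ⟩
        total a + total (λ x y → excess a y x) ≤⟨ +-mono-≤ total-≤nm (≤-reflexive (Σ-swap (λ x y → excess a y x))) ⟩
        n * m + total (excess a) ∎
        where
        open ≤-Reasoning
        pointwise : ∀ b k → ind b * k ≤ ind b + (k ∸ 1)
        pointwise false k = z≤n
        pointwise true k = ≤-trans (≤-reflexive (*-identityˡ k)) (m≤n+m∸n k 1)

      pinched-few : Σ5 pinched ≤ m * (n * m + total (excess a))
      pinched-few = begin
        Σ5 pinched ≡⟨ pinched-trace ⟩
        Σ[ n ] (λ x → codeg a x x * (a ⊙ codeg a) x x)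
          ≤⟨ Σ-mono (λ x → *-monoˡ-≤ ((a ⊙ codeg a) x x) (⊙-rowBound {P = a} {Q = a} row (λ x y → ind≤1 (adj A x y)) x x)) ⟩
        Σ[ n ] (λ x → m * (a ⊙ codeg a) x x) ≡⟨ Σ-*ˡ m (λ x → (a ⊙ codeg a) x x) ⟩
        m * tr (a ⊙ codeg a) ≤⟨ *-monoʳ-≤ m triangles ⟩
        m * (n * m + total (excess a)) ∎
        where open ≤-Reasoning

    closed5-few : closed5 a ≤ labelledC5 G + 5 * (m * (n * m + total (excess a)))
    closed5-few = begin
      closed5 a ≡⟨ closed5-walks ⟩
      Σ5 walk ≤⟨ Σ5-mono walk-bound ⟩
      Σ5 (λ x₁ x₂ x₃ x₄ x₅ → ind (cyc5 G x₁ x₂ x₃ x₄ x₅) + f₁ x₁ x₂ x₃ x₄ x₅ + f₂ x₁ x₂ x₃ x₄ x₅ + f₃ x₁ x₂ x₃ x₄ x₅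
        + f₄ x₁ x₂ x₃ x₄ x₅ + f₅ x₁ x₂ x₃ x₄ x₅)
        ≡⟨ trans (Σ5-+ _ f₅) (cong (_+ Σ5 f₅) (trans (Σ5-+ _ f₄) (cong (_+ Σ5 f₄) (trans (Σ5-+ _ f₃) (cong (_+ Σ5 f₃)
             (trans (Σ5-+ _ f₂) (cong (_+ Σ5 f₂) (Σ5-+ f₀ f₁)))))))) ⟩
      labelledC5 G + Σ5 f₁ + Σ5 f₂ + Σ5 f₃ + Σ5 f₄ + Σ5 f₅ ≡⟨ cong₂ _+_ (cong₂ _+_ (cong₂ _+_ (cong (labelledC5 G + Σ5 f₁ +_) e₂) e₃) e₄) e₅ ⟩
      labelledC5 G + P + P + P + P + P ≡⟨ collect (labelledC5 G) P ⟩
      labelledC5 G + 5 * P ≤⟨ +-monoʳ-≤ (labelledC5 G) (*-monoʳ-≤ 5 pinched-few) ⟩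
      labelledC5 G + 5 * (m * (n * m + total (excess a))) ∎
      where
      open ≤-Reasoning
      P = Σ5 pinched
      f₀ f₁ f₂ f₃ f₄ f₅ : Fin n → Fin n → Fin n → Fin n → Fin n → ℕ
      f₀ x₁ x₂ x₃ x₄ x₅ = ind (cyc5 G x₁ x₂ x₃ x₄ x₅)
      f₁ = pinched
      f₂ x₁ x₂ x₃ x₄ x₅ = pinched x₂ x₃ x₄ x₅ x₁
      f₃ x₁ x₂ x₃ x₄ x₅ = pinched x₃ x₄ x₅ x₁ x₂
      f₄ x₁ x₂ x₃ x₄ x₅ = pinched x₄ x₅ x₁ x₂ x₃
      f₅ x₁ x₂ x₃ x₄ x₅ = pinched x₅ x₁ x₂ x₃ x₄
      e₂ : Σ5 f₂ ≡ P
      e₂ = sym (Σ5-rotate f₁)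
      e₃ : Σ5 f₃ ≡ P
      e₃ = trans (sym (Σ5-rotate f₂)) e₂
      e₄ : Σ5 f₄ ≡ P
      e₄ = trans (sym (Σ5-rotate f₃)) e₃
      e₅ : Σ5 f₅ ≡ P
      e₅ = trans (sym (Σ5-rotate f₄)) e₄
      collect : ∀ q p → q + p + p + p + p + p ≡ q + 5 * p
      collect = solve-∀

-- The removal lemma over the natural numbers

edges-lost : ∀ {n} (G H : Graph n) → edges G ∸ edges H ≤ missed ⟪ G ⟫ (adj H)
edges-lost {n} G H = m≤n+o⇒m∸n≤o (edges G) (edges H) (≤-trans
  (total-mono (λ i j → pointwise (i <ᵇ j) (adj G i j) (adj H i j)))
  (≤-reflexive (total-⊕ (λ i j → ind ((i <ᵇ j) ∧ adj H i j)) (λ i j → ⟪ G ⟫ i j * ind (not (adj H i j))))))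
  where
  pointwise : ∀ l g h → ind (l ∧ g) ≤ ind (l ∧ h) + ind g * ind (not h)
  pointwise false g h = z≤n
  pointwise true false h = z≤n
  pointwise true true false = ≤-refl
  pointwise true true true = ≤-refl

-- This provides the cap on row and column sums that `closed5-lower` uses. A vertex above the cap
-- `m` has m * degree at most its squared degree, so `squared-degrees` bounds the edges given up.
module LowDegree {n} (G : Graph n) (m : ℕ) where
  degree : Fin n → ℕ
  degree x = Σ[ n ] (⟪ G ⟫ x)

  low : Fin n → Bool
  low x = ⌊ degree x ≤? m ⌋

  lowPart : Graph n
  lowPart .Graph.adj x y = adj G x y ∧ low x ∧ low y
  lowPart .Graph.sym x y = cong₂ _∧_ (Graph.sym G x y) (∧-comm (low x) (low y))
  lowPart .Graph.irrefl x = cong (_∧ (low x ∧ low x)) (Graph.irrefl G x)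

  lowPart⊆ : lowPart ⊆ᴳ G
  lowPart⊆ x y h = ∧-trueˡ h

  lowPart-degree : ∀ x → Σ[ n ] (⟪ lowPart ⟫ x) ≤ m
  lowPart-degree x with degree x ≤? m
  ... | yes h = ≤-trans (Σ-mono (λ y → ind-mono {v = adj G x y} ∧-trueˡ)) h
  ... | no _ = ≤-trans (Σ-≤ {k = 0} (λ y → zero-entry (adj G x y))) (≤-trans (≤-reflexive (*-zeroʳ n)) z≤n)
    where
    zero-entry : ∀ b → ind (b ∧ false) ≤ 0
    zero-entry false = z≤n
    zero-entry true = z≤n

  atHigh : ℕ
  atHigh = total (λ x y → ⟪ G ⟫ x y * ind (not (low x)))

  atHigh-few : m * atHigh ≤ n * n + total (excess ⟪ G ⟫)
  atHigh-few = begin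
    m * atHigh ≡⟨ cong (m *_) (Σ-cong (λ x → Σ-*ʳ (⟪ G ⟫ x) (ind (not (low x))))) ⟩
    m * Σ[ n ] (λ x → degree x * ind (not (low x))) ≡⟨ sym (Σ-*ˡ m (λ x → degree x * ind (not (low x)))) ⟩
    Σ[ n ] (λ x → m * (degree x * ind (not (low x)))) ≤⟨ Σ-mono square ⟩
    Σ[ n ] (λ x → degree x * degree x) ≤⟨ squared-degrees G ⟩
    n * n + total (excess ⟪ G ⟫) ∎
    where
    open ≤-Reasoning
    square : ∀ x → m * (degree x * ind (not (low x))) ≤ degree x * degree x
    square x with degree x ≤? m
    ... | yes _ = ≤-trans (≤-reflexive (trans (cong (m *_) (*-zeroʳ (degree x))) (*-zeroʳ m))) z≤n
    ... | no h = ≤-trans (*-mono-≤ (<⇒≤ (≰⇒> h)) (≤-reflexive (*-identityʳ (degree x)))) ≤-refl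

record Removal (N : ℕ) : Set where
  field
    d s₀ : ℕ
    remove : ∀ {n s} (G : Graph n) → 0 < n → s * s ≤ n → n ≤ 4 * (s * s) → s₀ ≤ s →
      d * labelledC4 G ≤ n * n → d * labelledC5 G ≤ n * n * s →
      Σ[ H ∈ Graph n ] (H ⊆ᴳ G × C3-free H × C5-free H × N * (edges G ∸ edges H) ≤ 10 * (n * s))

module _ (N : ℕ) .{{_ : NonZero N}} where
  open Iteration N
  private
    -- `D` is what up to `T` rounds starting from a single cell demand. The 30 is 2 * 3 * 5: two
    -- shares in `X-small`, three in `walks-small`, and five rotations of a pinched walk. `s₀` makes
    -- the contributions of the degrees, of order n * s to `X` and n * s * s to the walks, small
    -- against n * n and n * n * s.
    D d s₀ : ℕ
    D = threshold T 1
    d = 30 * D * M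
    s₀ = 30 * D * (M * M)

    1≤M : 1 ≤ M
    1≤M = >-nonZero⁻¹ M

    D≤ : ∀ k → D ≤ suc k * D * M
    D≤ k = ≤-trans (m≤m+n D (k * D)) (m≤m*n (suc k * D) M)

    1≤D : 1 ≤ D
    1≤D = ≤-trans (s≤s z≤n) (density≤threshold T 1)

    module Removing {n s} (G : Graph n) (pos : 0 < n) (s²≤n : s * s ≤ n) (n≤4s² : n ≤ 4 * (s * s)) (s₀≤s : s₀ ≤ s)
             (few4 : d * labelledC4 G ≤ n * n) (few5 : d * labelledC5 G ≤ n * n * s) where
      open LowDegree G (M * s)
      A : Graph n
      A = lowPart
      a : Mat n
      a = ⟪ A ⟫
      X : ℕ
      X = total (excess a)

      X-small : 15 * D * M * X ≤ n * n
      X-small = *-cancelˡ-≤ 2 (begin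
        2 * (15 * D * M * X) ≡⟨ e₁ D M X ⟩
        30 * D * M * X ≤⟨ *-monoʳ-≤ d (≤-trans (total-excess G A lowPart⊆) (+-monoʳ-≤ (labelledC4 G) (Σ-≤ lowPart-degree))) ⟩
        30 * D * M * (labelledC4 G + n * (M * s)) ≡⟨ e₂ D M (labelledC4 G) n s ⟩
        30 * D * M * labelledC4 G + 30 * D * (M * M) * s * n ≤⟨ +-mono-≤ few4 (*-monoˡ-≤ n (≤-trans (*-monoˡ-≤ s s₀≤s) s²≤n)) ⟩
        n * n + n * n ≡⟨ e₃ (n * n) ⟩
        2 * (n * n) ∎)
        where
        open ≤-Reasoning
        e₁ : ∀ D M X → 2 * (15 * D * M * X) ≡ 30 * D * M * X
        e₁ = solve-∀
        e₂ : ∀ D M q n s → 30 * D * M * (q + n * (M * s)) ≡ 30 * D * M * q + 30 * D * (M * M) * s * n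
        e₂ = solve-∀
        e₃ : ∀ k → k + k ≡ 2 * k
        e₃ = solve-∀

      walks-small : D * closed5 a ≤ n * n * s
      walks-small = *-cancelˡ-≤ 3 (begin
        3 * (D * closed5 a) ≤⟨ *-monoʳ-≤ 3 (*-monoʳ-≤ D (closed5-few G A lowPart⊆ lowPart-degree)) ⟩
        3 * (D * (labelledC5 G + 5 * (M * s * (n * (M * s) + X)))) ≡⟨ e₁ D M s n X (labelledC5 G) ⟩
        3 * D * labelledC5 G + 15 * D * (M * M) * (s * s) * n + 15 * D * M * X * s
          ≤⟨ +-mono-≤ (+-mono-≤ (≤-trans (*-monoˡ-≤ (labelledC5 G) 3D≤d) few5) (*-monoˡ-≤ n (*-mono-≤ 15≤s s²≤n))) (*-monoˡ-≤ s X-small) ⟩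
        n * n * s + s * n * n + n * n * s ≡⟨ e₂ n s ⟩
        3 * (n * n * s) ∎)
        where
        open ≤-Reasoning
        3D≤d : 3 * D ≤ d
        3D≤d = ≤-trans (*-monoˡ-≤ D {3} {30} (m≤m+n 3 27)) (m≤m*n (30 * D) M)
        15≤s : 15 * D * (M * M) ≤ s
        15≤s = ≤-trans (*-monoˡ-≤ (M * M) (*-monoˡ-≤ D {15} {30} (m≤m+n 15 15))) s₀≤s
        e₁ : ∀ D M s n X q → 3 * (D * (q + 5 * (M * s * (n * (M * s) + X)))) ≡ 3 * D * q + 15 * D * (M * M) * (s * s) * n + 15 * D * M * X * s
        e₁ = solve-∀
        e₂ : ∀ n s → n * n * s + s * n * n + n * n * s ≡ 3 * (n * n * s)
        e₂ = solve-∀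

      sparse : SparseMatrix (M * s) D n s
      sparse = record
        { matrix = a ; symmetric = ⟪⟫-sym A ; nonempty = pos ; s²≤n = s²≤n ; n≤4s² = n≤4s² ; row-sum = lowPart-degree
        ; few-C4 = ≤-trans (*-monoˡ-≤ X (D≤ 14)) X-small
        ; few-walks = walks-small }

      full : Region n
      full _ _ = true

      cleaning : Σ[ keep ∈ Region n ] (N * missed a keep ≤ 4 * (n * s) × NoClosedWalk keep)
      cleaning = clean T 1 sparse (λ _ → zero) full (λ _ _ → refl)
        (begin
          C * s * missed a full + area full ≤⟨ +-monoˡ-≤ (area full) (*-monoʳ-≤ (C * s) nothing-missed) ⟩
          C * s * 0 + area full ≡⟨ cong (_+ area full) (*-zeroʳ (C * s)) ⟩
          area full ≤⟨ full-area ⟩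
          n * n ∎)
        (*-monoʳ-≤ T full-area)
        where
        open ≤-Reasoning
        full-area : area full ≤ n * n
        full-area = total-≤n² ⟦ full ⟧ (λ _ _ → ≤-refl)
        nothing-missed : missed a full ≤ 0
        nothing-missed = ≤-trans (Σ-≤ {k = 0} (λ x → ≤-trans (Σ-≤ {k = 0} (λ y → ≤-reflexive (*-zeroʳ (a x y)))) (≤-reflexive (*-zeroʳ n)))) (≤-reflexive (*-zeroʳ n))

      keep : Region n
      keep = proj₁ cleaning

      -- `keep` need not be symmetric, as the rectangles cut off are not; an edge survives if both
      -- of its orientations are kept.
      H : Graph n
      H .Graph.adj x y = adj A x y ∧ keep x y ∧ keep y x
      H .Graph.sym x y = cong₂ _∧_ (Graph.sym A x y) (∧-comm (keep x y) (keep y x))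
      H .Graph.irrefl x = cong (_∧ (keep x x ∧ keep x x)) (Graph.irrefl A x)

      kept : ∀ {x y} → adj H x y ≡ true → keep x y ≡ true
      kept {x} {y} h = ∧-trueˡ (∧-trueʳ {adj A x y} h)

      kept′ : ∀ {x y} → adj H x y ≡ true → keep y x ≡ true
      kept′ {x} {y} h = ∧-trueʳ {keep x y} (∧-trueʳ {adj A x y} h)

      no-walk : NoClosedWalk keep
      no-walk = proj₂ (proj₂ cleaning)

      -- A triangle abc yields the closed walk abcab.
      H-C3-free : C3-free H
      H-C3-free x y z h =
        let xy = ∧-trueˡ h ; yz = ∧-trueˡ (∧-trueʳ {adj H x y} h) ; zx = ∧-trueʳ {adj H y z} (∧-trueʳ {adj H x y} h) in
        no-walk (kept xy) (kept yz) (kept zx) (kept xy) (kept′ xy)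

      H-C5-free : C5-free H
      H-C5-free x₁ x₂ x₃ x₄ x₅ h =
        let h₁ = ∧-trueˡ h ; h₂ = ∧-trueʳ {adj H x₁ x₂} h₁ ; h₃ = ∧-trueʳ {adj H x₂ x₃} h₂ ; h₄ = ∧-trueʳ {adj H x₃ x₄} h₃ in
        no-walk (kept (∧-trueˡ h₁)) (kept (∧-trueˡ h₂)) (kept (∧-trueˡ h₃)) (kept (∧-trueˡ h₄)) (kept (∧-trueʳ {adj H x₄ x₅} h₄))

      s-positive : 0 < s
      s-positive = SparseMatrix.s-positive sparse

      atHigh-small : N * atHigh ≤ n * s
      atHigh-small = *-cancelˡ-≤ (12 * s) {{m*n≢0 12 s {{_}} {{>-nonZero s-positive}}}} (begin
        12 * s * (N * atHigh) ≡⟨ e₁ N s atHigh ⟩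
        M * s * atHigh ≤⟨ atHigh-few ⟩
        n * n + total (excess ⟪ G ⟫) ≤⟨ +-monoʳ-≤ (n * n) (≤-trans (total-excess G G (λ _ _ h → h)) (+-mono-≤ few4′ (total-≤n² ⟪ G ⟫ (λ x y → ind≤1 (adj G x y))))) ⟩
        n * n + (n * n + n * n) ≡⟨ e₂ n ⟩
        3 * n * n ≤⟨ *-monoʳ-≤ (3 * n) n≤4s² ⟩
        3 * n * (4 * (s * s)) ≡⟨ e₃ n s ⟩
        12 * s * (n * s) ∎)
        where
        open ≤-Reasoning
        few4′ : labelledC4 G ≤ n * n
        few4′ = ≤-trans (≤-trans (≤-reflexive (sym (*-identityˡ _))) (*-monoˡ-≤ (labelledC4 G) (≤-trans 1≤D (D≤ 29)))) few4
        e₁ : ∀ N s t → 12 * s * (N * t) ≡ 12 * N * s * t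
        e₁ = solve-∀
        e₂ : ∀ n → n * n + (n * n + n * n) ≡ 3 * n * n
        e₂ = solve-∀
        e₃ : ∀ n s → 3 * n * (4 * (s * s)) ≡ 12 * s * (n * s)
        e₃ = solve-∀

      missed-H : missed ⟪ G ⟫ (adj H) ≤ atHigh + atHigh + missed a keep + missed a keep
      missed-H = begin
        missed ⟪ G ⟫ (adj H) ≤⟨ total-mono (λ x y → pointwise (adj G x y) (low x) (low y) (keep x y) (keep y x)) ⟩
        total (B₁ ⊕ B₂ ⊕ B₃ ⊕ B₄) ≡⟨ trans (total-⊕ (B₁ ⊕ B₂ ⊕ B₃) B₄) (cong (_+ total B₄) (trans (total-⊕ (B₁ ⊕ B₂) B₃) (cong (_+ total B₃) (total-⊕ B₁ B₂)))) ⟩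
        total B₁ + total B₂ + total B₃ + total B₄
          ≡⟨ cong₂ (λ u v → atHigh + u + missed a keep + v)
               (trans (Σ-swap B₂) (total-cong (λ x y → cong (_* ind (not (low x))) (⟪⟫-sym G y x))))
               (trans (Σ-swap B₄) (total-cong (λ x y → cong (_* ind (not (keep x y))) (⟪⟫-sym A y x)))) ⟩
        atHigh + atHigh + missed a keep + missed a keep ∎
        where
        open ≤-Reasoning
        B₁ B₂ B₃ B₄ : Mat n
        B₁ x y = ⟪ G ⟫ x y * ind (not (low x))
        B₂ x y = ⟪ G ⟫ x y * ind (not (low y))
        B₃ x y = a x y * ind (not (keep x y))
        B₄ x y = a x y * ind (not (keep y x))
        pointwise : ∀ g l l′ k k′ → ind g * ind (not ((g ∧ l ∧ l′) ∧ k ∧ k′)) ≤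
          ind g * ind (not l) + ind g * ind (not l′) + ind (g ∧ l ∧ l′) * ind (not k) + ind (g ∧ l ∧ l′) * ind (not k′)
        pointwise false l l′ k k′ = z≤n
        pointwise true false l′ k k′ = m≤m+n 1 _
        pointwise true true false k k′ = m≤m+n 1 _
        pointwise true true true false k′ = m≤m+n 1 _
        pointwise true true true true k′ = ≤-refl

      -- The 10 is 2 + 8: `atHigh` is lost for either end of an edge, and the 4 * (n * s) from
      -- `clean` for either orientation.
      lost-small : N * (edges G ∸ edges H) ≤ 10 * (n * s)
      lost-small = begin
        N * (edges G ∸ edges H) ≤⟨ *-monoʳ-≤ N (≤-trans (edges-lost G H) missed-H) ⟩
        N * (atHigh + atHigh + missed a keep + missed a keep) ≡⟨ e₁ N atHigh (missed a keep) ⟩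
        2 * (N * atHigh) + 2 * (N * missed a keep) ≤⟨ +-mono-≤ (*-monoʳ-≤ 2 atHigh-small) (*-monoʳ-≤ 2 (proj₁ (proj₂ cleaning))) ⟩
        2 * (n * s) + 2 * (4 * (n * s)) ≡⟨ e₂ (n * s) ⟩
        10 * (n * s) ∎
        where
        open ≤-Reasoning
        e₁ : ∀ N h k → N * (h + h + k + k) ≡ 2 * (N * h) + 2 * (N * k)
        e₁ = solve-∀
        e₂ : ∀ k → 2 * k + 2 * (4 * k) ≡ 10 * k
        e₂ = solve-∀

  removal : Removal N
  removal = record
    { d = d
    ; s₀ = s₀
    ; remove = λ G pos s²≤n n≤4s² s₀≤s few4 few5 → let module R = Removing G pos s²≤n n≤4s² s₀≤s few4 few5 in
        R.H , (λ x y h → ∧-trueˡ (∧-trueˡ h)) , R.H-C3-free , R.H-C5-free , R.lost-small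
    }

-- Integer square roots

square-cancel-≤ : ∀ {x y} → x * x ≤ y * y → x ≤ y
square-cancel-≤ h = ≮⇒≥ (λ y<x → <⇒≱ (*-mono-< y<x y<x) h)

sqrt : ∀ n → Σ[ s ∈ ℕ ] (s * s ≤ n × n < suc s * suc s)
sqrt zero = 0 , z≤n , s≤s z≤n
sqrt (suc n) with sqrt n
... | s , s²≤n , n< with suc s * suc s ≤? suc n
... | yes h = suc s , h , ≤-trans (s≤s n<) (*-mono-< (n<1+n (suc s)) (n<1+n (suc s)))
... | no h = s , m≤n⇒m≤1+n s²≤n , ≰⇒> h

sqrt-≥ : ∀ {n s} s₀ → n < suc s * suc s → s₀ * s₀ ≤ n → s₀ ≤ s
sqrt-≥ {n} {s} s₀ n< h = ≮⇒≥ (λ s<s₀ → <⇒≱ n< (≤-trans (*-mono-≤ s<s₀ s<s₀) h))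

sqrt-≤4 : ∀ {n s} → 1 ≤ s → n < suc s * suc s → n ≤ 4 * (s * s)
sqrt-≤4 {n} {s} 1≤s n< = ≤-trans (<⇒≤ n<) (≤-trans (*-mono-≤ suc≤ suc≤) (≤-reflexive (e s)))
  where
  suc≤ : suc s ≤ s + s
  suc≤ = +-monoˡ-≤ s 1≤s
  e : ∀ s → (s + s) * (s + s) ≡ 4 * (s * s)
  e = solve-∀

-- Translating between rational and natural inequalities

toℚᵘ-ℕ→ℚ : ∀ k → toℚᵘ (ℕ→ℚ k) ℚᵘ.≃ mkℚᵘ (ℤpos k) 0
toℚᵘ-ℕ→ℚ k = ℚ.toℚᵘ-fromℚᵘ (mkℚᵘ (ℤpos k) 0)

≤-unit-fraction : ∀ {r} e x y → toℚᵘ r ℚᵘ.≃ mkℚᵘ (ℤpos 1) e → ℕ→ℚ x ℚ.≤ r ℚ.* ℕ→ℚ y → suc e * x ≤ y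
≤-unit-fraction {r} e x y r≃ h = ≤-trans (≤-reflexive (eq₁ e x)) (≤-trans (ℤ.drop‿+≤+ in-ℤ) (≤-reflexive (eq₂ y)))
  where
  open ℚᵘ.≤-Reasoning
  in-ℚᵘ : mkℚᵘ (ℤpos x) 0 ℚᵘ.≤ mkℚᵘ (ℤpos 1) e ℚᵘ.* mkℚᵘ (ℤpos y) 0
  in-ℚᵘ = begin
    mkℚᵘ (ℤpos x) 0 ≃⟨ ℚᵘ.≃-sym (toℚᵘ-ℕ→ℚ x) ⟩
    toℚᵘ (ℕ→ℚ x) ≤⟨ ℚ.toℚᵘ-mono-≤ h ⟩
    toℚᵘ (r ℚ.* ℕ→ℚ y) ≃⟨ ℚ.toℚᵘ-homo-* r (ℕ→ℚ y) ⟩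
    toℚᵘ r ℚᵘ.* toℚᵘ (ℕ→ℚ y) ≃⟨ ℚᵘ.*-cong r≃ (toℚᵘ-ℕ→ℚ y) ⟩
    mkℚᵘ (ℤpos 1) e ℚᵘ.* mkℚᵘ (ℤpos y) 0 ∎
  in-ℤ : ℤpos (x * (suc e * 1)) ℤ.≤ ℤpos (1 * y * 1)
  in-ℤ = subst₂ ℤ._≤_ (sym (ℤ.pos-* x (suc e * 1))) (sym (trans (ℤ.pos-* (1 * y) 1) (cong (ℤ._* ℤpos 1) (ℤ.pos-* 1 y)))) (ℚᵘ.drop-*≤* in-ℚᵘ)
  eq₁ : ∀ e x → suc e * x ≡ x * (suc e * 1)
  eq₁ = solve-∀
  eq₂ : ∀ y → 1 * y * 1 ≡ y
  eq₂ = solve-∀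

-- The numerator is at least 1 and is replaced by 1, so the amount of removal needed is governed by
-- the denominator alone.
fraction-≤ : ∀ {r} p e x y → toℚᵘ r ℚᵘ.≃ mkℚᵘ (ℤpos (suc p)) e → suc e * x ≤ y → ℕ→ℚ x ℚ.≤ r ℚ.* ℕ→ℚ y
fraction-≤ {r} p e x y r≃ h = ℚ.toℚᵘ-cancel-≤ (begin
    toℚᵘ (ℕ→ℚ x) ≃⟨ toℚᵘ-ℕ→ℚ x ⟩
    mkℚᵘ (ℤpos x) 0 ≤⟨ *≤* in-ℤ ⟩
    mkℚᵘ (ℤpos (suc p)) e ℚᵘ.* mkℚᵘ (ℤpos y) 0 ≃⟨ ℚᵘ.≃-sym (ℚᵘ.*-cong r≃ (toℚᵘ-ℕ→ℚ y)) ⟩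
    toℚᵘ r ℚᵘ.* toℚᵘ (ℕ→ℚ y) ≃⟨ ℚᵘ.≃-sym (ℚ.toℚᵘ-homo-* r (ℕ→ℚ y)) ⟩
    toℚᵘ (r ℚ.* ℕ→ℚ y) ∎)
  where
  open ℚᵘ.≤-Reasoning
  in-ℤ : ℤpos x ℤ.* ℤpos (suc e * 1) ℤ.≤ (ℤpos (suc p) ℤ.* ℤpos y) ℤ.* ℤpos 1
  in-ℤ = subst₂ ℤ._≤_ (ℤ.pos-* x (suc e * 1)) (trans (ℤ.pos-* (suc p * y) 1) (cong (ℤ._* ℤpos 1) (ℤ.pos-* (suc p) y)))
    (ℤ.+≤+ (≤-trans (≤-reflexive (eq₁ e x)) (≤-trans h (≤-trans (m≤m+n y (p * y)) (≤-reflexive (sym (*-identityʳ (suc p * y))))))))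
    where
    eq₁ : ∀ e x → x * (suc e * 1) ≡ suc e * x
    eq₁ = solve-∀

positive-fraction : ∀ (ε : ℚ) → 0ℚ ℚ.< ε → Σ[ p ∈ ℕ ] Σ[ q ∈ ℕ ] toℚᵘ ε ≡ mkℚᵘ (ℤpos (suc p)) q
positive-fraction (mkℚ (ℤpos (suc p)) q _) _ = p , q , refl
positive-fraction (mkℚ (ℤpos zero) q _) (ℚ.*<* (ℤ.+<+ ()))
positive-fraction (mkℚ -[1+ _ ] q _) (ℚ.*<* ())

square-≃ : ∀ {r} p e → toℚᵘ r ℚᵘ.≃ mkℚᵘ p e → toℚᵘ (r ℚ.* r) ℚᵘ.≃ mkℚᵘ p e ℚᵘ.* mkℚᵘ p e
square-≃ {r} p e h = ℚᵘ.≃-trans (ℚ.toℚᵘ-homo-* r r) (ℚᵘ.*-cong h h)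

-- From copies to labelled cycles

labelled≤ : ∀ m k .{{_ : NonZero k}} → m ≤ k + k * (m / k)
labelled≤ m k = begin
  m ≡⟨ m≡m%n+[m/n]*n m k ⟩
  m % k + (m / k) * k ≤⟨ +-mono-≤ (<⇒≤ (m%n<n m k)) (≤-reflexive (*-comm (m / k) k)) ⟩
  k + k * (m / k) ∎
  where open ≤-Reasoning

1/ : ℕ → ℚ
1/ e = fromℚᵘ (mkℚᵘ (ℤpos 1) e)

1/-positive : ∀ e → 0ℚ ℚ.< 1/ e
1/-positive e = ℚ.positive⁻¹ (1/ e) {{ℚ.normalize-pos 1 (suc e)}}

-- Rounding in Q / k hides fewer than 10 labelled cycles, which 40 * d ≤ B absorbs. The 2 in 2 * B
-- allows for n^(5/2) ≤ 2 * (n * n * s), and 40 leaves room for the resulting 10 + 20.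
few : ∀ d e k .{{_ : NonZero k}} → 40 * d ≤ e → k ≤ 10 → ∀ Q B → e * (Q / k) ≤ 2 * B → 40 * d ≤ B → d * Q ≤ B
few d e k 40d≤e k≤ Q B h h′ = *-cancelˡ-≤ 40 (begin
  40 * (d * Q) ≤⟨ *-monoʳ-≤ 40 (*-monoʳ-≤ d (≤-trans (labelled≤ Q k) (+-mono-≤ k≤ (*-monoˡ-≤ c k≤)))) ⟩
  40 * (d * (10 + 10 * c)) ≡⟨ eq₁ d c ⟩
  10 * (40 * d) + 10 * (40 * d * c) ≤⟨ +-mono-≤ (*-monoʳ-≤ 10 h′) (*-monoʳ-≤ 10 (≤-trans (*-monoˡ-≤ c 40d≤e) h)) ⟩
  10 * B + 10 * (2 * B) ≤⟨ m≤m+n _ (10 * B) ⟩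
  10 * B + 10 * (2 * B) + 10 * B ≡⟨ eq₂ B ⟩
  40 * B ∎)
  where
  open ≤-Reasoning
  c = Q / k
  eq₁ : ∀ d c → 40 * (d * (10 + 10 * c)) ≡ 10 * (40 * d) + 10 * (40 * d * c)
  eq₁ = solve-∀
  eq₂ : ∀ B → 10 * B + 10 * (2 * B) + 10 * B ≡ 40 * B
  eq₂ = solve-∀

module _ {k : ℕ} (R : Removal (10 * k)) where
  open Removal R

  remove-sqrt : ∀ e → 40 * d ≤ e → ∀ {n} → suc s₀ * suc s₀ + 40 * d ≤ n → (G : Graph n) →
    e * copiesC4 G ≤ n ^ 2 → e * e * copiesC5 G ^ 2 ≤ n ^ 5 →
    Σ[ H ∈ Graph n ] (H ⊆ᴳ G × C3-free H × C5-free H × k * k * (edges G ∸ edges H) ^ 2 ≤ n ^ 3)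
  remove-sqrt e 40d≤e {n} n≥ G h₄ h₅ = conclude (remove G n-positive s²≤n n≤4s² (≤-trans (n≤1+n s₀) s₀<s) few₄ few₅)
    where
    open ≤-Reasoning
    s : ℕ
    s = proj₁ (sqrt n)
    s²≤n : s * s ≤ n
    s²≤n = proj₁ (proj₂ (sqrt n))
    n< : n < suc s * suc s
    n< = proj₂ (proj₂ (sqrt n))
    s₀<s : suc s₀ ≤ s
    s₀<s = sqrt-≥ (suc s₀) n< (≤-trans (m≤m+n _ (40 * d)) n≥)
    1≤s : 1 ≤ s
    1≤s = ≤-trans (s≤s z≤n) s₀<s
    n-positive : 1 ≤ n
    n-positive = ≤-trans (*-mono-≤ 1≤s 1≤s) s²≤n
    n≤4s² : n ≤ 4 * (s * s)
    n≤4s² = sqrt-≤4 1≤s n<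
    40d≤n² : 40 * d ≤ n * n
    40d≤n² = ≤-trans (≤-trans (m≤n+m (40 * d) (suc s₀ * suc s₀)) n≥) (≤-trans (≤-reflexive (sym (*-identityʳ n))) (*-monoʳ-≤ n n-positive))
    few₄ : d * labelledC4 G ≤ n * n
    few₄ = few d e 8 40d≤e (m≤m+n 8 2) (labelledC4 G) (n * n)
      (≤-trans h₄ (≤-trans (≤-reflexive (cong (n *_) (*-identityʳ n))) (m≤m+n (n * n) _))) 40d≤n²
    -- The hypothesis bounds a square, which avoids the exponent 5/2. Since n ≤ 4 * (s * s), its
    -- right side n ^ 5 is at most the square of 2 * (n * n * s), and roots can be taken.
    c₅-few : e * copiesC5 G ≤ 2 * (n * n * s)
    c₅-few = square-cancel-≤ (begin
      e * copiesC5 G * (e * copiesC5 G) ≡⟨ eq₁ e (copiesC5 G) ⟩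
      e * e * (copiesC5 G * (copiesC5 G * 1)) ≤⟨ h₅ ⟩
      n * (n * (n * (n * (n * 1)))) ≡⟨ eq₂ n ⟩
      n * n * (n * n) * n ≤⟨ *-monoʳ-≤ (n * n * (n * n)) n≤4s² ⟩
      n * n * (n * n) * (4 * (s * s)) ≡⟨ eq₃ n s ⟩
      2 * (n * n * s) * (2 * (n * n * s)) ∎)
      where
      eq₁ : ∀ k c → k * c * (k * c) ≡ k * k * (c * (c * 1))
      eq₁ = solve-∀
      eq₂ : ∀ n → n * (n * (n * (n * (n * 1)))) ≡ n * n * (n * n) * n
      eq₂ = solve-∀
      eq₃ : ∀ n s → n * n * (n * n) * (4 * (s * s)) ≡ 2 * (n * n * s) * (2 * (n * n * s))
      eq₃ = solve-∀
    few₅ : d * labelledC5 G ≤ n * n * s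
    few₅ = few d e 10 40d≤e ≤-refl (labelledC5 G) (n * n * s) c₅-few
      (≤-trans 40d≤n² (≤-trans (≤-reflexive (sym (*-identityʳ (n * n)))) (*-monoʳ-≤ (n * n) 1≤s)))
    conclude : Σ[ H ∈ Graph n ] (H ⊆ᴳ G × C3-free H × C5-free H × 10 * k * (edges G ∸ edges H) ≤ 10 * (n * s)) →
      Σ[ H ∈ Graph n ] (H ⊆ᴳ G × C3-free H × C5-free H × k * k * (edges G ∸ edges H) ^ 2 ≤ n ^ 3)
    conclude (H , H⊆G , free₃ , free₅ , lost) = H , H⊆G , free₃ , free₅ , (begin
        k * k * (x * (x * 1)) ≡⟨ eq₁ k x ⟩
        k * x * (k * x) ≤⟨ *-mono-≤ lost′ lost′ ⟩
        n * s * (n * s) ≡⟨ eq₂ n s ⟩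
        n * n * (s * s) ≤⟨ *-monoʳ-≤ (n * n) s²≤n ⟩
        n * n * n ≡⟨ eq₃ n ⟩
        n * (n * (n * 1)) ∎)
      where
      x = edges G ∸ edges H
      lost′ : k * x ≤ n * s
      lost′ = *-cancelˡ-≤ 10 (≤-trans (≤-reflexive (sym (*-assoc 10 k x))) lost)
      eq₁ : ∀ k x → k * k * (x * (x * 1)) ≡ k * x * (k * x)
      eq₁ = solve-∀
      eq₂ : ∀ n s → n * s * (n * s) ≡ n * n * (s * s)
      eq₂ = solve-∀
      eq₃ : ∀ n → n * n * n ≡ n * (n * (n * 1))
      eq₃ = solve-∀

conclude : ∀ (ε : ℚ) p q → toℚᵘ ε ≡ mkℚᵘ (ℤpos (suc p)) q → Removal (10 * suc q) →
  ∃[ δ ] (0ℚ ℚ.< δ × ∃[ n₀ ] (∀ (n : ℕ) → n₀ ≤ n → (G : Graph n) →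
    ℕ→ℚ (copiesC4 G) ℚ.≤ δ ℚ.* ℕ→ℚ (n ^ 2) →
    ℕ→ℚ (copiesC5 G ^ 2) ℚ.≤ (δ ℚ.* δ) ℚ.* ℕ→ℚ (n ^ 5) →
    ∃[ H ] (H ⊆ᴳ G × C3-free H × C5-free H ×
      ℕ→ℚ ((edges G ∸ edges H) ^ 2) ℚ.≤ (ε ℚ.* ε) ℚ.* ℕ→ℚ (n ^ 3))))
-- `1/ e` has denominator e + 1, which is at least the required 40 * d. In the bound on n, the
-- square forces the integer root above `s₀`, and 40 * d absorbs the rounding in the numbers of
-- copies.
conclude ε p q ε≡ R = 1/ e , 1/-positive e , suc s₀ * suc s₀ + 40 * d , λ n n≥ G h₄ h₅ →
  let H , H⊆G , free₃ , free₅ , lost = remove-sqrt R (suc e) (n≤1+n e) n≥ G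
        (≤-unit-fraction e (copiesC4 G) (n ^ 2) δ≃ h₄)
        -- Denominators are stored minus one, and e + e * suc e is the predecessor of suc e * suc e.
        (≤-unit-fraction (e + e * suc e) (copiesC5 G ^ 2) (n ^ 5) (square-≃ {1/ e} (ℤpos 1) e δ≃) h₅)
  in H , H⊆G , free₃ , free₅ ,
    fraction-≤ _ (q + q * suc q) ((edges G ∸ edges H) ^ 2) (n ^ 3) (square-≃ {ε} (ℤpos (suc p)) q (ℚᵘ.≃-reflexive ε≡)) lost
  where
  open Removal R
  e = 40 * d
  δ≃ : toℚᵘ (1/ e) ℚᵘ.≃ mkℚᵘ (ℤpos 1) e
  δ≃ = ℚ.toℚᵘ-fromℚᵘ (mkℚᵘ (ℤpos 1) e)

theorem1p2 : ∀ (ε : ℚ) → 0ℚ ℚ.< ε →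
    ∃[ δ ] (0ℚ ℚ.< δ × ∃[ n₀ ] (∀ (n : ℕ) → n₀ ≤ n → (G : Graph n) →
    ℕ→ℚ (copiesC4 G) ℚ.≤ δ ℚ.* ℕ→ℚ (n ^ 2) →
    ℕ→ℚ (copiesC5 G ^ 2) ℚ.≤ (δ ℚ.* δ) ℚ.* ℕ→ℚ (n ^ 5) →
    ∃[ H ] (H ⊆ᴳ G × C3-free H × C5-free H ×
    ℕ→ℚ ((edges G ∸ edges H) ^ 2) ℚ.≤ (ε ℚ.* ε) ℚ.* ℕ→ℚ (n ^ 3))))
-- The factor 10 cancels the 10 in the loss allowed by `Removal`.
theorem1p2 ε 0<ε = let p , q , ε≡ = positive-fraction ε 0<ε in conclude ε p q ε≡ (removal (10 * suc q))
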